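{- There exists an absolute constant $c>0$ such that for all sufficiently large primes $p$, uniformly over positive integers $d$, integers $\lambda$ coprime to $p$ and real numbers $L$, $$T_p(d,\lambda,L,p/d)<p^{\frac13-c}.$$
   Context: For a prime $p$, $d\in\mathbb N$, an integer $\lambda$ coprime to $p$, and real numbers $L$ and $N\ge1$, $T_p(d,\lambda,L,N)$ denotes the number of integers $x\in\mathbb N$ with $L+1\le x\le L+N$ and $x^d\equiv\lambda\pmod p$. -}

module Defs where

open import Data.Nat as ℕ using (ℕ; suc; NonZero)
open import Data.Nat.Divisibility as ℕD using ()
open import Data.Integer as ℤ using (ℤ; +_; ∣_∣)
open import Data.Integer.Divisibility using (_∣_)
open import Data.Rational as ℚ using (ℚ; _/_; 1ℚ; ceiling)
open import Data.Rational.Properties using (_≤?_)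
open import Data.List using (List; length; filter; upTo)
open import Data.Product using (_×_)
open import Relation.Nullary using (Dec)
open import Relation.Nullary.Decidable using (_×-dec_)

ℕ→ℚ : ℕ → ℚ
ℕ→ℚ x = (+ x) / 1

Cong : (p d : ℕ) (λ′ : ℤ) (x : ℕ) → Set
Cong p d λ′ x = (+ p) ∣ ((+ x) ℤ.^ d ℤ.- λ′)

InT : (p d : ℕ) (λ′ : ℤ) (L N : ℚ) (x : ℕ) → Set
InT p d λ′ L N x = ((L ℚ.+ 1ℚ) ℚ.≤ ℕ→ℚ x × ℕ→ℚ x ℚ.≤ (L ℚ.+ N)) × Cong p d λ′ x

InT? : ∀ p d λ′ L N x → Dec (InT p d λ′ L N x)
InT? p d λ′ L N x =
  (((L ℚ.+ 1ℚ) ≤? ℕ→ℚ x) ×-dec (ℕ→ℚ x ≤? (L ℚ.+ N)))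
  ×-dec (∣ + p ∣ ℕD.∣? ∣ (+ x) ℤ.^ d ℤ.- λ′ ∣)

-- T_p(d, λ, L, N) = #{x ∈ ℕ : L+1 ≤ x ≤ L+N, x^d ≡ λ (mod p)}.
-- Every such x satisfies x ≤ ⌈L+N⌉, so it suffices to scan 0 … ∣⌈L+N⌉∣.
Tp : (p d : ℕ) (λ′ : ℤ) (L N : ℚ) → ℕ
Tp p d λ′ L N = length (filter (InT? p d λ′ L N) (upTo (suc ∣ ceiling (L ℚ.+ N) ∣)))

{-# OPTIONS --safe #-}
-- Let H be the group of d-th roots of unity mod p, t = |H| ≤ d; the T integers x
-- counted lie in one coset of H and in an interval of length n with t n < p.
-- Write p ≈ q^24000 and suppose T ≥ q^7999, about p^(1/3).
--
-- Taking differences, T² is at most t plus the number of nonzero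
-- integer pairs |X|, |Y| ≤ n with X / Y ∈ H. Splitting H by the height of
-- its elements as fractions, and multiplying two fractions of the most
-- frequent height (the divisor bound controls repetitions), one gets a bound for this
-- number which forces t ≲ p^(1/3) or t ≳ p^(2/3), up to powers of q.
--
-- If t ≈ p^(2/3), the coset fills almost all of an interval of length about p^(1/3).
-- Burgess's shifts x + b c produce many y such that y + c₁, y + c₂, y + c₃ lie
-- in one coset; each such y is a point of H × H on a fixed line, and the
-- variance of the number of points of H × H on the lines of the plane bounds
-- the number of these y by about p^(1/2), which is too few.
--
-- If t ≈ p^(1/3), almost all of the coset lies in the interval. Dependent random choice
-- gives a large G ⊆ H all of whose quadruples map many common elements of the set A
-- of solutions into A. As (G - G) / (G - G) is not everything, it contains some
-- ζ - 1 = (g₁ - g₂) / (g₃ - g₄) but not ζ. Then (g₃ - g₄) (x + ζ y) takes about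
-- t² distinct values, all in a short interval around 0 and permuted by H to a
-- large extent, contradicting the energy bound.
module Submission where

open import Data.Nat as ℕ using (ℕ; zero; suc; z≤n; s≤s; NonZero)
open import Data.Nat.Primality using (Prime)
open import Data.List using (List; []; _∷_; _++_; length; map; filter; take; upTo; cartesianProduct; cartesianProductWith)
open import Data.List.Properties using (length-map; length-upTo; length-++; length-take)
open import Data.List.Membership.Propositional using (_∈_; find; lose)
open import Data.List.Membership.Propositional.Properties using (∈-map⁺; ∈-map⁻; ∈-++⁺ˡ; ∈-++⁺ʳ; ∈-filter⁺; ∈-filter⁻; ∈-upTo⁺; ∈-upTo⁻; ∈-cartesianProduct⁺; ∈-cartesianProduct⁻)
open import Data.List.Relation.Unary.Any as Any using (Any; here; there)
open import Data.List.Relation.Unary.All as All using (All; []; _∷_)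
open import Data.List.Relation.Unary.AllPairs using ([]; _∷_)
open import Data.List.Relation.Unary.Unique.Propositional using (Unique)
open import Data.List.Relation.Unary.Unique.Propositional.Properties using (map⁺; filter⁺; take⁺; upTo⁺; cartesianProduct⁺)
open import Data.Product using (_×_; _,_; ∃; ∃₂; proj₁; proj₂; swap)
open import Data.Product.Properties using (≡-dec)
open import Data.Sum using (_⊎_; inj₁; inj₂)
open import Data.Empty using (⊥; ⊥-elim)
open import Function using (_∘_)
open import Relation.Nullary using (Dec; yes; no; ¬_; contradiction)
open import Relation.Nullary.Decidable using (map′; ¬?; _×-dec_)
open import Relation.Binary.PropositionalEquality using (_≡_; _≢_; refl; sym; trans; cong; cong₂; subst; subst₂)

-- All sizes are compared as whole powers of one integer `q`, the integer part of the 24000-th root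
-- of `p`. Constants, divisor bounds and roundings each cost a bounded power of `q`, and the losses
-- add up to less than the gaps between the exponents 8000, 12000 and 16000 that stand for p^(1/3),
-- p^(1/2) and p^(2/3). The energy bound cannot finish alone. For t near p^(2/3) the diagonal term t
-- is already of size T²; for t near p^(1/3) the interval has length about p^(2/3), and an energy of
-- that order is again T². Differences of two elements are thus compatible with a coset that nearly
-- fills an interval, or nearly lies in one. The first case is refuted by three elements at a time,
-- the second by combining multiplication by H with the addition x + ζ y. Dependent random choice is
-- forced by the loss of powers of `q`: the fraction of the coset inside the interval may be as
-- small as q^(-27), so the sets of x moved into A by four given elements of H could have nothing in
-- common unless these elements are chosen together.

-- Finite sums, double counting and moment inequalities.

module Counting where

  open import Data.Nat
  open import Data.Nat.Properties
  open import Relation.Unary using (Decidable)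
  open import Data.Nat.Tactic.RingSolver using (solve-∀)

  private
    variable
      A B C : Set

  ∑ : List A → (A → ℕ) → ℕ
  ∑ [] f = 0
  ∑ (x ∷ xs) f = f x + ∑ xs f

  𝟙 : {P : Set} → Dec P → ℕ
  𝟙 (yes _) = 1
  𝟙 (no _) = 0

  count : {P : A → Set} → Decidable P → List A → ℕ
  count P? xs = ∑ xs (λ x → 𝟙 (P? x))

  ∑-mono : (xs : List A) {f g : A → ℕ} → (∀ {x} → x ∈ xs → f x ≤ g x) → ∑ xs f ≤ ∑ xs g
  ∑-mono [] h = z≤n
  ∑-mono (x ∷ xs) h = +-mono-≤ (h (here refl)) (∑-mono xs (h ∘ there))

  ∑-cong : (xs : List A) {f g : A → ℕ} → (∀ {x} → x ∈ xs → f x ≡ g x) → ∑ xs f ≡ ∑ xs g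
  ∑-cong xs h = ≤-antisym (∑-mono xs (≤-reflexive ∘ h)) (∑-mono xs (≤-reflexive ∘ sym ∘ h))

  ∑-const : (xs : List A) (c : ℕ) → ∑ xs (λ _ → c) ≡ length xs * c
  ∑-const [] c = refl
  ∑-const (x ∷ xs) c = cong (c +_) (∑-const xs c)

  ∑-one : (xs : List A) → ∑ xs (λ _ → 1) ≡ length xs
  ∑-one xs = trans (∑-const xs 1) (*-identityʳ _)

  ∑-bound : (xs : List A) {f : A → ℕ} (c : ℕ) → (∀ {x} → x ∈ xs → f x ≤ c) → ∑ xs f ≤ length xs * c
  ∑-bound xs c h = ≤-trans (∑-mono xs h) (≤-reflexive (∑-const xs c))

  ∑-bound≥ : (xs : List A) {f : A → ℕ} (c : ℕ) → (∀ {x} → x ∈ xs → c ≤ f x) → length xs * c ≤ ∑ xs f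
  ∑-bound≥ xs c h = ≤-trans (≤-reflexive (sym (∑-const xs c))) (∑-mono xs h)

  ∑-+ : (xs : List A) (f g : A → ℕ) → ∑ xs (λ x → f x + g x) ≡ ∑ xs f + ∑ xs g
  ∑-+ [] f g = refl
  ∑-+ (x ∷ xs) f g rewrite ∑-+ xs f g = interchange (f x) (g x) (∑ xs f) (∑ xs g)
    where
    interchange : ∀ a b c d → (a + b) + (c + d) ≡ (a + c) + (b + d)
    interchange = solve-∀

  ∑-*ˡ : (xs : List A) (c : ℕ) (f : A → ℕ) → ∑ xs (λ x → c * f x) ≡ c * ∑ xs f
  ∑-*ˡ [] c f = sym (*-zeroʳ c)
  ∑-*ˡ (x ∷ xs) c f = trans (cong (c * f x +_) (∑-*ˡ xs c f)) (sym (*-distribˡ-+ c (f x) (∑ xs f)))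

  ∑-*ʳ : (xs : List A) (c : ℕ) (f : A → ℕ) → ∑ xs (λ x → f x * c) ≡ ∑ xs f * c
  ∑-*ʳ [] c f = refl
  ∑-*ʳ (x ∷ xs) c f = trans (cong (f x * c +_) (∑-*ʳ xs c f)) (sym (*-distribʳ-+ c (f x) (∑ xs f)))

  ∑-swap : (xs : List A) (ys : List B) (f : A → B → ℕ) →
           ∑ xs (λ x → ∑ ys (f x)) ≡ ∑ ys (λ y → ∑ xs (λ x → f x y))
  ∑-swap [] ys f = sym (trans (∑-const ys 0) (*-zeroʳ (length ys)))
  ∑-swap (x ∷ xs) ys f =
    trans (cong (∑ ys (f x) +_) (∑-swap xs ys f))
          (sym (∑-+ ys (f x) (λ y → ∑ xs (λ x → f x y))))

  ∑-++ : (xs ys : List A) (f : A → ℕ) → ∑ (xs ++ ys) f ≡ ∑ xs f + ∑ ys f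
  ∑-++ [] ys f = refl
  ∑-++ (x ∷ xs) ys f = trans (cong (f x +_) (∑-++ xs ys f)) (sym (+-assoc (f x) _ _))

  ∑-map : (g : A → B) (xs : List A) (f : B → ℕ) → ∑ (map g xs) f ≡ ∑ xs (f ∘ g)
  ∑-map g [] f = refl
  ∑-map g (x ∷ xs) f = cong (f (g x) +_) (∑-map g xs f)

  ∑-cartesianProductWith : (g : A → B → C) (xs : List A) (ys : List B) (f : C → ℕ) →
    ∑ (cartesianProductWith g xs ys) f ≡ ∑ xs (λ x → ∑ ys (λ y → f (g x y)))
  ∑-cartesianProductWith g [] ys f = refl
  ∑-cartesianProductWith g (x ∷ xs) ys f =
    trans (∑-++ (map (g x) ys) _ f)
          (cong₂ _+_ (∑-map (g x) ys f) (∑-cartesianProductWith g xs ys f))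

  ∑-× : (xs : List A) (ys : List B) (f : A × B → ℕ) →
        ∑ (cartesianProduct xs ys) f ≡ ∑ xs (λ x → ∑ ys (λ y → f (x , y)))
  ∑-× = ∑-cartesianProductWith _,_

  ∑-product : (xs : List A) (ys : List B) (f : A → ℕ) (g : B → ℕ) →
    ∑ xs (λ x → ∑ ys (λ y → f x * g y)) ≡ ∑ xs f * ∑ ys g
  ∑-product xs ys f g =
    trans (∑-cong xs (λ {x} _ → ∑-*ˡ ys (f x) g)) (∑-*ʳ xs (∑ ys g) f)

  𝟙-yes : {P : Set} (d : Dec P) → P → 𝟙 d ≡ 1
  𝟙-yes (yes _) _ = refl
  𝟙-yes (no ¬p) p = ⊥-elim (¬p p)

  𝟙-no : {P : Set} (d : Dec P) → ¬ P → 𝟙 d ≡ 0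
  𝟙-no (yes p) ¬p = ⊥-elim (¬p p)
  𝟙-no (no _) _ = refl

  𝟙≤1 : {P : Set} (d : Dec P) → 𝟙 d ≤ 1
  𝟙≤1 (yes _) = ≤-refl
  𝟙≤1 (no _) = z≤n

  𝟙-mono : {P Q : Set} (d : Dec P) (e : Dec Q) → (P → Q) → 𝟙 d ≤ 𝟙 e
  𝟙-mono (yes p) e f = ≤-reflexive (sym (𝟙-yes e (f p)))
  𝟙-mono (no _) e f = z≤n

  𝟙-× : {P Q : Set} (d : Dec P) (e : Dec Q) → 𝟙 (d ×-dec e) ≡ 𝟙 d * 𝟙 e
  𝟙-× (yes p) (yes q) = refl
  𝟙-× (yes p) (no ¬q) = refl
  𝟙-× (no ¬p) e = refl

  ∈-∑ : {xs : List A} {x : A} (f : A → ℕ) → x ∈ xs → f x ≤ ∑ xs f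
  ∈-∑ f (here refl) = m≤m+n _ _
  ∈-∑ {xs = y ∷ _} f (there i) = ≤-trans (∈-∑ f i) (m≤n+m _ (f y))

  count≤length : {P : A → Set} (P? : Decidable P) (xs : List A) → count P? xs ≤ length xs
  count≤length P? xs = ≤-trans (∑-mono xs (λ {x} _ → 𝟙≤1 (P? x))) (≤-reflexive (∑-one xs))

  length-filter≡count : {P : A → Set} (P? : Decidable P) (xs : List A) → length (filter P? xs) ≡ count P? xs
  length-filter≡count P? [] = refl
  length-filter≡count P? (x ∷ xs) with P? x
  ... | yes _ = cong suc (length-filter≡count P? xs)
  ... | no _ = length-filter≡count P? xs

  ∑-filter : {P : A → Set} (P? : Decidable P) (xs : List A) (f : A → ℕ) →
    ∑ (filter P? xs) f ≡ ∑ xs (λ x → 𝟙 (P? x) * f x)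
  ∑-filter P? [] f = refl
  ∑-filter P? (x ∷ xs) f with P? x
  ... | yes _ = cong₂ _+_ (sym (*-identityˡ _)) (∑-filter P? xs f)
  ... | no _ = ∑-filter P? xs f

  count-none : {P : A → Set} (P? : Decidable P) (xs : List A) →
    (∀ {x} → x ∈ xs → ¬ P x) → count P? xs ≡ 0
  count-none P? xs h = trans (∑-cong xs (λ {x} i → 𝟙-no (P? x) (h i))) (trans (∑-const xs 0) (*-zeroʳ (length xs)))

  count≤1 : {P : A → Set} (P? : Decidable P) {xs : List A} → Unique xs →
    (∀ {x y} → x ∈ xs → y ∈ xs → P x → P y → x ≡ y) → count P? xs ≤ 1
  count≤1 P? {[]} _ _ = z≤n
  count≤1 P? {x ∷ xs} (x∉ ∷ u) h with P? x
  ... | no _ = count≤1 P? u (λ i j → h (there i) (there j))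
  ... | yes p = s≤s (≤-reflexive (count-none P? xs
                  (λ i q → All.lookup x∉ i (h (here refl) (there i) p q))))

  count≥1 : {P : A → Set} (P? : Decidable P) {xs : List A} {x : A} → x ∈ xs → P x → 1 ≤ count P? xs
  count≥1 P? {x = x} i p = ≤-trans (≤-reflexive (sym (𝟙-yes (P? x) p))) (∈-∑ (λ x → 𝟙 (P? x)) i)

  count-nonempty : {P : A → Set} (P? : Decidable P) (xs : List A) → 1 ≤ count P? xs → ∃ λ x → x ∈ xs × P x
  count-nonempty P? (x ∷ xs) h with P? x
  ... | yes p = x , here refl , p
  ... | no _ with count-nonempty P? xs h
  ...   | y , i , p = y , there i , p

  -- Double counting of related pairs: every `x` occurs in at least one fibre. The second moments
  -- and averages below enter through this form, with `ys` a group, an interval or a set of lattice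
  -- points.
  total-relation : {R : A → B → Set} (R? : ∀ x y → Dec (R x y)) (xs : List A) (ys : List B) →
    (∀ {x} → x ∈ xs → ∃ λ y → y ∈ ys × R x y) →
    length xs ≤ ∑ ys (λ y → count (λ x → R? x y) xs)
  total-relation R? xs ys h = begin
    length xs ≡⟨ ∑-one xs ⟨
    ∑ xs (λ _ → 1) ≤⟨ ∑-mono xs (λ {x} i → let (y , j , r) = h i in count≥1 (R? x) j r) ⟩
    ∑ xs (λ x → count (R? x) ys) ≡⟨ ∑-swap xs ys (λ x y → 𝟙 (R? x y)) ⟩
    ∑ ys (λ y → count (λ x → R? x y) xs) ∎
    where open ≤-Reasoning

  -- Injections appear as relations, because an image is often only known to exist modulo a prime.
  -- In the induction the partner of the head is deleted from `ys`; left uniqueness keeps it from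
  -- being the partner of a later entry.
  left-unique-relation : (R : A → B → Set) {xs : List A} (ys : List B) → Unique xs →
    (∀ {x} → x ∈ xs → ∃ λ y → y ∈ ys × R x y) →
    (∀ {x x′} y → x ∈ xs → x′ ∈ xs → R x y → R x′ y → x ≡ x′) →
    length xs ≤ length ys
  left-unique-relation R {xs = []} ys _ _ _ = z≤n
  left-unique-relation {A = A} {B = B} R {xs = x ∷ xs} ys (x∉ ∷ u) tot uni with tot (here refl)
  ... | y , j , r = ≤-trans (s≤s (left-unique-relation R (remove j) u
          (λ i → let (z , k , s) = tot (there i) in
            z , remove-∈ j k (λ { refl → All.lookup x∉ i (uni y (here refl) (there i) r s) }) , s)
          (λ z i i′ → uni z (there i) (there i′))))
        (≤-reflexive (length-remove j))
    where
    remove : {ys : List B} {y : B} → y ∈ ys → List B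
    remove {ys = _ ∷ ys} (here _) = ys
    remove {ys = y ∷ _} (there j) = y ∷ remove j
    length-remove : {ys : List B} {y : B} (j : y ∈ ys) → suc (length (remove j)) ≡ length ys
    length-remove (here _) = refl
    length-remove (there j) = cong suc (length-remove j)
    remove-∈ : {ys : List B} {y z : B} (j : y ∈ ys) → z ∈ ys → y ≢ z → z ∈ remove j
    remove-∈ (here refl) (here refl) ne = ⊥-elim (ne refl)
    remove-∈ (here refl) (there k) ne = k
    remove-∈ (there j) (here refl) ne = here refl
    remove-∈ (there j) (there k) ne = there (remove-∈ j k ne)

  rearrangement : ∀ e {a b} → a ≤ b → a * b ^ e + b * a ^ e ≤ a * a ^ e + b * b ^ e
  rearrangement e {a} {b} a≤b = begin
    a * b ^ e + b * a ^ e                           ≡⟨ cong₂ (λ x y → a * y + x * a ^ e) (m+[n∸m]≡n a≤b) (m+[n∸m]≡n h) ⟨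
    a * (a ^ e + l) + (a + k) * a ^ e               ≤⟨ m≤m+n _ (k * l) ⟩
    a * (a ^ e + l) + (a + k) * a ^ e + k * l       ≡⟨ eqn a k (a ^ e) l ⟩
    a * a ^ e + (a + k) * (a ^ e + l)               ≡⟨ cong₂ (λ x y → a * a ^ e + x * y) (m+[n∸m]≡n a≤b) (m+[n∸m]≡n h) ⟩
    a * a ^ e + b * b ^ e ∎
    where
    open ≤-Reasoning
    h = ^-monoˡ-≤ e a≤b
    k = b ∸ a
    l = b ^ e ∸ a ^ e
    eqn : ∀ a k x l → a * (x + l) + (a + k) * x + k * l ≡ a * x + (a + k) * (x + l)
    eqn = solve-∀

  rearrangement′ : ∀ e a b → a * b ^ e + b * a ^ e ≤ a ^ suc e + b ^ suc e
  rearrangement′ e a b with ≤-total a b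
  ... | inj₁ a≤b = rearrangement e a≤b
  ... | inj₂ b≤a = ≤-trans (≤-reflexive (+-comm (a * b ^ e) (b * a ^ e)))
     (≤-trans (rearrangement e b≤a) (≤-reflexive (+-comm (b * b ^ e) (a * a ^ e))))

  -- The rearrangement inequality, summed over all pairs of entries, gives twice each side.
  chebyshev : ∀ e (xs : List A) (f : A → ℕ) →
    ∑ xs f * ∑ xs (λ x → f x ^ e) ≤ length xs * ∑ xs (λ x → f x ^ suc e)
  chebyshev e xs f = *-cancelˡ-≤ 2 (begin
    2 * (S * Sₑ) ≡⟨ eq₁ S Sₑ ⟩
    S * Sₑ + Sₑ * S ≡⟨ cong₂ _+_ (sym (∑-product xs xs f fᵉ)) (sym (∑-product xs xs fᵉ f)) ⟩
    ∑ xs (λ x → ∑ xs (λ y → f x * fᵉ y)) + ∑ xs (λ x → ∑ xs (λ y → fᵉ x * f y))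
      ≡⟨ ∑-+ xs _ _ ⟨
    ∑ xs (λ x → ∑ xs (λ y → f x * fᵉ y) + ∑ xs (λ y → fᵉ x * f y))
      ≡⟨ ∑-cong xs (λ _ → ∑-+ xs _ _) ⟨
    ∑ xs (λ x → ∑ xs (λ y → f x * fᵉ y + fᵉ x * f y))
      ≤⟨ ∑-mono xs (λ {x} _ → ∑-mono xs (λ {y} _ →
           ≤-trans (≤-reflexive (cong (f x * fᵉ y +_) (*-comm (fᵉ x) (f y)))) (rearrangement′ e (f x) (f y)))) ⟩
    ∑ xs (λ x → ∑ xs (λ y → g x + g y))
      ≡⟨ ∑-cong xs (λ _ → trans (∑-+ xs _ _) (cong (_+ ∑ xs g) (∑-const xs _))) ⟩
    ∑ xs (λ x → length xs * g x + ∑ xs g)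
      ≡⟨ trans (∑-+ xs _ _) (cong₂ _+_ (∑-*ˡ xs (length xs) g) (∑-const xs _)) ⟩
    length xs * ∑ xs g + length xs * ∑ xs g ≡⟨ eq₂ (length xs * ∑ xs g) ⟩
    2 * (length xs * ∑ xs g) ∎)
    where
    open ≤-Reasoning
    fᵉ = λ x → f x ^ e
    g = λ x → f x ^ suc e
    S = ∑ xs f
    Sₑ = ∑ xs fᵉ
    eq₁ : ∀ a b → 2 * (a * b) ≡ a * b + b * a
    eq₁ = solve-∀
    eq₂ : ∀ a → a + a ≡ 2 * a
    eq₂ = solve-∀

  power-mean : ∀ e (xs : List A) (f : A → ℕ) →
    ∑ xs f ^ suc e ≤ length xs ^ e * ∑ xs (λ x → f x ^ suc e)
  power-mean zero xs f = ≤-reflexive (trans (*-identityʳ _)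
    (sym (trans (*-identityˡ _) (∑-cong xs (λ {x} _ → *-identityʳ (f x))))))
  power-mean (suc e) xs f = begin
    S * S ^ suc e ≤⟨ *-monoʳ-≤ S (power-mean e xs f) ⟩
    S * (n ^ e * Sₑ) ≡⟨ eqn S (n ^ e) Sₑ ⟩
    n ^ e * (S * Sₑ) ≤⟨ *-monoʳ-≤ (n ^ e) (chebyshev (suc e) xs f) ⟩
    n ^ e * (n * Sₑ₊₁) ≡⟨ eqn′ (n ^ e) n Sₑ₊₁ ⟩
    n ^ suc e * Sₑ₊₁ ∎
    where
    open ≤-Reasoning
    n = length xs
    S = ∑ xs f
    Sₑ = ∑ xs (λ x → f x ^ suc e)
    Sₑ₊₁ = ∑ xs (λ x → f x ^ suc (suc e))
    eqn : ∀ a b c → a * (b * c) ≡ b * (a * c)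
    eqn = solve-∀
    eqn′ : ∀ a b c → a * (b * c) ≡ b * a * c
    eqn′ = solve-∀

  cauchy-schwarz : (xs : List A) (f : A → ℕ) → ∑ xs f * ∑ xs f ≤ length xs * ∑ xs (λ x → f x * f x)
  cauchy-schwarz xs f = begin
    ∑ xs f * ∑ xs f ≡⟨ cong (∑ xs f *_) (sym (*-identityʳ _)) ⟩
    ∑ xs f ^ 2 ≤⟨ power-mean 1 xs f ⟩
    length xs ^ 1 * ∑ xs (λ x → f x ^ 2)
      ≡⟨ cong₂ _*_ (*-identityʳ (length xs)) (∑-cong xs (λ {x} _ → cong (f x *_) (*-identityʳ (f x)))) ⟩
    length xs * ∑ xs (λ x → f x * f x) ∎
    where open ≤-Reasoning

  average : (xs : List A) (f : A → ℕ) → 1 ≤ length xs → ∃ λ x → x ∈ xs × ∑ xs f ≤ length xs * f x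
  average (x ∷ []) f _ = x , here refl , ≤-refl
  average (x ∷ y ∷ ys) f _ with average (y ∷ ys) f (s≤s z≤n)
  ... | z , i , h with ≤-total (f x) (f z)
  ...   | inj₁ fx≤fz = z , there i , +-mono-≤ fx≤fz h
  ...   | inj₂ fz≤fx = x , here refl , +-monoʳ-≤ (f x) (≤-trans h (*-monoʳ-≤ (length (y ∷ ys)) fz≤fx))

  length-× : (xs : List A) (ys : List B) → length (cartesianProduct xs ys) ≡ length xs * length ys
  length-× xs ys = trans (sym (∑-one (cartesianProduct xs ys)))
    (trans (∑-× xs ys (λ _ → 1)) (trans (∑-cong xs (λ _ → ∑-one ys)) (∑-const xs (length ys))))

  tuples : ℕ → List A → List (List A)
  tuples zero xs = [] ∷ []
  tuples (suc e) xs = cartesianProductWith _∷_ xs (tuples e xs)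

  length-tuples : ∀ e (xs : List A) → length (tuples e xs) ≡ length xs ^ e
  length-tuples zero xs = refl
  length-tuples (suc e) xs = trans (sym (∑-one (tuples (suc e) xs)))
    (trans (∑-cartesianProductWith _∷_ xs (tuples e xs) (λ _ → 1))
    (trans (∑-cong xs (λ _ → trans (∑-one (tuples e xs)) (length-tuples e xs))) (∑-const xs (length xs ^ e))))

  -- Independence of the entries of a random tuple. It is what raises a density to a high power in
  -- the dependent random choice.
  count-tuples : {P : A → Set} (P? : Decidable P) (e : ℕ) (xs : List A) →
    count (All.all? P?) (tuples e xs) ≡ count P? xs ^ e
  count-tuples P? zero xs = refl
  count-tuples {A = A} P? (suc e) xs =
    trans (∑-cartesianProductWith _∷_ xs (tuples e xs) _)
    (trans (∑-cong xs (λ {x} _ → ∑-cong (tuples e xs) (λ {ys} _ → 𝟙-all x ys)))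
    (trans (∑-product xs (tuples e xs) (λ x → 𝟙 (P? x)) (λ ys → 𝟙 (All.all? P? ys)))
    (cong (count P? xs *_) (count-tuples P? e xs))))
    where
    𝟙-all : ∀ x ys → 𝟙 (All.all? P? (x ∷ ys)) ≡ 𝟙 (P? x) * 𝟙 (All.all? P? ys)
    𝟙-all x ys with P? x | All.all? P? ys
    ... | yes _ | yes _ = refl
    ... | yes _ | no _ = refl
    ... | no _ | yes _ = refl
    ... | no _ | no _ = refl

  ^-distribʳ-* : ∀ e a b → (a * b) ^ e ≡ a ^ e * b ^ e
  ^-distribʳ-* zero a b = refl
  ^-distribʳ-* (suc e) a b = trans (cong (a * b *_) (^-distribʳ-* e a b)) (eqn a b (a ^ e) (b ^ e))
    where
    eqn : ∀ w x y z → (w * x) * (y * z) ≡ (w * y) * (x * z)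
    eqn = solve-∀

-- The divisor bound: τ(n) is smaller than any power of n.

module Divisor where

  open Counting
  open import Data.Nat
  open import Data.Nat.Properties
  open import Data.Nat.Divisibility
  open import Data.Nat.DivMod using (_/_; _%_; m≡m%n+[m/n]*n; m%n<n; m/n*n≤m)
  open import Data.Nat.Primality
  open import Data.Nat.Primality.Factorisation using (factorise; PrimeFactorisation)
  open import Data.Nat.Induction using (<-wellFounded)
  open import Data.Nat.ListAction using (product)
  open import Induction.WellFounded using (Acc; acc)
  open import Data.Nat.Tactic.RingSolver using (solve-∀)

  divisors : ℕ → List ℕ
  divisors n = filter (_∣? n) (upTo (suc n))

  τ : ℕ → ℕ
  τ n = length (divisors n)

  divisors-unique : ∀ n → Unique (divisors n)
  divisors-unique n = filter⁺ (_∣? n) (upTo⁺ (suc n))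

  ∈-divisors : ∀ {n e} .{{_ : NonZero n}} → e ∣ n → e ∈ divisors n
  ∈-divisors {n} e∣n = ∈-filter⁺ (_∣? n) (∈-upTo⁺ (s≤s (∣⇒≤ e∣n))) e∣n

  prime-power∣ : ∀ {r} → Prime r → ∀ a {e f} → ¬ r ∣ f → r ^ a ∣ e * f → r ^ a ∣ e
  prime-power∣ pr zero r∤f _ = 1∣ _
  prime-power∣ {r} pr (suc a) {e} {f} r∤f h with euclidsLemma e f pr (∣-trans (m∣m*n (r ^ a)) h)
  ... | inj₂ r∣f = contradiction r∣f r∤f
  ... | inj₁ (divides e′ refl) =
    subst (r * r ^ a ∣_) (*-comm r e′)
      (*-monoʳ-∣ r (prime-power∣ pr a r∤f
        (*-cancelˡ-∣ r {{prime⇒nonZero pr}} (subst (r * r ^ a ∣_) (eqn e′ r f) h))))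
    where
    eqn : ∀ x y z → x * y * z ≡ y * (x * z)
    eqn = solve-∀

  -- Let e f = r^(a+1) m. If r divides f, then e divides r^a m; otherwise all of r^(a+1) divides e,
  -- and the quotient divides m.
  τ-prime-step : ∀ {r} → Prime r → ∀ a m .{{_ : NonZero m}} → τ (r ^ suc a * m) ≤ τ (r ^ a * m) + τ m
  τ-prime-step {r} pr a m = ≤-trans
    (left-unique-relation R (map inj₁ D₁ ++ map inj₂ D₂) (divisors-unique N) total unique)
    (≤-reflexive (trans (length-++ (map inj₁ D₁)) (cong₂ _+_ (length-map inj₁ D₁) (length-map inj₂ D₂))))
    where
    instance
      r≢0 = prime⇒nonZero pr
      N₁≢0 = m*n≢0 (r ^ a) m {{m^n≢0 r a}}
      rᵃ≢0 = m^n≢0 r (suc a)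
    N = r ^ suc a * m
    D₁ = divisors (r ^ a * m)
    D₂ = divisors m
    R : ℕ → ℕ ⊎ ℕ → Set
    R e (inj₁ f) = e ≡ f
    R e (inj₂ f) = e ≡ r ^ suc a * f
    total : ∀ {e} → e ∈ divisors N → ∃ λ y → y ∈ (map inj₁ D₁ ++ map inj₂ D₂) × R e y
    total {e} i with proj₂ (∈-filter⁻ (_∣? N) {xs = upTo (suc N)} i)
    ... | divides f eq with r ∣? f
    ...   | yes (divides g refl) = inj₁ e , ∈-++⁺ˡ (∈-map⁺ inj₁ (∈-divisors (divides g
              (*-cancelˡ-≡ _ _ r (trans (sym (*-assoc r (r ^ a) m)) (trans eq (eqn g r e))))))) , refl
      where
      eqn : ∀ x y z → x * y * z ≡ y * (x * z)
      eqn = solve-∀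
    ...   | no r∤f with prime-power∣ pr (suc a) {e} r∤f (divides m (trans (*-comm e f) (trans (sym eq) (*-comm (r ^ suc a) m))))
    ...     | divides g refl = inj₂ g , ∈-++⁺ʳ (map inj₁ D₁) (∈-map⁺ inj₂ (∈-divisors (divides f
              (*-cancelˡ-≡ _ _ (r ^ suc a) (trans eq (eqn f g (r ^ suc a))))))) , *-comm g _
      where
      eqn : ∀ x y z → x * (y * z) ≡ z * (x * y)
      eqn = solve-∀
    unique : ∀ {x x′} y → x ∈ divisors N → x′ ∈ divisors N → R x y → R x′ y → x ≡ x′
    unique (inj₁ _) _ _ p q = trans p (sym q)
    unique (inj₂ _) _ _ p q = trans p (sym q)

  τ-prime-power : ∀ {r} → Prime r → ∀ a m .{{_ : NonZero m}} → τ (r ^ a * m) ≤ suc a * τ m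
  τ-prime-power pr zero m = ≤-reflexive (trans (cong τ (*-identityˡ m)) (sym (*-identityˡ (τ m))))
  τ-prime-power pr (suc a) m = ≤-trans (τ-prime-step pr a m)
    (≤-trans (≤-reflexive (+-comm _ (τ m))) (+-monoʳ-≤ (τ m) (τ-prime-power pr a m)))

  product-primes-nonZero : ∀ {rs} → All Prime rs → NonZero (product rs)
  product-primes-nonZero [] = _
  product-primes-nonZero (pr ∷ prs) = m*n≢0 _ _ {{prime⇒nonZero pr}} {{product-primes-nonZero prs}}

  -- A prime factor at most doubles τ, so it multiplies τ^k by at most 2^k, and a prime of at least
  -- that size pays for this itself.
  τ-large-primes : ∀ k {rs} → All Prime rs → All (2 ^ k ≤_) rs → τ (product rs) ^ k ≤ product rs
  τ-large-primes k [] [] = ≤-reflexive (^-zeroˡ k)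
  τ-large-primes k {r ∷ rs} (pr ∷ prs) (h ∷ hs) = begin
    τ (r * product rs) ^ k ≡⟨ cong (λ x → τ (x * product rs) ^ k) (*-identityʳ r) ⟨
    τ (r ^ 1 * product rs) ^ k ≤⟨ ^-monoˡ-≤ k (τ-prime-power pr 1 (product rs) {{product-primes-nonZero prs}}) ⟩
    (2 * τ (product rs)) ^ k ≡⟨ ^-distribʳ-* k 2 (τ (product rs)) ⟩
    2 ^ k * τ (product rs) ^ k ≤⟨ *-mono-≤ h (τ-large-primes k prs hs) ⟩
    r * product rs ∎
    where open ≤-Reasoning

  rough-prime-factors : ∀ {Q n} → Q Rough n → ∀ {rs} → product rs ∣ n → All Prime rs → All (Q ≤_) rs
  rough-prime-factors rough _ [] = []
  rough-prime-factors {Q} rough {r ∷ rs} d (pr ∷ prs) =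
    ≮⇒≥ (λ r<Q → rough (hasNonTrivialDivisor {{prime⇒nonTrivial pr}} r<Q (∣-trans (m∣m*n (product rs)) d)))
    ∷ rough-prime-factors rough (∣-trans (n∣m*n r) d) prs

  strip : ∀ Q n → 2 ≤ Q → .{{_ : NonZero n}} → ∃₂ λ a m → n ≡ Q ^ a * m × ¬ Q ∣ m × NonZero m
  strip Q n 2≤Q = go n (<-wellFounded n)
    where
    go : ∀ n → Acc _<_ n → .{{NonZero n}} → ∃₂ λ a m → n ≡ Q ^ a * m × ¬ Q ∣ m × NonZero m
    go n (acc rec) with Q ∣? n
    ... | no Q∤n = 0 , n , sym (*-identityˡ n) , Q∤n , ≢-nonZero (≢-nonZero⁻¹ n)
    ... | yes (divides zero refl) = contradiction refl (≢-nonZero⁻¹ 0)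
    ... | yes (divides n′@(suc _) refl) with go n′ (rec (m<m*n n′ Q 2≤Q))
    ...   | a , m , eq , Q∤m , m≢0 = suc a , m , trans (cong (_* Q) eq) (eqn (Q ^ a) m Q) , Q∤m , m≢0
      where
      eqn : ∀ x y z → x * y * z ≡ z * x * y
      eqn = solve-∀

  n<2^n : ∀ n → n < 2 ^ n
  n<2^n zero = s≤s z≤n
  n<2^n (suc n) = begin-strict
    suc n ≤⟨ n<2^n n ⟩
    2 ^ n <⟨ m<m*n (2 ^ n) 2 {{m^n≢0 2 n}} ≤-refl ⟩
    2 ^ n * 2 ≡⟨ *-comm (2 ^ n) 2 ⟩
    2 * 2 ^ n ∎
    where open ≤-Reasoning

  -- Write a = k b + r with r < k; then a + 1 ≤ k (b + 1) ≤ k 2ᵇ.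
  suc^≤2^ : ∀ k .{{_ : NonZero k}} a → suc a ^ k ≤ k ^ k * 2 ^ a
  suc^≤2^ k a = begin
    suc a ^ k ≤⟨ ^-monoˡ-≤ k a<k2ᵇ ⟩
    (k * 2 ^ b) ^ k ≡⟨ ^-distribʳ-* k k (2 ^ b) ⟩
    k ^ k * (2 ^ b) ^ k ≡⟨ cong (k ^ k *_) (^-*-assoc 2 b k) ⟩
    k ^ k * 2 ^ (b * k) ≤⟨ *-monoʳ-≤ (k ^ k) (^-monoʳ-≤ 2 (m/n*n≤m a k)) ⟩
    k ^ k * 2 ^ a ∎
    where
    open ≤-Reasoning
    b = a / k
    a<k2ᵇ : suc a ≤ k * 2 ^ b
    a<k2ᵇ = begin
      suc a ≡⟨ cong suc (m≡m%n+[m/n]*n a k) ⟩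
      suc (a % k) + b * k ≤⟨ +-monoˡ-≤ (b * k) (m%n<n a k) ⟩
      suc b * k ≤⟨ *-monoˡ-≤ k (n<2^n b) ⟩
      2 ^ b * k ≡⟨ *-comm (2 ^ b) k ⟩
      k * 2 ^ b ∎

  -- The numbers Q below 2^k are divided out in turn, `i` of them being left. Each costs one factor
  -- k^k, since (a+1)^k ≤ k^k 2^a ≤ k^k Q^a. Roughness makes Q prime as soon as it divides `n`.
  τ-rough : ∀ k .{{_ : NonZero k}} i Q → 2 ≤ Q → Q + i ≡ 2 ^ k → ∀ n .{{_ : NonZero n}} → Q Rough n →
    τ n ^ k ≤ (k ^ k) ^ i * n
  τ-rough k zero Q 2≤Q eq n rough = begin
    τ n ^ k ≡⟨ cong (λ x → τ x ^ k) (isFactorisation F) ⟩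
    τ (product rs) ^ k ≤⟨ τ-large-primes k (factorsPrime F) (subst (λ x → All (x ≤_) rs) (trans (sym (+-identityʳ Q)) eq)
      (rough-prime-factors rough (subst (_∣ n) (isFactorisation F) ∣-refl) (factorsPrime F))) ⟩
    product rs ≡⟨ isFactorisation F ⟨
    n ≡⟨ *-identityˡ n ⟨
    1 * n ∎
    where
    open ≤-Reasoning
    open PrimeFactorisation
    F = factorise n
    rs = factors F
  τ-rough k (suc i) Q 2≤Q eq n rough with strip Q n 2≤Q
  ... | a , m , refl , Q∤m , m≢0 = begin
    τ (Q ^ a * m) ^ k ≤⟨ ^-monoˡ-≤ k (step a rough) ⟩
    (suc a * τ m) ^ k ≡⟨ ^-distribʳ-* k (suc a) (τ m) ⟩
    suc a ^ k * τ m ^ k ≤⟨ *-mono-≤ (suc^≤2^ k a) (τ-rough k i (suc Q) (m≤n⇒m≤1+n 2≤Q) (trans (sym (+-suc Q i)) eq) m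
          (∤⇒rough-suc Q∤m (rough∧∣⇒rough rough (n∣m*n (Q ^ a))))) ⟩
    (k ^ k * 2 ^ a) * ((k ^ k) ^ i * m) ≤⟨ *-monoˡ-≤ _ (*-monoʳ-≤ (k ^ k) (^-monoˡ-≤ a 2≤Q)) ⟩
    (k ^ k * Q ^ a) * ((k ^ k) ^ i * m) ≡⟨ eqn (k ^ k) (Q ^ a) ((k ^ k) ^ i) m ⟩
    (k ^ k) ^ suc i * (Q ^ a * m) ∎
    where
    open ≤-Reasoning
    instance _ = m≢0
    eqn : ∀ w x y z → (w * x) * (y * z) ≡ (w * y) * (x * z)
    eqn = solve-∀
    step : ∀ a → Q Rough (Q ^ a * m) → τ (Q ^ a * m) ≤ suc a * τ m
    step zero _ = ≤-reflexive (trans (cong τ (*-identityˡ m)) (sym (*-identityˡ (τ m))))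
    step (suc a) rough = τ-prime-power (rough∧∣⇒prime {{n>1⇒nonTrivial 2≤Q}} rough
      (∣-trans (m∣m*n (Q ^ a)) (m∣m*n m))) (suc a) m

  divisor-bound : ∀ k .{{_ : NonZero k}} → ∃ λ C → ∀ n .{{_ : NonZero n}} → τ n ^ k ≤ C * n
  divisor-bound k = (k ^ k) ^ (2 ^ k ∸ 2) , λ n → τ-rough k (2 ^ k ∸ 2) 2 ≤-refl
    (m+[n∸m]≡n (^-monoʳ-≤ 2 (>-nonZero⁻¹ k))) n 2-rough

-- Elementary inequalities behind the lattice and energy bounds.

module Arith where

  open import Data.Nat
  open import Data.Nat.Properties
  open import Data.Nat.Tactic.RingSolver using (solve-∀)

  -- Cleared of denominators, this is L ≤ 12 M² / p + 3 M / K: area over determinant for a lattice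
  -- of determinant p, plus the points on a single line.
  grid-bound : ∀ {p K M W V L} → K ≤ M → W * p ≤ 2 * M * K → V * K ≤ M + M →
    L ≤ suc (W + W) * suc V → K * (p * L) ≤ 12 * (M * M) * K + 3 * M * p
  grid-bound {p} {K} {M} {W} {V} {L} K≤M hW hV hL = begin
    K * (p * L) ≤⟨ *-monoʳ-≤ K (*-monoʳ-≤ p hL) ⟩
    K * (p * (suc (W + W) * suc V)) ≡⟨ eq₁ K p W V ⟩
    (2 * (W * p) + p) * (V * K + K) ≤⟨ *-mono-≤ (+-monoˡ-≤ p (*-monoʳ-≤ 2 hW)) (+-mono-≤ hV K≤M) ⟩
    (2 * (2 * M * K) + p) * (M + M + M) ≡⟨ eq₂ M K p ⟩
    12 * (M * M) * K + 3 * M * p ∎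
    where
    open ≤-Reasoning
    eq₁ : ∀ K p W V → K * (p * ((1 + (W + W)) * (1 + V))) ≡ (2 * (W * p) + p) * (V * K + K)
    eq₁ = solve-∀
    eq₂ : ∀ M K p → (2 * (2 * M * K) + p) * (M + M + M) ≡ 12 * (M * M) * K + 3 * M * p
    eq₂ = solve-∀

  -- Read the hypothesis as x ≤ a + b / K, which gets weaker as K decreases.
  scale-down : ∀ {K Q} x a b → Q ≤ K → K * x ≤ a * K + b → Q * x ≤ a * Q + b
  scale-down {K} {Q} x a b Q≤K h with ≤-total x a
  ... | inj₁ x≤a = ≤-trans (*-monoʳ-≤ Q x≤a) (≤-trans (≤-reflexive (*-comm Q a)) (m≤m+n _ b))
  ... | inj₂ a≤x = begin
    Q * x ≡⟨ cong (Q *_) (m+[n∸m]≡n a≤x) ⟨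
    Q * (a + e) ≡⟨ eqn Q a e ⟩
    a * Q + Q * e ≤⟨ +-monoʳ-≤ (a * Q) (≤-trans (*-monoˡ-≤ e Q≤K) Ke≤b) ⟩
    a * Q + b ∎
    where
    open ≤-Reasoning
    e = x ∸ a
    eqn : ∀ Q a e → Q * (a + e) ≡ a * Q + Q * e
    eqn = solve-∀
    Ke≤b : K * e ≤ b
    Ke≤b = +-cancelˡ-≤ (a * K) (K * e) b
      (≤-trans (≤-reflexive (trans (sym (eqn K a e)) (cong (K *_) (m+[n∸m]≡n a≤x)))) h)

  module _ {q R₁ p t : ℕ} .{{_ : NonZero q}} .{{_ : NonZero p}} (36R₁≤q : 36 * R₁ ≤ q) where

    open ≤-Reasoning

    private
      3≤36 : 3 ≤ 36
      3≤36 = s≤s (s≤s (s≤s z≤n))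

      12≤36 : 12 ≤ 36
      12≤36 = m≤m+n 12 24

    -- Here `x` is q^j, `s` the size of the dominant height class and `E` the energy at radius `M`.
    -- As t M ≤ 3 p, the area term is at most 36 M p, and what remains is E ≤ q M (1 + s / x).
    linear-energy : ∀ {x s M E} → t * M ≤ 3 * p →
      x * (p * E) ≤ R₁ * (12 * (M * M) * t * x + 3 * M * p * s) → x * E ≤ q * M * (x + s)
    linear-energy {x} {s} {M} {E} tM h = *-cancelˡ-≤ p (begin
      p * (x * E) ≡⟨ eq₁ p x E ⟩
      x * (p * E) ≤⟨ h ⟩
      R₁ * (12 * (M * M) * t * x + 3 * M * p * s) ≡⟨ cong (λ z → R₁ * (z + 3 * M * p * s)) (eq₂ M t x) ⟩
      R₁ * (12 * M * x * (t * M) + 3 * M * p * s)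
        ≤⟨ *-monoʳ-≤ R₁ (+-mono-≤ (*-monoʳ-≤ (12 * M * x) tM)
             (*-monoˡ-≤ s (*-monoˡ-≤ p (*-monoˡ-≤ M 3≤36)))) ⟩
      R₁ * (12 * M * x * (3 * p) + 36 * M * p * s) ≡⟨ eq₃ R₁ M x p s ⟩
      36 * R₁ * (M * p * (x + s)) ≤⟨ *-monoˡ-≤ _ 36R₁≤q ⟩
      q * (M * p * (x + s)) ≡⟨ eq₄ q M p (x + s) ⟩
      p * (q * M * (x + s)) ∎)
      where
      eq₁ : ∀ p x E → p * (x * E) ≡ x * (p * E)
      eq₁ = solve-∀
      eq₂ : ∀ M t x → 12 * (M * M) * t * x ≡ 12 * M * x * (t * M)
      eq₂ = solve-∀
      eq₃ : ∀ R M x p s → R * (12 * M * x * (3 * p) + 36 * M * p * s) ≡ 36 * R * (M * p * (x + s))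
      eq₃ = solve-∀
      eq₄ : ∀ q M p y → q * (M * p * y) ≡ p * (q * M * y)
      eq₄ = solve-∀

    -- Products of two fractions from the class have height up to M = (x q)², and the same total
    -- bound is applied at that radius, where the area term has to be kept.
    square-energy : ∀ {x s E} .{{_ : NonZero x}} → s * s ≤ q * E →
      (let M = x * q * (x * q)) → x * (p * E) ≤ R₁ * (12 * (M * M) * t * x + 3 * M * p * s) →
      p * (s * s) ≤ x ^ 4 * q ^ 6 * t + x * q ^ 4 * (p * s)
    square-energy {x} {s} {E} hs h = *-cancelˡ-≤ x (begin
      x * (p * (s * s)) ≤⟨ *-monoʳ-≤ x (*-monoʳ-≤ p hs) ⟩
      x * (p * (q * E)) ≡⟨ eq₁ x p q E ⟩
      q * (x * (p * E)) ≤⟨ *-monoʳ-≤ q h ⟩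
      q * (R₁ * (12 * (M * M) * t * x + 3 * M * p * s))
        ≤⟨ *-monoʳ-≤ q (*-monoʳ-≤ R₁ (+-mono-≤ (*-monoˡ-≤ x (*-monoˡ-≤ t (*-monoˡ-≤ (M * M) 12≤36)))
             (*-monoˡ-≤ s (*-monoˡ-≤ p (*-monoˡ-≤ M 3≤36))))) ⟩
      q * (R₁ * (36 * (M * M) * t * x + 36 * M * p * s)) ≡⟨ eq₂ q R₁ M t x p s ⟩
      36 * R₁ * (q * (M * M * t * x + M * p * s)) ≤⟨ *-monoˡ-≤ _ 36R₁≤q ⟩
      q * (q * (M * M * t * x + M * p * s)) ≡⟨ eq₃ q x t p s ⟩
      x * (x ^ 4 * q ^ 6 * t + x * q ^ 4 * (p * s)) ∎)
      where
      M = x * q * (x * q)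
      eq₁ : ∀ x p q E → x * (p * (q * E)) ≡ q * (x * (p * E))
      eq₁ = solve-∀
      eq₂ : ∀ q R M t x p s → q * (R * (36 * (M * M) * t * x + 36 * M * p * s)) ≡ 36 * R * (q * (M * M * t * x + M * p * s))
      eq₂ = solve-∀
      eq₃ : ∀ q x t p s → q * (q * (x * q * (x * q) * (x * q * (x * q)) * t * x + x * q * (x * q) * p * s))
         ≡ x * (x * (x * (x * (x * 1))) * (q * (q * (q * (q * (q * (q * 1)))))) * t + x * (q * (q * (q * (q * 1)))) * (p * s))
      eq₃ = solve-∀

    -- At the threshold s = 2 x q⁴ the last term of the second hypothesis can be absorbed into its
    -- left side, which leaves s² ≤ 2 x⁴ q⁶ t / p. Since E ≤ 2 q M s / x, the fourth power of E
    -- together with s⁴ ≤ s² t² makes the unknown height x cancel.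
    energy-dichotomy : ∀ {x s M E} .{{_ : NonZero x}} → 32 ≤ q → s ≤ t → x * E ≤ q * M * (x + s) →
      p * (s * s) ≤ x ^ 4 * q ^ 6 * t + x * q ^ 4 * (p * s) →
      E ≤ M * q ^ 6 ⊎ p * E ^ 4 ≤ q ^ 11 * M ^ 4 * t ^ 3
    energy-dichotomy {x} {s} {M} {E} 32≤q s≤t h₁ h₂ with ≤-total s (2 * (x * q ^ 4))
    ... | inj₁ small = inj₁ (*-cancelˡ-≤ x (begin
      x * E ≤⟨ h₁ ⟩
      q * M * (x + s) ≤⟨ *-monoʳ-≤ (q * M) (+-mono-≤ (m≤m*n x (q ^ 4) {{m^n≢0 q 4}}) small) ⟩
      q * M * (x * q ^ 4 + 2 * (x * q ^ 4)) ≡⟨ eq₁ q M (x * q ^ 4) ⟩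
      q * M * (x * q ^ 4 * 3) ≤⟨ *-monoʳ-≤ (q * M) (*-monoʳ-≤ (x * q ^ 4) (≤-trans (m≤m+n 3 29) 32≤q)) ⟩
      q * M * (x * q ^ 4 * q) ≡⟨ eq₂ q M x ⟩
      x * (M * q ^ 6) ∎))
      where
      eq₁ : ∀ q M y → q * M * (y + 2 * y) ≡ q * M * (y * 3)
      eq₁ = solve-∀
      eq₂ : ∀ q M x → q * M * (x * (q * (q * (q * (q * 1)))) * q) ≡ x * (M * (q * (q * (q * (q * (q * (q * 1)))))))
      eq₂ = solve-∀
    ... | inj₂ large = inj₂ (*-cancelˡ-≤ (x ^ 4) {{m^n≢0 x 4}} (begin
      x ^ 4 * (p * E ^ 4) ≡⟨ eq₁ x p E ⟩
      p * (x * E) ^ 4 ≤⟨ *-monoʳ-≤ p (^-monoˡ-≤ 4 (begin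
        x * E ≤⟨ h₁ ⟩
        q * M * (x + s) ≤⟨ *-monoʳ-≤ (q * M) (+-monoˡ-≤ s x≤s) ⟩
        q * M * (s + s) ∎)) ⟩
      p * (q * M * (s + s)) ^ 4 ≡⟨ eq₂ p q M s ⟩
      16 * (q ^ 4 * M ^ 4) * (p * (s * s) * (s * s))
        ≤⟨ *-monoʳ-≤ (16 * (q ^ 4 * M ^ 4)) (*-mono-≤ ps² (*-mono-≤ s≤t s≤t)) ⟩
      16 * (q ^ 4 * M ^ 4) * (2 * (x ^ 4 * q ^ 6 * t) * (t * t)) ≡⟨ eq₃ q M x t ⟩
      x ^ 4 * (32 * (q ^ 10 * M ^ 4 * t ^ 3)) ≤⟨ *-monoʳ-≤ (x ^ 4) (*-monoˡ-≤ _ 32≤q) ⟩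
      x ^ 4 * (q * (q ^ 10 * M ^ 4 * t ^ 3)) ≡⟨ eq₄ (x ^ 4) q (q ^ 10) (M ^ 4) (t ^ 3) ⟩
      x ^ 4 * (q ^ 11 * M ^ 4 * t ^ 3) ∎))
      where
      x≤s : x ≤ s
      x≤s = ≤-trans (≤-trans (m≤m*n x (q ^ 4) {{m^n≢0 q 4}}) (m≤n*m (x * q ^ 4) 2)) large
      ps² : p * (s * s) ≤ 2 * (x ^ 4 * q ^ 6 * t)
      ps² = +-cancelʳ-≤ (p * (s * s)) _ _ (begin
        p * (s * s) + p * (s * s) ≡⟨ eq₅ (p * (s * s)) ⟩
        2 * (p * (s * s)) ≤⟨ *-monoʳ-≤ 2 h₂ ⟩
        2 * (x ^ 4 * q ^ 6 * t + x * q ^ 4 * (p * s)) ≡⟨ eq₆ (x ^ 4 * q ^ 6 * t) (x * q ^ 4) p s ⟩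
        2 * (x ^ 4 * q ^ 6 * t) + p * (2 * (x * q ^ 4) * s) ≤⟨ +-monoʳ-≤ _ (*-monoʳ-≤ p (*-monoˡ-≤ s large)) ⟩
        2 * (x ^ 4 * q ^ 6 * t) + p * (s * s) ∎)
        where
        eq₅ : ∀ y → y + y ≡ 2 * y
        eq₅ = solve-∀
        eq₆ : ∀ a b p s → 2 * (a + b * (p * s)) ≡ 2 * a + p * (2 * b * s)
        eq₆ = solve-∀
      eq₁ : ∀ x p E → x * (x * (x * (x * 1))) * (p * (E * (E * (E * (E * 1)))))
          ≡ p * (x * E * (x * E * (x * E * (x * E * 1))))
      eq₁ = solve-∀
      eq₂ : ∀ p q M s → p * (q * M * (s + s) * (q * M * (s + s) * (q * M * (s + s) * (q * M * (s + s) * 1))))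
          ≡ 16 * (q * (q * (q * (q * 1))) * (M * (M * (M * (M * 1))))) * (p * (s * s) * (s * s))
      eq₂ = solve-∀
      pow-eq₃ : ∀ a m b c t → 16 * (a * m) * (2 * (b * c * t) * (t * t)) ≡ b * (32 * (a * c * m * (t * (t * (t * 1)))))
      pow-eq₃ = solve-∀
      eq₃ : ∀ q M x t → 16 * (q ^ 4 * M ^ 4) * (2 * (x ^ 4 * q ^ 6 * t) * (t * t)) ≡ x ^ 4 * (32 * (q ^ 10 * M ^ 4 * t ^ 3))
      eq₃ q M x t = trans (pow-eq₃ (q ^ 4) (M ^ 4) (x ^ 4) (q ^ 6) t)
        (cong (λ z → x ^ 4 * (32 * (z * M ^ 4 * t ^ 3))) (sym (^-distribˡ-+-* q 4 6)))
      eq₄ : ∀ a q b c e → a * (q * (b * c * e)) ≡ a * (q * b * c * e)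
      eq₄ = solve-∀

-- Integers of bounded absolute value.

module Box where

  import Data.Nat.Properties as ℕ
  open import Data.Integer hiding (suc; pred)
  open import Data.Integer.Properties
  open import Data.Integer.Tactic.RingSolver using (solve-∀)

  minus-cancelʳ : ∀ {x y} z → x - z ≡ y - z → x ≡ y
  minus-cancelʳ {x} {y} z e = trans (sym (eqn x z)) (trans (cong (λ w → w + z) e) (eqn y z))
    where
    eqn : ∀ a b → a - b + b ≡ a
    eqn = solve-∀

  shift-nonneg : ∀ {z M} → ∣ z ∣ ℕ.≤ M → ∃ λ i → z + + M ≡ + i × i ℕ.≤ M ℕ.+ M
  shift-nonneg {+ n} {M} h = n ℕ.+ M , refl , ℕ.+-monoˡ-≤ M h
  shift-nonneg { -[1+ n ]} {M} h = M ℕ.∸ suc n , ⊖-≥ h , ℕ.≤-trans (ℕ.m∸n≤m M (suc n)) (ℕ.m≤m+n M M)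

  opaque
    Box : ℕ → List ℤ
    Box M = map (λ i → + i - + M) (upTo (suc (M ℕ.+ M)))

    length-Box : ∀ M → length (Box M) ≡ suc (M ℕ.+ M)
    length-Box M = trans (length-map _ (upTo (suc (M ℕ.+ M)))) (length-upTo _)

    Box-unique : ∀ M → Unique (Box M)
    Box-unique M = map⁺ (λ e → +-injective (minus-cancelʳ (+ M) e)) (upTo⁺ (suc (M ℕ.+ M)))

    ∈-Box⁺ : ∀ {z M} → ∣ z ∣ ℕ.≤ M → z ∈ Box M
    ∈-Box⁺ {z} {M} h with shift-nonneg {z} h
    ... | i , eq , le = subst (_∈ Box M) (trans (cong (_- + M) (sym eq)) (eqn z (+ M)))
            (∈-map⁺ (λ i → + i - + M) (∈-upTo⁺ (s≤s le)))
      where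
      eqn : ∀ z m → z + m - m ≡ z
      eqn = solve-∀

    ∈-Box⁻ : ∀ {z M} → z ∈ Box M → ∣ z ∣ ℕ.≤ M
    ∈-Box⁻ {z} {M} i with ∈-map⁻ (λ i → + i - + M) i
    ... | j , k , refl with ℕ.≤-total j M | ℕ.≤-pred (∈-upTo⁻ k)
    ...   | h | j≤2M rewrite m-n≡m⊖n j M = bound h
      where
      bound : j ℕ.≤ M ⊎ M ℕ.≤ j → ∣ j ⊖ M ∣ ℕ.≤ M
      bound (inj₁ j≤M) = subst (ℕ._≤ M) (sym (trans (cong ∣_∣ (⊖-≤ j≤M)) (∣-i∣≡∣i∣ (+ (M ℕ.∸ j))))) (ℕ.m∸n≤m M j)
      bound (inj₂ M≤j) = subst (ℕ._≤ M) (sym (cong ∣_∣ (⊖-≥ M≤j)))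
        (ℕ.≤-trans (ℕ.∸-monoˡ-≤ M j≤2M) (ℕ.≤-reflexive (ℕ.m+n∸n≡m M M)))

-- Arithmetic modulo a prime, carried out on integers.

module ModP (p : ℕ) (pr : Prime p) where

  open import Data.Nat.Primality using (euclidsLemma; prime⇒nonZero; prime⇒nonTrivial)
  import Data.Nat.Properties as ℕ
  import Data.Nat.Divisibility as ℕ
  import Data.Nat.Coprimality as ℕ
  import Data.Nat.GCD as ℕ
  open import Data.Integer hiding (suc; pred)
  open import Data.Integer.Properties
  open import Data.Integer.DivMod using (_%ℕ_; _/ℕ_; n%ℕd<d; a≡a%ℕn+[a/ℕn]*n)
  open import Data.Integer.Divisibility.Signed
  open import Data.Integer.Tactic.RingSolver using (solve-∀)

  instance
    p≢0 : ℕ.NonZero p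
    p≢0 = prime⇒nonZero pr

  P : ℤ
  P = + p

  infix 4 _≈_ _≉_ _≈?_

  -- A record instead of the bare divisibility, so that `x` and `y` can be inferred from the type of
  -- a congruence.
  record _≈_ (x y : ℤ) : Set where
    constructor mod
    field
      difference : P ∣ x - y

  _≉_ : ℤ → ℤ → Set
  x ≉ y = ¬ x ≈ y

  _≈?_ : ∀ x y → Dec (x ≈ y)
  x ≈? y = map′ mod _≈_.difference (P ∣? (x - y))

  -- Congruences are derived as integer combinations of known ones; the coefficients are a
  -- certificate that leaves only a ring identity to the solver.
  lin₁ : ∀ {a b x y} → x ≈ y → ∀ c → a - b ≡ c * (x - y) → a ≈ b
  lin₁ (mod h) c eq = mod (subst (P ∣_) (sym eq) (∣n⇒∣m*n c h))

  lin₂ : ∀ {a b x y z w} → x ≈ y → z ≈ w → ∀ c d → a - b ≡ c * (x - y) + d * (z - w) → a ≈ b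
  lin₂ (mod h) (mod k) c d eq = mod (subst (P ∣_) (sym eq) (∣m∣n⇒∣m+n (∣n⇒∣m*n c h) (∣n⇒∣m*n d k)))

  ≈-refl : ∀ {x} → x ≈ x
  ≈-refl {x} = mod (subst (P ∣_) (sym (+-inverseʳ x)) (divides 0ℤ refl))

  ≈-reflexive : ∀ {x y} → x ≡ y → x ≈ y
  ≈-reflexive refl = ≈-refl

  ≈-sym : ∀ {x y} → x ≈ y → y ≈ x
  ≈-sym {x} {y} h = lin₁ h -1ℤ (eqn x y)
    where
    eqn : ∀ x y → y - x ≡ -1ℤ * (x - y)
    eqn = solve-∀

  ≈-trans : ∀ {x y z} → x ≈ y → y ≈ z → x ≈ z
  ≈-trans {x} {y} {z} h k = lin₂ h k 1ℤ 1ℤ (eqn x y z)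
    where
    eqn : ∀ x y z → x - z ≡ 1ℤ * (x - y) + 1ℤ * (y - z)
    eqn = solve-∀

  infixr 2 _≈⟨_⟩_ _≡⟨_⟩≈_
  infix 3 _≈∎

  _≈⟨_⟩_ : ∀ x {y z} → x ≈ y → y ≈ z → x ≈ z
  x ≈⟨ h ⟩ k = ≈-trans h k

  _≡⟨_⟩≈_ : ∀ x {y z} → x ≡ y → y ≈ z → x ≈ z
  x ≡⟨ refl ⟩≈ k = k

  _≈∎ : ∀ x → x ≈ x
  x ≈∎ = ≈-refl

  ≈-+ : ∀ {x y z w} → x ≈ y → z ≈ w → x + z ≈ y + w
  ≈-+ {x} {y} {z} {w} h k = lin₂ h k 1ℤ 1ℤ (eqn x y z w)
    where
    eqn : ∀ x y z w → (x + z) - (y + w) ≡ 1ℤ * (x - y) + 1ℤ * (z - w)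
    eqn = solve-∀

  ≈-- : ∀ {x y z w} → x ≈ y → z ≈ w → x - z ≈ y - w
  ≈-- {x} {y} {z} {w} h k = lin₂ h k 1ℤ -1ℤ (eqn x y z w)
    where
    eqn : ∀ x y z w → (x - z) - (y - w) ≡ 1ℤ * (x - y) + -1ℤ * (z - w)
    eqn = solve-∀

  ≈-* : ∀ {x y z w} → x ≈ y → z ≈ w → x * z ≈ y * w
  ≈-* {x} {y} {z} {w} h k = lin₂ h k z y (eqn x y z w)
    where
    eqn : ∀ x y z w → x * z - y * w ≡ z * (x - y) + y * (z - w)
    eqn = solve-∀

  ≈-^ : ∀ {x y} e → x ≈ y → x ^ e ≈ y ^ e
  ≈-^ zero h = ≈-refl
  ≈-^ (suc e) h = ≈-* h (≈-^ e h)

  ^-distribʳ-*ℤ : ∀ e a b → (a * b) ^ e ≡ a ^ e * b ^ e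
  ^-distribʳ-*ℤ zero a b = refl
  ^-distribʳ-*ℤ (suc e) a b = trans (cong (a * b *_) (^-distribʳ-*ℤ e a b)) (eqn a b (a ^ e) (b ^ e))
    where
    eqn : ∀ w x y z → (w * x) * (y * z) ≡ (w * y) * (x * z)
    eqn = solve-∀

  x-0≡x : ∀ x → x - 0ℤ ≡ x
  x-0≡x = +-identityʳ

  ≈0⇒∣ : ∀ {x} → x ≈ 0ℤ → p ℕ.∣ ∣ x ∣
  ≈0⇒∣ {x} (mod h) = ∣⇒∣ᵤ (subst (P ∣_) (x-0≡x x) h)

  ∣⇒≈0 : ∀ {x} → p ℕ.∣ ∣ x ∣ → x ≈ 0ℤ
  ∣⇒≈0 {x} h = mod (subst (P ∣_) (sym (x-0≡x x)) (∣ᵤ⇒∣ h))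

  ≈⇒-≈0 : ∀ {x y} → x ≈ y → x - y ≈ 0ℤ
  ≈⇒-≈0 {x} {y} (mod h) = mod (subst (P ∣_) (sym (x-0≡x (x - y))) h)

  -≈0⇒≈ : ∀ {x y} → x - y ≈ 0ℤ → x ≈ y
  -≈0⇒≈ {x} {y} (mod h) = mod (subst (P ∣_) (x-0≡x (x - y)) h)

  small≈0 : ∀ {x} → ∣ x ∣ ℕ.< p → x ≈ 0ℤ → x ≡ 0ℤ
  small≈0 {x} lt h with ∣ x ∣ in eq | ≈0⇒∣ h
  ... | zero | _ = ∣i∣≡0⇒i≡0 eq
  ... | suc n | d = ⊥-elim (ℕ.>⇒∤ lt d)

  small≈ : ∀ {x y} → ∣ x - y ∣ ℕ.< p → x ≈ y → x ≡ y
  small≈ {x} {y} lt h = i-j≡0⇒i≡j x y (small≈0 lt (≈⇒-≈0 h))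

  1≉0 : 1ℤ ≉ 0ℤ
  1≉0 h = ℕ.>⇒∤ (ℕ.nonTrivial⇒n>1 p {{prime⇒nonTrivial pr}}) (≈0⇒∣ h)

  euclid : ∀ {x y} → x * y ≈ 0ℤ → x ≈ 0ℤ ⊎ y ≈ 0ℤ
  euclid {x} {y} h with euclidsLemma ∣ x ∣ ∣ y ∣ pr (subst (p ℕ.∣_) (abs-* x y) (≈0⇒∣ h))
  ... | inj₁ k = inj₁ (∣⇒≈0 k)
  ... | inj₂ k = inj₂ (∣⇒≈0 k)

  *≉0 : ∀ {x y} → x ≉ 0ℤ → y ≉ 0ℤ → x * y ≉ 0ℤ
  *≉0 x≉0 y≉0 h with euclid h
  ... | inj₁ k = x≉0 k
  ... | inj₂ k = y≉0 k

  *≉0⁻ˡ : ∀ {x} y → x * y ≉ 0ℤ → x ≉ 0ℤ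
  *≉0⁻ˡ {x} y h k = h (lin₁ k y (eqn x y))
    where
    eqn : ∀ x y → x * y - 0ℤ ≡ y * (x - 0ℤ)
    eqn = solve-∀

  *≉0⁻ʳ : ∀ x {y} → x * y ≉ 0ℤ → y ≉ 0ℤ
  *≉0⁻ʳ x {y} h k = h (lin₁ k x (eqn x y))
    where
    eqn : ∀ x y → x * y - 0ℤ ≡ x * (y - 0ℤ)
    eqn = solve-∀

  ≈-cancelˡ : ∀ z {x y} → z ≉ 0ℤ → z * x ≈ z * y → x ≈ y
  ≈-cancelˡ z {x} {y} z≉0 h with euclid {z} {x - y} (lin₁ h 1ℤ (eqn z x y))
    where
    eqn : ∀ z x y → z * (x - y) - 0ℤ ≡ 1ℤ * (z * x - z * y)
    eqn = solve-∀
  ... | inj₁ k = ⊥-elim (z≉0 k)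
  ... | inj₂ k = -≈0⇒≈ k

  ≈-cancelʳ : ∀ z {x y} → z ≉ 0ℤ → x * z ≈ y * z → x ≈ y
  ≈-cancelʳ z {x} {y} z≉0 h = ≈-cancelˡ z z≉0
    (≈-trans (≈-reflexive (*-comm z x)) (≈-trans h (≈-reflexive (*-comm y z))))

  ^≉0 : ∀ e {x} → x ≉ 0ℤ → x ^ e ≉ 0ℤ
  ^≉0 zero x≉0 = 1≉0
  ^≉0 (suc e) x≉0 = *≉0 x≉0 (^≉0 e x≉0)

  ≉0-resp : ∀ {x y} → x ≈ y → x ≉ 0ℤ → y ≉ 0ℤ
  ≉0-resp h x≉0 y≈0 = x≉0 (≈-trans h y≈0)

  opaque
    Res : List ℤ
    Res = map +_ (upTo p)

    residue : ∀ z → ∃ λ r → r ∈ Res × z ≈ r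
    residue z = + (z %ℕ p) , ∈-map⁺ +_ (∈-upTo⁺ (n%ℕd<d z p)) ,
      mod (divides (z /ℕ p) (eqn z (+ (z %ℕ p)) (z /ℕ p * P) (a≡a%ℕn+[a/ℕn]*n z p)))
      where
      eqn₀ : ∀ y w → (y + w) - y ≡ w
      eqn₀ = solve-∀
      eqn : ∀ x y w → x ≡ y + w → x - y ≡ w
      eqn x y w refl = eqn₀ y w

    Res-unique : Unique Res
    Res-unique = map⁺ +-injective (upTo⁺ p)

    length-Res : length Res ≡ p
    length-Res = trans (length-map +_ (upTo p)) (length-upTo p)

    ∈-Res⁻ : ∀ {x} → x ∈ Res → ∃ λ i → x ≡ + i × i ℕ.< p
    ∈-Res⁻ i with ∈-map⁻ +_ i
    ... | j , k , eq = j , eq , ∈-upTo⁻ k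

    Res-≈ : ∀ {x y} → x ∈ Res → y ∈ Res → x ≈ y → x ≡ y
    Res-≈ i j h with ∈-Res⁻ i | ∈-Res⁻ j
    ... | a , refl , a<p | b , refl , b<p = small≈ (ℕ.≤-<-trans (∣m⊖n∣≤m⊔n a b) (ℕ.⊔-lub a<p b<p)) h
      where
      ∣m⊖n∣≤m⊔n : ∀ m n → ∣ + m - + n ∣ ℕ.≤ m ℕ.⊔ n
      ∣m⊖n∣≤m⊔n m n = subst (λ x → ∣ x ∣ ℕ.≤ m ℕ.⊔ n) (sym (m-n≡m⊖n m n)) (∣m⊝n∣≤m⊔n m n)

  opaque
    inverse : ∀ {y} → y ≉ 0ℤ → ∃ λ z → z * y ≈ 1ℤ
    inverse {y} y≉0 with residue y
    ... | r , i , y≈r with ∈-Res⁻ i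
    ...   | zero , refl , _ = ⊥-elim (y≉0 y≈r)
    ...   | a@(suc _) , refl , a<p with ℕ.coprime-Bézout (ℕ.prime⇒coprime pr a<p)
    ...     | ℕ.Bézout.+- u v eq = - + v , ≈-trans (≈-* (≈-refl { - + v}) y≈r) (mod (divides (- + u) (eqn (+ u) (+ v) (+ a) P eq′)))
      where
      eq′ : 1ℤ + + v * + a ≡ + u * P
      eq′ = trans (cong (λ z → 1ℤ + z) (sym (pos-* v a))) (trans (cong +_ eq) (pos-* u p))
      eqn₀ : ∀ v a → - v * a - 1ℤ ≡ - (1ℤ + v * a)
      eqn₀ = solve-∀
      eqn : ∀ u v a P → 1ℤ + v * a ≡ u * P → - v * a - 1ℤ ≡ - u * P
      eqn u v a P h = trans (eqn₀ v a) (trans (cong -_ h) (neg-distribˡ-* u P))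
    ...     | ℕ.Bézout.-+ u v eq = + v , ≈-trans (≈-* (≈-refl {+ v}) y≈r) (mod (divides (+ u) (eqn (+ u) (+ v) (+ a) P eq′)))
      where
      eq′ : 1ℤ + + u * P ≡ + v * + a
      eq′ = trans (cong (λ z → 1ℤ + z) (sym (pos-* u p))) (trans (cong +_ eq) (pos-* v a))
      eqn₀ : ∀ w → (1ℤ + w) - 1ℤ ≡ w
      eqn₀ = solve-∀
      eqn : ∀ u v a P → 1ℤ + u * P ≡ v * a → v * a - 1ℤ ≡ u * P
      eqn u v a P h = trans (cong (_- 1ℤ) (sym h)) (eqn₀ (u * P))

  opaque
    solve-linear : ∀ {y} → y ≉ 0ℤ → ∀ x → ∃ λ h → h ∈ Res × h * y ≈ x
    solve-linear {y} y≉0 x with inverse y≉0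
    ... | z , zy≈1 with residue (x * z)
    ...   | h , i , xz≈h = h , i , lin₂ xz≈h zy≈1 (- y) x (eqn h x y z)
      where
      eqn : ∀ h x y z → h * y - x ≡ - y * (x * z - h) + x * (z * y - 1ℤ)
      eqn = solve-∀

-- The group of d-th roots of unity modulo p.

module Group (p : ℕ) (pr : Prime p) (d : ℕ) .{{d≢0 : NonZero d}} where

  open ModP p pr
  import Data.Nat.Properties as ℕ
  open import Data.Integer hiding (suc; pred)
  open import Data.Integer.Properties
  open import Data.Integer.Tactic.RingSolver using (solve-∀)

  -- Integer polynomials as functions in Horner form c + x g(x). The equations are exact; only roots
  -- are taken modulo p.
  Degree< : ℕ → (ℤ → ℤ) → Set
  Degree< zero f = ∀ x → f x ≡ 0ℤ
  Degree< (suc e) f = ∃₂ λ c g → Degree< e g × (∀ x → f x ≡ c + x * g x)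

  Monic : ℕ → (ℤ → ℤ) → Set
  Monic zero f = ∀ x → f x ≡ 1ℤ
  Monic (suc e) f = ∃₂ λ c g → Monic e g × (∀ x → f x ≡ c + x * g x)

  monic⇒degree< : ∀ e {f} → Monic e f → Degree< (suc e) f
  monic⇒degree< zero h = 1ℤ , (λ _ → 0ℤ) , (λ _ → refl) , λ x → trans (h x) (sym (trans (cong (λ y → 1ℤ + y) (*-zeroʳ x)) refl))
  monic⇒degree< (suc e) (c , g , m , h) = c , g , monic⇒degree< e m , h

  monic-+ : ∀ e {f g} a → Monic e f → Degree< e g → Monic e (λ x → f x + a * g x)
  monic-+ zero a hf hg x = trans (cong₂ (λ u v → u + a * v) (hf x) (hg x)) (eqn a)
    where
    eqn : ∀ a → 1ℤ + a * 0ℤ ≡ 1ℤ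
    eqn = solve-∀
  monic-+ (suc e) a (c , f′ , mf , hf) (b , g′ , dg , hg) =
    c + a * b , _ , monic-+ e a mf dg , λ x → trans (cong₂ (λ u v → u + a * v) (hf x) (hg x)) (eqn a b c x (f′ x) (g′ x))
    where
    eqn : ∀ a b c x f g → c + x * f + a * (b + x * g) ≡ c + a * b + x * (f + a * g)
    eqn = solve-∀

  -- If f = c + x g and g(x) - g(a) = (x - a) k(x), then f(x) - f(a) = (x - a) (g(x) + a k(x)), and
  -- the cofactor stays monic because k has lower degree than g.
  factor : ∀ e {f} → Monic (suc e) f → ∀ a → ∃ λ g → Monic e g × (∀ x → f x - f a ≡ (x - a) * g x)
  factor zero (c , g , m , h) a = g , m , λ x → trans (cong₂ _-_ (h x) (h a))
    (trans (cong₂ (λ u v → c + x * u - (c + a * v)) (m x) (m a))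
    (trans (eqn c x a) (cong ((x - a) *_) (sym (m x)))))
    where
    eqn : ∀ c x a → c + x * 1ℤ - (c + a * 1ℤ) ≡ (x - a) * 1ℤ
    eqn = solve-∀
  factor (suc e) (c , g , m , h) a with factor e m a
  ... | k , mk , hk = (λ x → g x + a * k x) , monic-+ (suc e) a m (monic⇒degree< e mk) ,
    λ x → trans (cong₂ _-_ (h x) (h a)) (trans (eqn₁ c x a (g x) (g a))
      (trans (cong (λ u → (x - a) * g x + a * u) (hk x)) (eqn₂ a (x - a) (g x) (k x))))
    where
    eqn₁ : ∀ c x a u v → c + x * u - (c + a * v) ≡ (x - a) * u + a * (u - v)
    eqn₁ = solve-∀
    eqn₂ : ∀ a w u k → w * u + a * (w * k) ≡ w * (u + a * k)
    eqn₂ = solve-∀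

  roots-bound : ∀ e {f} → Monic e f → ∀ {xs} → Unique xs → All (_∈ Res) xs → All (λ x → f x ≈ 0ℤ) xs → length xs ℕ.≤ e
  roots-bound e m {[]} _ _ _ = z≤n
  roots-bound zero m {x ∷ xs} _ _ (r ∷ _) = ⊥-elim (1≉0 (subst (_≈ 0ℤ) (m x) r))
  roots-bound (suc e) {f} m {a ∷ xs} (a∉ ∷ u) (ia ∷ is) (ra ∷ rs) with factor e m a
  ... | g , mg , h = s≤s (roots-bound e mg u is (All.tabulate root))
    where
    root : ∀ {x} → x ∈ xs → g x ≈ 0ℤ
    root {x} i with euclid {x - a} {g x} (subst (_≈ 0ℤ) (h x) (≈-- (All.lookup rs i) ra))
    ... | inj₂ k = k
    ... | inj₁ k = ⊥-elim (All.lookup a∉ i (sym (Res-≈ (All.lookup is i) ia (-≈0⇒≈ k))))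

  power-monic : ∀ e → Monic e (_^ e)
  power-monic zero x = refl
  power-monic (suc e) = 0ℤ , (_^ e) , power-monic e , λ x → sym (+-identityˡ (x * x ^ e))

  power-minus-one-monic : ∀ e .{{_ : ℕ.NonZero e}} → Monic e (λ x → x ^ e - 1ℤ)
  power-minus-one-monic (suc e) = -1ℤ , (_^ e) , power-monic e , λ x → +-comm (x * x ^ e) -1ℤ

  ∈H? : ∀ h → Dec (h ^ d ≈ 1ℤ)
  ∈H? h = h ^ d ≈? 1ℤ

  opaque
    -- Two units x and y lie in one coset of H iff x ^ d ≈ y ^ d, so cosets need no representatives.
    H : List ℤ
    H = filter ∈H? Res

    H-unique : Unique H
    H-unique = filter⁺ ∈H? Res-unique

    ∈H⁻ : ∀ {h} → h ∈ H → h ∈ Res × h ^ d ≈ 1ℤ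
    ∈H⁻ = ∈-filter⁻ ∈H? {xs = Res}

    H-≈ : ∀ {g h} → g ∈ H → h ∈ H → g ≈ h → g ≡ h
    H-≈ i j = Res-≈ (proj₁ (∈H⁻ i)) (proj₁ (∈H⁻ j))

    0^ : ∀ e .{{_ : ℕ.NonZero e}} → 0ℤ ^ e ≡ 0ℤ
    0^ (suc e) = refl

    H≉0 : ∀ {h} → h ∈ H → h ≉ 0ℤ
    H≉0 i h≈0 = 1≉0 (≈-trans (≈-sym (proj₂ (∈H⁻ i))) (≈-trans (≈-^ d h≈0) (≈-reflexive (0^ d))))

    ∈H⁺ : ∀ {z} → z ^ d ≈ 1ℤ → ∃ λ h → h ∈ H × z ≈ h
    ∈H⁺ {z} zᵈ≈1 with residue z
    ... | h , i , z≈h = h , ∈-filter⁺ ∈H? i (≈-trans (≈-sym (≈-^ d z≈h)) zᵈ≈1) , z≈h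

    t≤d : length H ℕ.≤ d
    t≤d = roots-bound d (power-minus-one-monic d) H-unique
      (All.tabulate (λ i → proj₁ (∈H⁻ i))) (All.tabulate (λ i → ≈⇒-≈0 (proj₂ (∈H⁻ i))))

  opaque
    unfolding H

    ratio : ∀ {x y} → y ≉ 0ℤ → x ^ d ≈ y ^ d → ∃ λ h → h ∈ H × x ≈ h * y
    ratio {x} {y} y≉0 xᵈ≈yᵈ with solve-linear y≉0 x
    ... | h , i , hy≈x = h , ∈-filter⁺ ∈H? i hᵈ≈1 , ≈-sym hy≈x
      where
      hᵈ≈1 : h ^ d ≈ 1ℤ
      hᵈ≈1 = ≈-cancelʳ (y ^ d) {h ^ d} {1ℤ} (^≉0 d y≉0) (
        h ^ d * y ^ d ≡⟨ sym (^-distribʳ-*ℤ d h y) ⟩≈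
        (h * y) ^ d ≈⟨ ≈-^ d hy≈x ⟩
        x ^ d ≈⟨ xᵈ≈yᵈ ⟩
        y ^ d ≡⟨ sym (*-identityˡ (y ^ d)) ⟩≈
        1ℤ * y ^ d ≈∎)

    H-coset : ∀ {h} → h ∈ H → ∀ y → (h * y) ^ d ≈ y ^ d
    H-coset {h} i y =
      (h * y) ^ d ≡⟨ ^-distribʳ-*ℤ d h y ⟩≈
      h ^ d * y ^ d ≈⟨ ≈-* (proj₂ (∈H⁻ i)) (≈-refl {y ^ d}) ⟩
      1ℤ * y ^ d ≡⟨ *-identityˡ (y ^ d) ⟩≈
      y ^ d ≈∎

    H-closed : ∀ {g h} → g ∈ H → h ∈ H → ∃ λ k → k ∈ H × g * h ≈ k
    H-closed {g} {h} i j = ∈H⁺ (≈-trans (H-coset i h) (proj₂ (∈H⁻ j)))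

  t : ℕ
  t = length H

-- Points of the lattice x = r y modulo p in a square.

module Lattice (p : ℕ) (pr : Prime p) where

  open Counting
  open Arith
  open Box
  open ModP p pr
  import Data.Nat.Properties as ℕ
  import Data.Nat.DivMod as ℕ
  import Data.Nat.Divisibility as ℕ
  import Data.Nat.GCD as ℕ
  import Data.Nat.Coprimality as ℕ
  open import Data.Integer hiding (suc; pred)
  open import Data.Integer.Properties
  open import Data.Integer.Divisibility.Signed
  open import Data.Integer.Tactic.RingSolver using (solve-∀)

  OnLine : ℤ → ℤ × ℤ → Set
  OnLine r (x , y) = x ≈ r * y

  onLine? : ∀ r xy → Dec (OnLine r xy)
  onLine? r (x , y) = x ≈? r * y

  OnLine* : ℤ → ℤ × ℤ → Set
  OnLine* r (x , y) = y ≉ 0ℤ × x ≈ r * y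

  onLine*? : ∀ r xy → Dec (OnLine* r xy)
  onLine*? r (x , y) = ¬? (y ≈? 0ℤ) ×-dec x ≈? r * y

  Square : ℕ → List (ℤ × ℤ)
  Square M = cartesianProduct (Box M) (Box M)

  ∈-Square⁺ : ∀ {x y M} → ∣ x ∣ ℕ.≤ M → ∣ y ∣ ℕ.≤ M → (x , y) ∈ Square M
  ∈-Square⁺ {x} {y} hx hy = ∈-cartesianProduct⁺ (∈-Box⁺ {x} hx) (∈-Box⁺ {y} hy)

  ∈-Square⁻ : ∀ {x y M} → (x , y) ∈ Square M → ∣ x ∣ ℕ.≤ M × ∣ y ∣ ℕ.≤ M
  ∈-Square⁻ {x} {y} {M} i with ∈-cartesianProduct⁻ (Box M) (Box M) i
  ... | ix , iy = ∈-Box⁻ {x} ix , ∈-Box⁻ {y} iy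

  Square-unique : ∀ M → Unique (Square M)
  Square-unique M = cartesianProduct⁺ (Box-unique M) (Box-unique M)

  opaque
    -- All lattice points in the square, and those with an invertible second coordinate. The latter
    -- are the ways to write r as a fraction of height at most M.
    Λ-points J-points : ℕ → ℤ → List (ℤ × ℤ)
    Λ-points M r = filter (onLine? r) (Square M)
    J-points M r = filter (onLine*? r) (Square M)

    J-points-unique : ∀ M r → Unique (J-points M r)
    J-points-unique M r = filter⁺ (onLine*? r) (Square-unique M)

    ∈-J⁺ : ∀ {x y M r} → ∣ x ∣ ℕ.≤ M → ∣ y ∣ ℕ.≤ M → y ≉ 0ℤ → x ≈ r * y → (x , y) ∈ J-points M r
    ∈-J⁺ {x} {y} {M} {r} hx hy y≉0 h = ∈-filter⁺ (onLine*? r) (∈-Square⁺ {x} {y} hx hy) (y≉0 , h)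

    ∈-J⁻ : ∀ {x y M r} → (x , y) ∈ J-points M r → (∣ x ∣ ℕ.≤ M × ∣ y ∣ ℕ.≤ M) × y ≉ 0ℤ × x ≈ r * y
    ∈-J⁻ {x} {y} {M} {r} i with ∈-filter⁻ (onLine*? r) {xs = Square M} i
    ... | i′ , h = ∈-Square⁻ {x} {y} i′ , h

    ∈-Λ⁺ : ∀ {x y M r} → ∣ x ∣ ℕ.≤ M → ∣ y ∣ ℕ.≤ M → x ≈ r * y → (x , y) ∈ Λ-points M r
    ∈-Λ⁺ {x} {y} {M} {r} hx hy h = ∈-filter⁺ (onLine? r) (∈-Square⁺ {x} {y} hx hy) h

    ∈-Λ⁻ : ∀ {x y M r} → (x , y) ∈ Λ-points M r → (∣ x ∣ ℕ.≤ M × ∣ y ∣ ℕ.≤ M) × x ≈ r * y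
    ∈-Λ⁻ {x} {y} {M} {r} i with ∈-filter⁻ (onLine? r) {xs = Square M} i
    ... | i′ , h = ∈-Square⁻ {x} {y} i′ , h

    Λ-points-unique : ∀ M r → Unique (Λ-points M r)
    Λ-points-unique M r = filter⁺ (onLine? r) (Square-unique M)

  Λ J : ℕ → ℤ → ℕ
  Λ M r = length (Λ-points M r)
  J M r = length (J-points M r)

  nonempty : ∀ {A : Set} (xs : List A) → 1 ℕ.≤ length xs → ∃ λ x → x ∈ xs
  nonempty (x ∷ xs) _ = x , here refl

  ∈⇒1≤ : ∀ {A : Set} {x : A} {xs : List A} → x ∈ xs → 1 ℕ.≤ length xs
  ∈⇒1≤ (here _) = s≤s z≤n
  ∈⇒1≤ (there _) = s≤s z≤n

  J-mono : ∀ {M N} r → M ℕ.≤ N → 1 ℕ.≤ J M r → 1 ℕ.≤ J N r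
  J-mono {M} {N} r M≤N h with nonempty (J-points M r) h
  ... | (x , y) , i with ∈-J⁻ {x} {y} i
  ... | (hx , hy) , y≉0 , e = ∈⇒1≤ (∈-J⁺ {x} {y} {N} {r} (ℕ.≤-trans hx M≤N) (ℕ.≤-trans hy M≤N) y≉0 e)

  -- For M < p, a coordinate y ≈ 0 is 0, and then so is x: only the origin separates the two counts.
  Λ≤1+J : ∀ {M} r → M ℕ.< p → Λ M r ℕ.≤ suc (J M r)
  Λ≤1+J {M} r M<p = left-unique-relation _≡_ ((0ℤ , 0ℤ) ∷ J-points M r)
    (Λ-points-unique M r) total (λ _ _ _ e e′ → trans e (sym e′))
    where
    total : ∀ {xy} → xy ∈ Λ-points M r → ∃ λ uv → uv ∈ ((0ℤ , 0ℤ) ∷ J-points M r) × xy ≡ uv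
    total {x , y} i with ∈-Λ⁻ {x} {y} i | y ≈? 0ℤ
    ...   | (hx , hy) , h | no y≉0 = (x , y) , there (∈-J⁺ {x} {y} hx hy y≉0 h) , refl
    ...   | (hx , hy) , h | yes y≈0 = (0ℤ , 0ℤ) , here refl ,
              cong₂ _,_ (small≈0 (ℕ.≤-<-trans hx M<p)
                           (≈-trans h (≈-trans (≈-* (≈-refl {r}) y≈0) (≈-reflexive (*-zeroʳ r)))))
                        (small≈0 (ℕ.≤-<-trans hy M<p) y≈0)

  same-quotient : ∀ K .{{_ : ℕ.NonZero K}} i i′ → i ℕ./ K ≡ i′ ℕ./ K → ∣ + i - + i′ ∣ ℕ.< K
  same-quotient K i i′ eq = subst (ℕ._< K) (cong ∣_∣ (sym diff))
    (subst (λ z → ∣ z ∣ ℕ.< K) (sym (m-n≡m⊖n r r′))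
      (ℕ.≤-<-trans (∣m⊝n∣≤m⊔n r r′) (ℕ.⊔-lub (ℕ.m%n<n i K) (ℕ.m%n<n i′ K))))
    where
    r = i ℕ.% K
    r′ = i′ ℕ.% K
    eqn : ∀ x y z → (x + z) - (y + z) ≡ x - y
    eqn = solve-∀
    diff : + i - + i′ ≡ + r - + r′
    diff = trans (cong₂ (λ a b → + a - + b) (ℕ.m≡m%n+[m/n]*n i K)
             (trans (ℕ.m≡m%n+[m/n]*n i′ K) (cong (λ c → r′ ℕ.+ c ℕ.* K) (sym eq))))
           (eqn (+ r) (+ r′) (+ (i ℕ./ K ℕ.* K)))

  -- A point of the lattice in the square is determined by the integer (a v - b u) / p,
  -- which names a line of direction (u , v), and by its position ⌊(a + M) / |u|⌋ on it.
  line-count : ∀ {u v : ℤ} {M} → ℕ.Coprime ∣ u ∣ ∣ v ∣ → ∣ v ∣ ℕ.≤ ∣ u ∣ → ∣ u ∣ ℕ.≤ M → 1 ℕ.≤ ∣ u ∣ →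
    {xs : List (ℤ × ℤ)} → Unique xs →
    (∀ {a b} → (a , b) ∈ xs → (∣ a ∣ ℕ.≤ M × ∣ b ∣ ℕ.≤ M) × a * v ≈ b * u) →
    ∣ u ∣ ℕ.* (p ℕ.* length xs) ℕ.≤ 12 ℕ.* (M ℕ.* M) ℕ.* ∣ u ∣ ℕ.+ 3 ℕ.* M ℕ.* p
  line-count {u} {v} {M} cop v≤u u≤M 1≤u {xs} uniq prop =
    grid-bound {p} {K} {M} {W} {V} u≤M (ℕ.m/n*n≤m (2 ℕ.* M ℕ.* K) p) (ℕ.m/n*n≤m (M ℕ.+ M) K)
      (ℕ.≤-trans (left-unique-relation R targets uniq total unique)
        (ℕ.≤-reflexive (trans (length-× (Box W) (upTo (suc V))) (cong₂ ℕ._*_ (length-Box W) (length-upTo (suc V))))))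
    where
    K = ∣ u ∣
    instance
      K≢0 : ℕ.NonZero K
      K≢0 = ℕ.>-nonZero 1≤u
    W = (2 ℕ.* M ℕ.* K) ℕ./ p
    V = (M ℕ.+ M) ℕ./ K
    targets = cartesianProduct (Box W) (upTo (suc V))
    R : ℤ × ℤ → ℤ × ℕ → Set
    R (a , b) (j , c) = a * v - b * u ≡ j * P × ∃ λ i → a + + M ≡ + i × i ℕ./ K ≡ c
    total : ∀ {x} → x ∈ xs → ∃ λ y → y ∈ targets × R x y
    total {a , b} i with prop i
    ... | (ha , hb) , mod (divides j eq) with shift-nonneg {a} ha
    ...   | k , ek , k≤2M = (j , k ℕ./ K) ,
      ∈-cartesianProduct⁺ (∈-Box⁺ {j} j≤W) (∈-upTo⁺ (s≤s (ℕ./-monoˡ-≤ K k≤2M))) , eq , k , ek , refl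
      where
      open ℕ.≤-Reasoning
      jp≤ : ∣ j ∣ ℕ.* p ℕ.≤ 2 ℕ.* M ℕ.* K
      jp≤ = begin
        ∣ j ∣ ℕ.* p ≡⟨ abs-* j P ⟨
        ∣ j * P ∣ ≡⟨ cong ∣_∣ eq ⟨
        ∣ a * v - b * u ∣ ≤⟨ ∣i-j∣≤∣i∣+∣j∣ (a * v) (b * u) ⟩
        ∣ a * v ∣ ℕ.+ ∣ b * u ∣ ≡⟨ cong₂ ℕ._+_ (abs-* a v) (abs-* b u) ⟩
        ∣ a ∣ ℕ.* ∣ v ∣ ℕ.+ ∣ b ∣ ℕ.* K ≤⟨ ℕ.+-mono-≤ (ℕ.*-mono-≤ ha v≤u) (ℕ.*-monoˡ-≤ K hb) ⟩
        M ℕ.* K ℕ.+ M ℕ.* K ≡⟨ ℕ.*-distribʳ-+ K M M ⟨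
        (M ℕ.+ M) ℕ.* K ≡⟨ cong (λ z → (M ℕ.+ z) ℕ.* K) (ℕ.+-identityʳ M) ⟨
        2 ℕ.* M ℕ.* K ∎
      j≤W : ∣ j ∣ ℕ.≤ W
      j≤W = ℕ.≤-trans (ℕ.≤-reflexive (sym (ℕ.m*n/n≡m ∣ j ∣ p))) (ℕ./-monoˡ-≤ p jp≤)
    unique : ∀ {x x′} y → x ∈ xs → x′ ∈ xs → R x y → R x′ y → x ≡ x′
    unique {a , b} {a′ , b′} (j , c) _ _ (e , i , ei , ci) (e′ , i′ , ei′ , ci′) = cong₂ _,_ a≡a′ b≡b′
      where
      cross : (b - b′) * u ≡ (a - a′) * v
      cross = trans (eqn a b a′ b′ u v) (trans (cong (λ w → (a - a′) * v - w) (trans (cong₂ _-_ e e′) (+-inverseʳ (j * P)))) (+-identityʳ _))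
        where
        eqn : ∀ a b a′ b′ u v → (b - b′) * u ≡ (a - a′) * v - ((a * v - b * u) - (a′ * v - b′ * u))
        eqn = solve-∀
      -- Two points on the same line differ by a multiple of the primitive vector (u , v), so |u|
      -- divides a - a′; the common position makes this difference smaller than |u|.
      K∣ : K ℕ.∣ ∣ a - a′ ∣
      K∣ = ℕ.coprime-divisor cop (ℕ.divides ∣ b - b′ ∣ (trans (ℕ.*-comm ∣ v ∣ ∣ a - a′ ∣)
             (trans (sym (abs-* (a - a′) v)) (trans (cong ∣_∣ (sym cross)) (abs-* (b - b′) u)))))
      small : ∣ a - a′ ∣ ℕ.< K
      small = subst (λ z → ∣ z ∣ ℕ.< K) (trans (cong₂ _-_ (sym ei) (sym ei′)) (eqn a a′ (+ M)))
                (same-quotient K i i′ (trans ci (sym ci′)))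
        where
        eqn : ∀ a a′ m → (a + m) - (a′ + m) ≡ a - a′
        eqn = solve-∀
      zero-of : ∀ n → K ℕ.∣ n → n ℕ.< K → n ≡ 0
      zero-of zero _ _ = refl
      zero-of (suc n) K∣n n<K = ⊥-elim (ℕ.>⇒∤ n<K K∣n)
      a≡a′ : a ≡ a′
      a≡a′ = i-j≡0⇒i≡j a a′ (∣i∣≡0⇒i≡0 (zero-of ∣ a - a′ ∣ K∣ small))
      b≡b′ : b ≡ b′
      b≡b′ = i-j≡0⇒i≡j b b′ (∣i∣≡0⇒i≡0 (ℕ.m*n≡0⇒m≡0 ∣ b - b′ ∣ K (trans (sym (abs-* (b - b′) u))
        (cong ∣_∣ (trans cross (trans (cong (_* v) (trans (cong (_- a′) a≡a′) (+-inverseʳ a′))) (*-zeroˡ v)))))))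

  opaque
    multiple-of : ∀ g x → g ℕ.∣ ∣ x ∣ → ∃ λ u → x ≡ u * + g
    multiple-of g x h with ∣ᵤ⇒∣ {+ g} {x} h
    ... | divides u eu = u , eu

  opaque
    nat-gcd : ∀ a b → ∃ λ g → g ℕ.∣ a × g ℕ.∣ b × ℕ.gcd a b ≡ g
    nat-gcd a b = ℕ.gcd a b , ℕ.gcd[m,n]∣m a b , ℕ.gcd[m,n]∣n a b , refl

  opaque
    -- The gcd divides y ≉ 0, hence is invertible modulo p and can be cancelled from the congruence.
    reduce : ∀ {x y} r → y ≉ 0ℤ → x ≈ r * y → ∃₂ λ u v →
      ℕ.Coprime ∣ u ∣ ∣ v ∣ × ∣ u ∣ ℕ.≤ ∣ x ∣ × ∣ v ∣ ℕ.≤ ∣ y ∣ × v ≉ 0ℤ × u ≈ r * v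
    reduce {x} {y} r y≉0 h with nat-gcd ∣ x ∣ ∣ y ∣
    ... | g , g∣x , g∣y , gcd≡g with multiple-of g x g∣x | multiple-of g y g∣y
    ...   | u , eu | v , ev = u , v , cop , le u x eu , le v y ev , v≉0 , u≈rv
      where
      vg≉0 : v * + g ≉ 0ℤ
      vg≉0 = subst (_≉ 0ℤ) ev y≉0
      v≉0 : v ≉ 0ℤ
      v≉0 = *≉0⁻ˡ {v} (+ g) vg≉0
      g≉0 : + g ≉ 0ℤ
      g≉0 = *≉0⁻ʳ v {+ g} vg≉0
      instance
        g≢0 : ℕ.NonZero g
        g≢0 = ℕ.≢-nonZero (λ e → g≉0 (≈-reflexive (cong +_ e)))
      le : ∀ w z → z ≡ w * + g → ∣ w ∣ ℕ.≤ ∣ z ∣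
      le w z eq = subst (∣ w ∣ ℕ.≤_) (trans (sym (abs-* w (+ g))) (cong ∣_∣ (sym eq))) (ℕ.m≤m*n ∣ w ∣ g)
      u≈rv : u ≈ r * v
      u≈rv = ≈-cancelʳ (+ g) {u} {r * v} g≉0 (u * + g ≡⟨ sym eu ⟩≈ x ≈⟨ h ⟩ r * y ≡⟨ cong (r *_) ev ⟩≈
               r * (v * + g) ≡⟨ sym (*-assoc r v (+ g)) ⟩≈ r * v * + g ≈∎)
      abs-eq : ∀ w z → z ≡ w * + g → g ℕ.* ∣ w ∣ ≡ ∣ z ∣
      abs-eq w z eq = trans (ℕ.*-comm g ∣ w ∣) (trans (sym (abs-* w (+ g))) (cong ∣_∣ (sym eq)))
      cop : ℕ.Coprime ∣ u ∣ ∣ v ∣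
      cop = ℕ.gcd≡1⇒coprime (ℕ.*-cancelˡ-≡ (ℕ.gcd ∣ u ∣ ∣ v ∣) 1 g (trans (ℕ.c*gcd[m,n]≡gcd[cm,cn] g ∣ u ∣ ∣ v ∣)
              (trans (cong₂ ℕ.gcd (abs-eq u x eu) (abs-eq v y ev)) (trans gcd≡g (sym (ℕ.*-identityʳ g))))))

  opaque
    -- `K` is the height max(|u|, |v|). `line-count` wants the dominant coordinate first, so the
    -- coordinates are exchanged when it is v.
    coprime-J-bound : ∀ {u v} M r → ℕ.Coprime ∣ u ∣ ∣ v ∣ → ∣ u ∣ ℕ.≤ M → ∣ v ∣ ℕ.≤ M → v ≉ 0ℤ → u ≈ r * v →
      ∃ λ K → ∣ u ∣ ℕ.≤ K × ∣ v ∣ ℕ.≤ K ×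
        K ℕ.* (p ℕ.* J M r) ℕ.≤ 12 ℕ.* (M ℕ.* M) ℕ.* K ℕ.+ 3 ℕ.* M ℕ.* p
    coprime-J-bound {u} {v} M r cop uM vM v≉0 u≈rv with ℕ.≤-total ∣ v ∣ ∣ u ∣
    ... | inj₁ v≤u = ∣ u ∣ , ℕ.≤-refl , v≤u ,
      line-count cop v≤u uM (ℕ.≤-trans v≥1 v≤u) (J-points-unique M r)
        (λ {a} {b} i → let (bd , _ , e) = ∈-J⁻ {a} {b} i in bd , lin₂ e u≈rv v (- b) (eqn a b u v r))
      where
      v≥1 : 1 ℕ.≤ ∣ v ∣
      v≥1 = ℕ.n≢0⇒n>0 (λ e → v≉0 (≈-reflexive (∣i∣≡0⇒i≡0 e)))
      eqn : ∀ a b u v r → a * v - b * u ≡ v * (a - r * b) + - b * (u - r * v)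
      eqn = solve-∀
    ... | inj₂ u≤v = ∣ v ∣ , u≤v , ℕ.≤-refl ,
      subst (λ l → ∣ v ∣ ℕ.* (p ℕ.* l) ℕ.≤ 12 ℕ.* (M ℕ.* M) ℕ.* ∣ v ∣ ℕ.+ 3 ℕ.* M ℕ.* p) (length-map swap (J-points M r))
        (line-count {v} {u} (ℕ.sym cop) u≤v vM (ℕ.n≢0⇒n>0 (λ e → v≉0 (≈-reflexive (∣i∣≡0⇒i≡0 e))))
          (map⁺ (λ { refl → refl }) (J-points-unique M r)) prop)
      where
      eqn : ∀ a b u v r → a * u - b * v ≡ - v * (b - r * a) + a * (u - r * v)
      eqn = solve-∀
      prop : ∀ {a b} → (a , b) ∈ map swap (J-points M r) → (∣ a ∣ ℕ.≤ M × ∣ b ∣ ℕ.≤ M) × a * u ≈ b * v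
      prop i with ∈-map⁻ swap i
      ... | (b , a) , k , refl with ∈-J⁻ {b} {a} k
      ...   | (hb , ha) , _ , e = (ha , hb) , lin₂ e u≈rv (- v) a (eqn a b u v r)

  opaque
    -- Any point in the square reduces to a primitive one, whose height is at least `Q` because
    -- there is no fraction of smaller height. The longer this vector, the fewer lattice points fit
    -- on each line in its direction.
    J-bound : ∀ M Q r → J (Q ℕ.∸ 1) r ≡ 0 →
      Q ℕ.* (p ℕ.* J M r) ℕ.≤ 12 ℕ.* (M ℕ.* M) ℕ.* Q ℕ.+ 3 ℕ.* M ℕ.* p
    J-bound M Q r none with J M r ℕ.≟ 0
    ...   | yes J≡0 = ℕ.≤-trans (ℕ.≤-reflexive (trans (cong (λ j → Q ℕ.* (p ℕ.* j)) J≡0)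
                       (trans (cong (Q ℕ.*_) (ℕ.*-zeroʳ p)) (ℕ.*-zeroʳ Q)))) z≤n
    ...   | no J≢0 with nonempty (J-points M r) (ℕ.n≢0⇒n>0 J≢0)
    ...     | (x , y) , i with ∈-J⁻ {x} {y} i
    ...       | (hx , hy) , y≉0 , x≈ry with reduce {x} {y} r y≉0 x≈ry
    ...         | u , v , cop , ux , vy , v≉0 , u≈rv
                  with coprime-J-bound {u} {v} M r cop (ℕ.≤-trans ux hx) (ℕ.≤-trans vy hy) v≉0 u≈rv
    ...           | K , uK , vK , bound = scale-down (p ℕ.* J M r) (12 ℕ.* (M ℕ.* M)) (3 ℕ.* M ℕ.* p) Q≤K bound
      where
      Q≤K : Q ℕ.≤ K
      Q≤K = ℕ.≮⇒≥ (λ K<Q → ℕ.<⇒≢ (J-mono r (ℕ.∸-monoˡ-≤ 1 K<Q)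
              (∈⇒1≤ (∈-J⁺ {u} {v} {K} {r} uK vK v≉0 u≈rv))) (sym none))

-- The energy bound for pairs of short integers with ratio in H.

module Energy (p : ℕ) (pr : Prime p) (d : ℕ) .{{d≢0 : NonZero d}} where

  open Counting
  open Arith
  open Divisor
  open ModP p pr
  open Group p pr d
  open Lattice p pr
  import Data.Nat.Properties as ℕ
  import Data.Nat.Divisibility as ℕ
  open import Data.Integer hiding (suc; pred)
  open import Data.Integer.Properties
  open import Data.Integer.Tactic.RingSolver using (solve-∀)
  import Data.Nat.Tactic.RingSolver as ℕ

  -- A pair (X , Y) with Y ≉ 0 determines X / Y, so this is the number of such pairs in the square
  -- whose ratio lies in `H`.
  𝒥 : ℕ → ℕ
  𝒥 M = ∑ H (J M)

  opaque
    divisorsℤ : ℤ → List ℤ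
    divisorsℤ x = map +_ (divisors ∣ x ∣) ++ map (λ n → - + n) (divisors ∣ x ∣)

    length-divisorsℤ : ∀ x → length (divisorsℤ x) ≡ τ ∣ x ∣ ℕ.+ τ ∣ x ∣
    length-divisorsℤ x = trans (length-++ (map +_ (divisors ∣ x ∣)))
      (cong₂ ℕ._+_ (length-map _ (divisors ∣ x ∣)) (length-map _ (divisors ∣ x ∣)))

    ∈-divisorsℤ : ∀ u w {x} → u * w ≡ x → x ≢ 0ℤ → u ∈ divisorsℤ x
    ∈-divisorsℤ u w {x} eq x≢0 = signed u divides-x
      where
      instance
        ∣x∣≢0 : ℕ.NonZero ∣ x ∣
        ∣x∣≢0 = ℕ.≢-nonZero (λ e → x≢0 (∣i∣≡0⇒i≡0 e))
      divides-x : ∣ u ∣ ∈ divisors ∣ x ∣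
      divides-x = ∈-divisors (ℕ.divides ∣ w ∣ (trans (cong ∣_∣ (sym eq)) (trans (abs-* u w) (ℕ.*-comm ∣ u ∣ ∣ w ∣))))
      signed : ∀ u → ∣ u ∣ ∈ divisors ∣ x ∣ → u ∈ divisorsℤ x
      signed (+ n) i = ∈-++⁺ˡ (∈-map⁺ +_ i)
      signed -[1+ n ] i = ∈-++⁺ʳ (map +_ (divisors ∣ x ∣)) (∈-map⁺ (λ n → - + n) i)

  first-jump : ∀ (f : ℕ → ℕ) R → f 0 ≡ 0 → 1 ℕ.≤ f (suc R) → ∃ λ j → j ℕ.≤ R × f j ≡ 0 × 1 ℕ.≤ f (suc j)
  first-jump f R f0 fR with f R ℕ.≟ 0
  ... | yes e = R , ℕ.≤-refl , e , fR
  first-jump f zero f0 fR | no ne = ⊥-elim (ne f0)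
  first-jump f (suc R) f0 fR | no ne with first-jump f R f0 (ℕ.n≢0⇒n>0 ne)
  ... | j , j≤R , e , g = j , ℕ.m≤n⇒m≤1+n j≤R , e , g

  -- Used to find the class with the largest s_j / q^j, not merely the largest class: apart from the
  -- area term, class i contributes about M s_i / q^i to the energy.
  ratio-max : ∀ (f g : ℕ → ℕ) R → (∀ i → 1 ℕ.≤ g i) →
    ∃ λ j → j ℕ.≤ R × ∀ i → i ℕ.≤ R → f i ℕ.* g j ℕ.≤ f j ℕ.* g i
  ratio-max f g zero pos = 0 , z≤n , λ { zero z≤n → ℕ.≤-refl }
  ratio-max f g (suc R) pos with ratio-max f g R pos
  ... | j , j≤R , best with ℕ.≤-total (f (suc R) ℕ.* g j) (f j ℕ.* g (suc R))
  ...   | inj₁ le = j , ℕ.m≤n⇒m≤1+n j≤R , below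
    where
    below : ∀ i → i ℕ.≤ suc R → f i ℕ.* g j ℕ.≤ f j ℕ.* g i
    below i i≤ with ℕ.m≤n⇒m<n∨m≡n i≤
    ... | inj₁ i<  = best i (ℕ.≤-pred i<)
    ... | inj₂ refl = le
  ...   | inj₂ ge = suc R , ℕ.≤-refl , below
    where
    below : ∀ i → i ℕ.≤ suc R → f i ℕ.* g (suc R) ℕ.≤ f (suc R) ℕ.* g i
    below i i≤ with ℕ.m≤n⇒m<n∨m≡n i≤
    ... | inj₂ refl = ℕ.≤-refl
    ... | inj₁ i< = ℕ.*-cancelˡ-≤ (g j) {{ℕ.>-nonZero (pos j)}} (begin
      g j ℕ.* (f i ℕ.* g (suc R)) ≡⟨ eqn₁ (g j) (f i) (g (suc R)) ⟩
      f i ℕ.* g j ℕ.* g (suc R) ≤⟨ ℕ.*-monoˡ-≤ (g (suc R)) (best i (ℕ.≤-pred i<)) ⟩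
      f j ℕ.* g i ℕ.* g (suc R) ≡⟨ eqn₂ (f j) (g i) (g (suc R)) ⟩
      f j ℕ.* g (suc R) ℕ.* g i ≤⟨ ℕ.*-monoˡ-≤ (g i) ge ⟩
      f (suc R) ℕ.* g j ℕ.* g i ≡⟨ eqn₃ (f (suc R)) (g j) (g i) ⟩
      g j ℕ.* (f (suc R) ℕ.* g i) ∎)
      where
      open ℕ.≤-Reasoning
      eqn₁ : ∀ a b c → a ℕ.* (b ℕ.* c) ≡ b ℕ.* a ℕ.* c
      eqn₁ = ℕ.solve-∀
      eqn₂ : ∀ a b c → a ℕ.* b ℕ.* c ≡ a ℕ.* c ℕ.* b
      eqn₂ = ℕ.solve-∀
      eqn₃ : ∀ a b c → a ℕ.* b ℕ.* c ≡ b ℕ.* (a ℕ.* c)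
      eqn₃ = ℕ.solve-∀

  module Heights (q R D : ℕ) (2≤q : 2 ℕ.≤ q) (p≤q^ : p ℕ.≤ q ℕ.^ suc R) (D²≤q : D ℕ.* D ℕ.≤ q)
    (few-divisors : ∀ n .{{_ : ℕ.NonZero n}} → n ℕ.≤ q ℕ.^ suc R ℕ.* q ℕ.^ suc R → τ n ℕ.+ τ n ℕ.≤ D) where

    instance
      q≢0 : ℕ.NonZero q
      q≢0 = ℕ.>-nonZero (ℕ.≤-trans (s≤s z≤n) 2≤q)

    -- The least height of r as a fraction lies in [q^j , q^(j+1)); `∸ 1` turns the strict bounds
    -- into weak ones.
    Class : ℕ → ℤ → Set
    Class j r = J (q ℕ.^ j ℕ.∸ 1) r ≡ 0 × 1 ℕ.≤ J (q ℕ.^ suc j ℕ.∸ 1) r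

    class? : ∀ j r → Dec (Class j r)
    class? j r = (J (q ℕ.^ j ℕ.∸ 1) r ℕ.≟ 0) ×-dec (1 ℕ.≤? J (q ℕ.^ suc j ℕ.∸ 1) r)

    opaque
      C : ℕ → List ℤ
      C j = filter (class? j) H

      C-unique : ∀ j → Unique (C j)
      C-unique j = filter⁺ (class? j) H-unique

      ∈-C⁻ : ∀ {j r} → r ∈ C j → r ∈ H × Class j r
      ∈-C⁻ {j} i = ∈-filter⁻ (class? j) {xs = H} i

      length-C≤t : ∀ j → length (C j) ℕ.≤ t
      length-C≤t j = ℕ.≤-trans (ℕ.≤-reflexive (length-filter≡count (class? j) H)) (count≤length (class? j) H)

      ∑-C : ∀ j (f : ℤ → ℕ) → ∑ (C j) f ≡ ∑ H (λ r → 𝟙 (class? j r) ℕ.* f r)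
      ∑-C j f = ∑-filter (class? j) H f

    s : ℕ → ℕ
    s j = length (C j)

    opaque
      -- There is no fraction of height 0, and at height q^(R+1) - 1 ≥ p - 1 there is r / 1; in
      -- between the count becomes positive.
      some-class : ∀ {r} → r ∈ H → ∃ λ j → j ℕ.≤ R × Class j r
      some-class {r} i = first-jump (λ j → J (q ℕ.^ j ℕ.∸ 1) r) R none some
        where
        none : J 0 r ≡ 0
        none with J 0 r ℕ.≟ 0
        ... | yes e = e
        ... | no ne with nonempty (J-points 0 r) (ℕ.n≢0⇒n>0 ne)
        ...   | (x , y) , k with ∈-J⁻ {x} {y} k
        ...     | (_ , hy) , y≉0 , _ = ⊥-elim (y≉0 (≈-reflexive (∣i∣≡0⇒i≡0 (ℕ.n≤0⇒n≡0 hy))))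
        some : 1 ℕ.≤ J (q ℕ.^ suc R ℕ.∸ 1) r
        some with ∈-Res⁻ (proj₁ (∈H⁻ i))
        ... | k , refl , k<p = ∈⇒1≤ (∈-J⁺ {+ k} {1ℤ} (ℕ.∸-monoˡ-≤ 1 (ℕ.≤-trans k<p p≤q^))
                (ℕ.∸-monoˡ-≤ 1 (ℕ.≤-trans 2≤q (ℕ.m≤m*n q (q ℕ.^ R) {{ℕ.m^n≢0 q R}})))
                1≉0 (≈-reflexive (sym (*-identityʳ (+ k)))))

      𝒥≤classes : ∀ M → 𝒥 M ℕ.≤ ∑ (upTo (suc R)) (λ j → ∑ (C j) (J M))
      𝒥≤classes M = begin
        ∑ H (J M) ≤⟨ ∑-mono H (λ {r} i → bound r (some-class i)) ⟩
        ∑ H (λ r → ∑ (upTo (suc R)) (λ j → 𝟙 (class? j r) ℕ.* J M r)) ≡⟨ ∑-swap H (upTo (suc R)) _ ⟩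
        ∑ (upTo (suc R)) (λ j → ∑ H (λ r → 𝟙 (class? j r) ℕ.* J M r)) ≡⟨ ∑-cong (upTo (suc R)) (λ {j} _ → ∑-C j (J M)) ⟨
        ∑ (upTo (suc R)) (λ j → ∑ (C j) (J M)) ∎
        where
        open ℕ.≤-Reasoning
        bound : ∀ r → (∃ λ j → j ℕ.≤ R × Class j r) → J M r ℕ.≤ ∑ (upTo (suc R)) (λ j → 𝟙 (class? j r) ℕ.* J M r)
        bound r (j , j≤R , c) = ℕ.≤-trans
          (ℕ.≤-reflexive (sym (trans (cong (ℕ._* J M r) (𝟙-yes (class? j r) c)) (ℕ.*-identityˡ _))))
          (∈-∑ (λ j → 𝟙 (class? j r) ℕ.* J M r) (∈-upTo⁺ (s≤s j≤R)))

      class-bound : ∀ M i → q ℕ.^ i ℕ.* (p ℕ.* ∑ (C i) (J M)) ℕ.≤ s i ℕ.* (12 ℕ.* (M ℕ.* M) ℕ.* q ℕ.^ i ℕ.+ 3 ℕ.* M ℕ.* p)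
      class-bound M i = begin
        q ℕ.^ i ℕ.* (p ℕ.* ∑ (C i) (J M)) ≡⟨ cong (q ℕ.^ i ℕ.*_) (∑-*ˡ (C i) p (J M)) ⟨
        q ℕ.^ i ℕ.* ∑ (C i) (λ r → p ℕ.* J M r) ≡⟨ ∑-*ˡ (C i) (q ℕ.^ i) (λ r → p ℕ.* J M r) ⟨
        ∑ (C i) (λ r → q ℕ.^ i ℕ.* (p ℕ.* J M r))
          ≤⟨ ∑-bound (C i) _ (λ {r} k → J-bound M (q ℕ.^ i) r (proj₁ (proj₂ (∈-C⁻ {i} k)))) ⟩
        s i ℕ.* (12 ℕ.* (M ℕ.* M) ℕ.* q ℕ.^ i ℕ.+ 3 ℕ.* M ℕ.* p) ∎
        where open ℕ.≤-Reasoning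

      -- The lattice bound 12 M² / p + 3 M / q^i is summed over each class. In the first term s_i is
      -- replaced by t, in the second s_i / q^i by its maximum s_j / q^j.
      total-bound : ∀ j → (∀ i → i ℕ.≤ R → s i ℕ.* q ℕ.^ j ℕ.≤ s j ℕ.* q ℕ.^ i) → ∀ M →
        q ℕ.^ j ℕ.* (p ℕ.* 𝒥 M) ℕ.≤ suc R ℕ.* (12 ℕ.* (M ℕ.* M) ℕ.* t ℕ.* q ℕ.^ j ℕ.+ 3 ℕ.* M ℕ.* p ℕ.* s j)
      total-bound j best M = begin
        q ℕ.^ j ℕ.* (p ℕ.* 𝒥 M) ≤⟨ ℕ.*-monoʳ-≤ (q ℕ.^ j) (ℕ.*-monoʳ-≤ p (𝒥≤classes M)) ⟩
        q ℕ.^ j ℕ.* (p ℕ.* ∑ (upTo (suc R)) Jc) ≡⟨ cong (q ℕ.^ j ℕ.*_) (∑-*ˡ (upTo (suc R)) p Jc) ⟨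
        q ℕ.^ j ℕ.* ∑ (upTo (suc R)) (λ i → p ℕ.* Jc i) ≡⟨ ∑-*ˡ (upTo (suc R)) (q ℕ.^ j) (λ i → p ℕ.* Jc i) ⟨
        ∑ (upTo (suc R)) (λ i → q ℕ.^ j ℕ.* (p ℕ.* Jc i)) ≤⟨ ∑-bound (upTo (suc R)) _ (λ {i} k → each i (ℕ.≤-pred (∈-upTo⁻ k))) ⟩
        length (upTo (suc R)) ℕ.* bound ≡⟨ cong (ℕ._* bound) (length-upTo (suc R)) ⟩
        suc R ℕ.* (12 ℕ.* (M ℕ.* M) ℕ.* t ℕ.* q ℕ.^ j ℕ.+ 3 ℕ.* M ℕ.* p ℕ.* s j) ∎
        where
        open ℕ.≤-Reasoning
        bound : ℕ
        bound = 12 ℕ.* (M ℕ.* M) ℕ.* t ℕ.* q ℕ.^ j ℕ.+ 3 ℕ.* M ℕ.* p ℕ.* s j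
        Jc : ℕ → ℕ
        Jc i = ∑ (C i) (J M)
        each : ∀ i → i ℕ.≤ R → q ℕ.^ j ℕ.* (p ℕ.* Jc i) ℕ.≤ 12 ℕ.* (M ℕ.* M) ℕ.* t ℕ.* q ℕ.^ j ℕ.+ 3 ℕ.* M ℕ.* p ℕ.* s j
        each i i≤R = ℕ.*-cancelˡ-≤ (q ℕ.^ i) {{ℕ.m^n≢0 q i}} (begin
          q ℕ.^ i ℕ.* (q ℕ.^ j ℕ.* (p ℕ.* Jc i)) ≡⟨ eq₁ (q ℕ.^ i) (q ℕ.^ j) (p ℕ.* Jc i) ⟩
          q ℕ.^ j ℕ.* (q ℕ.^ i ℕ.* (p ℕ.* Jc i)) ≤⟨ ℕ.*-monoʳ-≤ (q ℕ.^ j) (class-bound M i) ⟩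
          q ℕ.^ j ℕ.* (s i ℕ.* (12 ℕ.* (M ℕ.* M) ℕ.* q ℕ.^ i ℕ.+ 3 ℕ.* M ℕ.* p)) ≡⟨ eq₂ (q ℕ.^ j) (s i) M (q ℕ.^ i) p ⟩
          q ℕ.^ i ℕ.* (12 ℕ.* (M ℕ.* M) ℕ.* s i ℕ.* q ℕ.^ j) ℕ.+ 3 ℕ.* M ℕ.* p ℕ.* (s i ℕ.* q ℕ.^ j)
            ≤⟨ ℕ.+-mono-≤ (ℕ.*-monoʳ-≤ (q ℕ.^ i) (ℕ.*-monoˡ-≤ (q ℕ.^ j) (ℕ.*-monoʳ-≤ (12 ℕ.* (M ℕ.* M)) (length-C≤t i))))
                 (ℕ.*-monoʳ-≤ (3 ℕ.* M ℕ.* p) (best i i≤R)) ⟩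
          q ℕ.^ i ℕ.* (12 ℕ.* (M ℕ.* M) ℕ.* t ℕ.* q ℕ.^ j) ℕ.+ 3 ℕ.* M ℕ.* p ℕ.* (s j ℕ.* q ℕ.^ i) ≡⟨ eq₃ (q ℕ.^ i) _ (3 ℕ.* M ℕ.* p) (s j) ⟩
          q ℕ.^ i ℕ.* (12 ℕ.* (M ℕ.* M) ℕ.* t ℕ.* q ℕ.^ j ℕ.+ 3 ℕ.* M ℕ.* p ℕ.* s j) ∎)
          where
          eq₁ : ∀ a b c → a ℕ.* (b ℕ.* c) ≡ b ℕ.* (a ℕ.* c)
          eq₁ = ℕ.solve-∀
          eq₂ : ∀ x s M y p → x ℕ.* (s ℕ.* (12 ℕ.* (M ℕ.* M) ℕ.* y ℕ.+ 3 ℕ.* M ℕ.* p)) ≡ y ℕ.* (12 ℕ.* (M ℕ.* M) ℕ.* s ℕ.* x) ℕ.+ 3 ℕ.* M ℕ.* p ℕ.* (s ℕ.* x)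
          eq₂ = ℕ.solve-∀
          eq₃ : ∀ y a b s → y ℕ.* a ℕ.+ b ℕ.* (s ℕ.* y) ≡ y ℕ.* (a ℕ.+ b ℕ.* s)
          eq₃ = ℕ.solve-∀

    -- Products of two fractions of height < q^(j+1) have height < q^(2j+2), and by
    -- the divisor bound few pairs of fractions share a product.
    module _ (j : ℕ) (j≤R : j ℕ.≤ R) where

      M : ℕ
      M = q ℕ.^ j ℕ.* q ℕ.* (q ℕ.^ j ℕ.* q)

      M≤ : M ℕ.≤ q ℕ.^ suc R ℕ.* q ℕ.^ suc R
      M≤ = ℕ.*-mono-≤ h h
        where
        h : q ℕ.^ j ℕ.* q ℕ.≤ q ℕ.^ suc R
        h = ℕ.≤-trans (ℕ.≤-reflexive (ℕ.*-comm (q ℕ.^ j) q)) (ℕ.^-monoʳ-≤ q (s≤s j≤R))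

      -- The product point (x , y) still shows a fraction u / v for r₁ among the divisors of its
      -- coordinates. Recording this lets the divisor bound limit the repetitions.
      Divides : ℤ × ℤ → ℤ × ℤ → Set
      Divides (r₁ , _) (x , y) = Any (λ { (u , v) → v ≉ 0ℤ × u ≈ r₁ * v }) (cartesianProduct (divisorsℤ x) (divisorsℤ y))

      divides? : ∀ rr xy → Dec (Divides rr xy)
      divides? (r₁ , _) (x , y) = Any.any? (onLine*? r₁) (cartesianProduct (divisorsℤ x) (divisorsℤ y))

      Product : ℤ × ℤ → ℤ → Set
      Product (r₁ , r₂) r = r₁ * r₂ ≈ r

      product? : ∀ rr r → Dec (Product rr r)
      product? (r₁ , r₂) r = r₁ * r₂ ≈? r

      opaque
        Pairs : ℤ → List (ℤ × ℤ)
        Pairs r = filter (λ rr → product? rr r) (cartesianProduct (C j) (C j))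

        Pairs-unique : ∀ r → Unique (Pairs r)
        Pairs-unique r = filter⁺ (λ rr → product? rr r) (cartesianProduct⁺ (C-unique j) (C-unique j))

        ∈-Pairs⁻ : ∀ {r₁ r₂ r} → (r₁ , r₂) ∈ Pairs r → (r₁ ∈ C j × r₂ ∈ C j) × r₁ * r₂ ≈ r
        ∈-Pairs⁻ {r₁} {r₂} {r} i with ∈-filter⁻ (λ rr → product? rr r) {xs = cartesianProduct (C j) (C j)} i
        ... | i′ , h = ∈-cartesianProduct⁻ (C j) (C j) i′ , h

        s²≤∑Pairs : s j ℕ.* s j ℕ.≤ ∑ H (λ r → length (Pairs r))
        s²≤∑Pairs = begin
          s j ℕ.* s j ≡⟨ length-× (C j) (C j) ⟨
          length (cartesianProduct (C j) (C j)) ≤⟨ total-relation product? (cartesianProduct (C j) (C j)) H total ⟩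
          ∑ H (λ r → count (λ rr → product? rr r) (cartesianProduct (C j) (C j)))
            ≡⟨ ∑-cong H (λ {r} _ → length-filter≡count (λ rr → product? rr r) (cartesianProduct (C j) (C j))) ⟨
          ∑ H (λ r → length (Pairs r)) ∎
          where
          open ℕ.≤-Reasoning
          total : ∀ {rr} → rr ∈ cartesianProduct (C j) (C j) → ∃ λ r → r ∈ H × Product rr r
          total {r₁ , r₂} i with ∈-cartesianProduct⁻ (C j) (C j) i
          ... | i₁ , i₂ = H-closed (proj₁ (∈-C⁻ {j} i₁)) (proj₁ (∈-C⁻ {j} i₂))

      opaque
        -- A divisor u of x and a divisor v of y fix r₁ = u / v and then r₂ = r / r₁; each
        -- coordinate has at most `D` divisors, signs included.
        fibre-bound : ∀ {r} x y → ∣ x ∣ ℕ.≤ M → ∣ y ∣ ℕ.≤ M → x ≢ 0ℤ → y ≢ 0ℤ →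
          count (λ rr → divides? rr (x , y)) (Pairs r) ℕ.≤ D ℕ.* D
        fibre-bound {r} x y hx hy x≢0 y≢0 = begin
          count (λ rr → divides? rr (x , y)) (Pairs r) ≡⟨ length-filter≡count (λ rr → divides? rr (x , y)) (Pairs r) ⟨
          length (filter (λ rr → divides? rr (x , y)) (Pairs r))
            ≤⟨ left-unique-relation (λ { (r₁ , r₂) (u , v) → v ≉ 0ℤ × u ≈ r₁ * v }) (cartesianProduct (divisorsℤ x) (divisorsℤ y))
                 (filter⁺ (λ rr → divides? rr (x , y)) (Pairs-unique r)) total unique ⟩
          length (cartesianProduct (divisorsℤ x) (divisorsℤ y)) ≡⟨ length-× (divisorsℤ x) (divisorsℤ y) ⟩
          length (divisorsℤ x) ℕ.* length (divisorsℤ y) ≤⟨ ℕ.*-mono-≤ (few x hx x≢0) (few y hy y≢0) ⟩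
          D ℕ.* D ∎
          where
          open ℕ.≤-Reasoning
          few : ∀ x → ∣ x ∣ ℕ.≤ M → x ≢ 0ℤ → length (divisorsℤ x) ℕ.≤ D
          few x hx x≢0 = ℕ.≤-trans (ℕ.≤-reflexive (length-divisorsℤ x))
            (few-divisors ∣ x ∣ {{ℕ.≢-nonZero (λ e → x≢0 (∣i∣≡0⇒i≡0 e))}} (ℕ.≤-trans hx M≤))
          total : ∀ {rr} → rr ∈ filter (λ rr → divides? rr (x , y)) (Pairs r) →
            ∃ λ uv → uv ∈ cartesianProduct (divisorsℤ x) (divisorsℤ y) × (proj₂ uv ≉ 0ℤ × proj₁ uv ≈ proj₁ rr * proj₂ uv)
          total {r₁ , r₂} i with find (proj₂ (∈-filter⁻ (λ rr → divides? rr (x , y)) {xs = Pairs r} i))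
          ... | (u , v) , k , h = (u , v) , k , h
          unique : ∀ {rr rr′} uv → rr ∈ filter (λ rr → divides? rr (x , y)) (Pairs r) →
            rr′ ∈ filter (λ rr → divides? rr (x , y)) (Pairs r) →
            proj₂ uv ≉ 0ℤ × proj₁ uv ≈ proj₁ rr * proj₂ uv → proj₂ uv ≉ 0ℤ × proj₁ uv ≈ proj₁ rr′ * proj₂ uv → rr ≡ rr′
          unique {r₁ , r₂} {r₁′ , r₂′} (u , v) i i′ (v≉0 , h) (_ , h′)
            with ∈-Pairs⁻ {r₁} {r₂} (proj₁ (∈-filter⁻ (λ rr → divides? rr (x , y)) {xs = Pairs r} i))
               | ∈-Pairs⁻ {r₁′} {r₂′} (proj₁ (∈-filter⁻ (λ rr → divides? rr (x , y)) {xs = Pairs r} i′))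
          ... | (i₁ , i₂) , e | (i₁′ , i₂′) , e′ = cong₂ _,_ r₁≡ r₂≡
            where
            inH : ∀ {r} → r ∈ C j → r ∈ H
            inH k = proj₁ (∈-C⁻ {j} k)
            r₁≡ : r₁ ≡ r₁′
            r₁≡ = H-≈ (inH i₁) (inH i₁′) (≈-cancelʳ v {r₁} {r₁′} v≉0 (≈-trans (≈-sym h) h′))
            r₂≡ : r₂ ≡ r₂′
            r₂≡ = H-≈ (inH i₂) (inH i₂′) (≈-cancelˡ r₁ {r₂} {r₂′} (H≉0 (inH i₁))
                    (≈-trans e (≈-trans (≈-sym e′) (≈-reflexive (cong (_* r₂′) (sym r₁≡))))))

        pairs-bound : ∀ {r} → r ∈ H → length (Pairs r) ℕ.≤ q ℕ.* J M r
        pairs-bound {r} r∈H = begin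
          length (Pairs r) ≤⟨ total-relation divides? (Pairs r) (J-points M r) total ⟩
          ∑ (J-points M r) (λ xy → count (λ rr → divides? rr xy) (Pairs r)) ≤⟨ ∑-bound (J-points M r) (D ℕ.* D) fibre ⟩
          J M r ℕ.* (D ℕ.* D) ≤⟨ ℕ.*-monoʳ-≤ (J M r) D²≤q ⟩
          J M r ℕ.* q ≡⟨ ℕ.*-comm (J M r) q ⟩
          q ℕ.* J M r ∎
          where
          open ℕ.≤-Reasoning
          ≉⇒≢ : ∀ {z} → z ≉ 0ℤ → z ≢ 0ℤ
          ≉⇒≢ z≉0 e = z≉0 (≈-reflexive e)
          fibre : ∀ {xy} → xy ∈ J-points M r → count (λ rr → divides? rr xy) (Pairs r) ℕ.≤ D ℕ.* D
          fibre {x , y} k with ∈-J⁻ {x} {y} k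
          ... | (hx , hy) , y≉0 , x≈ry = fibre-bound x y hx hy
                  (≉⇒≢ (≉0-resp (≈-sym x≈ry) (*≉0 (H≉0 r∈H) y≉0))) (≉⇒≢ y≉0)
          rep : ∀ {r} → r ∈ C j → ∃₂ λ u v → (∣ u ∣ ℕ.≤ q ℕ.^ j ℕ.* q × ∣ v ∣ ℕ.≤ q ℕ.^ j ℕ.* q) × v ≉ 0ℤ × u ≈ r * v
          rep {r} i with nonempty (J-points (q ℕ.^ suc j ℕ.∸ 1) r) (proj₂ (proj₂ (∈-C⁻ {j} i)))
          ... | (u , v) , k with ∈-J⁻ {u} {v} k
          ...   | (hu , hv) , h = u , v , (weaken hu , weaken hv) , h
            where
            weaken : ∀ {a} → a ℕ.≤ q ℕ.^ suc j ℕ.∸ 1 → a ℕ.≤ q ℕ.^ j ℕ.* q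
            weaken h = ℕ.≤-trans h (ℕ.≤-trans (ℕ.m∸n≤m _ 1) (ℕ.≤-reflexive (ℕ.*-comm q (q ℕ.^ j))))
          total : ∀ {rr} → rr ∈ Pairs r → ∃ λ xy → xy ∈ J-points M r × Divides rr xy
          total {r₁ , r₂} i with ∈-Pairs⁻ {r₁} {r₂} i
          ... | (i₁ , i₂) , e with rep i₁ | rep i₂
          ...   | u₁ , v₁ , (hu₁ , hv₁) , v₁≉0 , e₁ | u₂ , v₂ , (hu₂ , hv₂) , v₂≉0 , e₂ =
            (u₁ * u₂ , v₁ * v₂) , ∈-J⁺ {u₁ * u₂} {v₁ * v₂} (abs≤ u₁ u₂ hu₁ hu₂) (abs≤ v₁ v₂ hv₁ hv₂) vv≉0 x≈ry ,
            lose (∈-cartesianProduct⁺ (∈-divisorsℤ u₁ u₂ refl (≉⇒≢ uu≉0)) (∈-divisorsℤ v₁ v₂ refl (≉⇒≢ vv≉0))) (v₁≉0 , e₁)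
            where
            abs≤ : ∀ a b → ∣ a ∣ ℕ.≤ q ℕ.^ j ℕ.* q → ∣ b ∣ ℕ.≤ q ℕ.^ j ℕ.* q → ∣ a * b ∣ ℕ.≤ M
            abs≤ a b ha hb = ℕ.≤-trans (ℕ.≤-reflexive (abs-* a b)) (ℕ.*-mono-≤ ha hb)
            vv≉0 : v₁ * v₂ ≉ 0ℤ
            vv≉0 = *≉0 v₁≉0 v₂≉0
            eqn : ∀ a b c d → a * b * (c * d) ≡ a * c * (b * d)
            eqn = solve-∀
            x≈ry : u₁ * u₂ ≈ r * (v₁ * v₂)
            x≈ry = u₁ * u₂ ≈⟨ ≈-* e₁ e₂ ⟩ r₁ * v₁ * (r₂ * v₂) ≡⟨ eqn r₁ v₁ r₂ v₂ ⟩≈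
                   r₁ * r₂ * (v₁ * v₂) ≈⟨ ≈-* e (≈-refl {v₁ * v₂}) ⟩ r * (v₁ * v₂) ≈∎
            uu≉0 : u₁ * u₂ ≉ 0ℤ
            uu≉0 = ≉0-resp (≈-sym x≈ry) (*≉0 (H≉0 r∈H) vv≉0)

        square-bound : s j ℕ.* s j ℕ.≤ q ℕ.* 𝒥 M
        square-bound = begin
          s j ℕ.* s j ≤⟨ s²≤∑Pairs ⟩
          ∑ H (λ r → length (Pairs r)) ≤⟨ ∑-mono H pairs-bound ⟩
          ∑ H (λ r → q ℕ.* J M r) ≡⟨ ∑-*ˡ H q (J M) ⟩
          q ℕ.* 𝒥 M ∎
          where open ℕ.≤-Reasoning

    opaque
      -- The factor 3 in t M ≤ 3 p leaves room for the radius M = 3 n, needed for sums of three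
      -- differences.
      energy-bound : 36 ℕ.* suc R ℕ.≤ q → ∀ M → t ℕ.* M ℕ.≤ 3 ℕ.* p →
        𝒥 M ℕ.≤ M ℕ.* q ℕ.^ 6 ⊎ p ℕ.* 𝒥 M ℕ.^ 4 ℕ.≤ q ℕ.^ 11 ℕ.* M ℕ.^ 4 ℕ.* t ℕ.^ 3
      energy-bound 36R≤q M tM≤ with ratio-max s (q ℕ.^_) R (λ i → ℕ.m^n>0 q i)
      ... | j , j≤R , best = energy-dichotomy {q} {suc R} {p} {t} 36R≤q {q ℕ.^ j} {s j} {{ℕ.m^n≢0 q j}}
        (ℕ.≤-trans (ℕ.≤-trans (ℕ.m≤m+n 32 4) (ℕ.m≤m*n 36 (suc R))) 36R≤q)
        (length-C≤t j)
        (linear-energy {q} {suc R} {p} {t} 36R≤q {q ℕ.^ j} {s j} tM≤ (total-bound j best M))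
        (square-energy {q} {suc R} {p} {t} 36R≤q {q ℕ.^ j} {s j} {{ℕ.m^n≢0 q j}}
          (square-bound j j≤R) (total-bound j best _))

-- Part of a coset of H inside a short interval.

module Interval (p : ℕ) (pr : Prime p) (d : ℕ) .{{d≢0 : NonZero d}} where

  open Counting
  open Box
  open ModP p pr
  open Group p pr d
  open Lattice p pr
  open Energy p pr d
  import Data.Nat.Properties as ℕ
  open import Data.Integer hiding (suc; pred)
  open import Data.Integer.Properties
  open import Data.Integer.Tactic.RingSolver using (solve-∀)

  record CosetInInterval (A : List ℤ) (n : ℕ) : Set where
    field
      unique : Unique A
      n<p : n ℕ.< p
      close : ∀ {x y} → x ∈ A → y ∈ A → ∣ x - y ∣ ℕ.≤ n
      unit : ∀ {x} → x ∈ A → x ≉ 0ℤ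
      coset : ∀ {x y} → x ∈ A → y ∈ A → x ^ d ≈ y ^ d

    A-≈ : ∀ {x y} → x ∈ A → y ∈ A → x ≈ y → x ≡ y
    A-≈ i j = small≈ (ℕ.≤-<-trans (close i j) n<p)

    A-ratio : ∀ {x y} → x ∈ A → y ∈ A → ∃ λ h → h ∈ H × x ≈ h * y
    A-ratio i j = ratio (unit j) (coset i j)

    InA : ℤ → Set
    InA z = Any (λ a → a ≈ z) A

    inA? : ∀ z → Dec (InA z)
    inA? z = Any.any? (λ a → a ≈? z) A

    InRatio : ℤ × ℤ → ℤ → Set
    InRatio (x , y) h = x ≈ h * y

    inRatio? : ∀ xy h → Dec (InRatio xy h)
    inRatio? (x , y) h = x ≈? h * y

    opaque
      -- Subtracting one fixed solution of x = h y turns the others into lattice points with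
      -- coordinates at most `n`, wherever the interval lies.
      ratio-pairs≤Λ : ∀ h → count (λ xy → inRatio? xy h) (cartesianProduct A A) ℕ.≤ Λ n h
      ratio-pairs≤Λ h with count (λ xy → inRatio? xy h) (cartesianProduct A A) ℕ.≟ 0
      ... | yes e = ℕ.≤-trans (ℕ.≤-reflexive e) z≤n
      ... | no ne with count-nonempty (λ xy → inRatio? xy h) (cartesianProduct A A) (ℕ.n≢0⇒n>0 ne)
      ...   | (x₀ , y₀) , i , h₀ with ∈-cartesianProduct⁻ A A i
      ...     | ix₀ , iy₀ = ℕ.≤-trans (ℕ.≤-reflexive (sym (length-filter≡count (λ xy → inRatio? xy h) (cartesianProduct A A))))
        (left-unique-relation R (Λ-points n h) (filter⁺ (λ xy → inRatio? xy h) (cartesianProduct⁺ unique unique)) total unique′)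
        where
        F : List (ℤ × ℤ)
        F = filter (λ xy → inRatio? xy h) (cartesianProduct A A)
        R : ℤ × ℤ → ℤ × ℤ → Set
        R (x , y) (X , Y) = x - x₀ ≡ X × y - y₀ ≡ Y
        eqn : ∀ x y x₀ y₀ h → (x - x₀) - h * (y - y₀) ≡ 1ℤ * (x - h * y) + -1ℤ * (x₀ - h * y₀)
        eqn = solve-∀
        total : ∀ {xy} → xy ∈ F → ∃ λ XY → XY ∈ Λ-points n h × R xy XY
        total {x , y} k with ∈-filter⁻ (λ xy → inRatio? xy h) {xs = cartesianProduct A A} k
        ... | k′ , hxy with ∈-cartesianProduct⁻ A A k′
        ...   | ix , iy = (x - x₀ , y - y₀) , ∈-Λ⁺ {x - x₀} {y - y₀} (close ix ix₀) (close iy iy₀)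
                  (lin₂ hxy h₀ 1ℤ -1ℤ (eqn x y x₀ y₀ h)) , refl , refl
        unique′ : ∀ {xy xy′} XY → xy ∈ F → xy′ ∈ F → R xy XY → R xy′ XY → xy ≡ xy′
        unique′ {x , y} {x′ , y′} (X , Y) _ _ (e , f) (e′ , f′) =
          cong₂ _,_ (minus-cancelʳ x₀ (trans e (sym e′))) (minus-cancelʳ y₀ (trans f (sym f′)))

    ∑Λ≤ : ∀ M → M ℕ.< p → ∑ H (Λ M) ℕ.≤ t ℕ.+ 𝒥 M
    ∑Λ≤ M M<p = ℕ.≤-trans (∑-mono H (λ {h} _ → Λ≤1+J h M<p))
      (ℕ.≤-reflexive (trans (∑-+ H (λ _ → 1) (J M)) (cong (ℕ._+ 𝒥 M) (∑-one H))))

    opaque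
      -- Every pair of elements has its ratio in `H`. The term t comes from the origin, counted once
      -- for each h.
      second-moment : length A ℕ.* length A ℕ.≤ t ℕ.+ 𝒥 n
      second-moment = begin
        length A ℕ.* length A ≡⟨ length-× A A ⟨
        length (cartesianProduct A A) ≤⟨ total-relation inRatio? (cartesianProduct A A) H total ⟩
        ∑ H (λ h → count (λ xy → inRatio? xy h) (cartesianProduct A A)) ≤⟨ ∑-mono H (λ {h} _ → ratio-pairs≤Λ h) ⟩
        ∑ H (Λ n) ≤⟨ ∑Λ≤ n n<p ⟩
        t ℕ.+ 𝒥 n ∎
        where
        open ℕ.≤-Reasoning
        total : ∀ {xy} → xy ∈ cartesianProduct A A → ∃ λ h → h ∈ H × InRatio xy h
        total {x , y} k with ∈-cartesianProduct⁻ A A k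
        ... | i , j = A-ratio i j

      length≤t : length A ℕ.≤ t
      length≤t with length A ℕ.≟ 0
      ... | yes e = ℕ.≤-trans (ℕ.≤-reflexive e) z≤n
      ... | no ne with nonempty A (ℕ.n≢0⇒n>0 ne)
      ...   | x₀ , i₀ = left-unique-relation (λ x h → x ≈ h * x₀) H unique
              (λ i → A-ratio i i₀) (λ h i j e f → A-≈ i j (≈-trans e (≈-sym f)))

      length≤1+2n : length A ℕ.≤ suc (n ℕ.+ n)
      length≤1+2n with length A ℕ.≟ 0
      ... | yes e = ℕ.≤-trans (ℕ.≤-reflexive e) z≤n
      ... | no ne with nonempty A (ℕ.n≢0⇒n>0 ne)
      ...   | x₀ , i₀ = ℕ.≤-trans (left-unique-relation (λ x z → x - x₀ ≡ z) (Box n) unique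
              (λ {x} i → x - x₀ , ∈-Box⁺ {x - x₀} (close i i₀) , refl)
              (λ _ _ _ e f → minus-cancelʳ x₀ (trans e (sym f)))) (ℕ.≤-reflexive (length-Box n))

-- The case t ≈ p^(1/3): popular dilations and a sum-product argument.

module Low (p : ℕ) (pr : Prime p) (d : ℕ) .{{d≢0 : NonZero d}} where

  open Counting
  open ModP p pr
  open Group p pr d
  open Lattice p pr
  open Energy p pr d
  open Interval p pr d
  import Data.Nat.Properties as ℕ
  open import Data.Integer hiding (suc; pred)
  open import Data.Integer.Properties
  open import Data.Integer.Tactic.RingSolver using (solve-∀)
  import Data.Nat.Tactic.RingSolver as ℕ

  Quad : Set
  Quad = (ℤ × ℤ) × (ℤ × ℤ)

  quads : List ℤ → List Quad
  quads G = cartesianProduct (cartesianProduct G G) (cartesianProduct G G)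

  length-quads : ∀ G → length (quads G) ≡ length G ℕ.* length G ℕ.* (length G ℕ.* length G)
  length-quads G = trans (length-× (cartesianProduct G G) (cartesianProduct G G)) (cong₂ ℕ._*_ (length-× G G) (length-× G G))

  ∈-quads⁺ : ∀ {G a b c e} → a ∈ G → b ∈ G → c ∈ G → e ∈ G → ((a , b) , (c , e)) ∈ quads G
  ∈-quads⁺ i j k l = ∈-cartesianProduct⁺ (∈-cartesianProduct⁺ i j) (∈-cartesianProduct⁺ k l)

  ∈-quads⁻ : ∀ {G a b c e} → ((a , b) , (c , e)) ∈ quads G → (a ∈ G × b ∈ G) × (c ∈ G × e ∈ G)
  ∈-quads⁻ {G} i with ∈-cartesianProduct⁻ (cartesianProduct G G) (cartesianProduct G G) i
  ... | j , k = ∈-cartesianProduct⁻ G G j , ∈-cartesianProduct⁻ G G k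

  -- (G - G) / (G - G)
  Quotient : List ℤ → ℤ → Set
  Quotient G ξ = Any (λ { ((a , b) , (c , e)) → c ≉ e × ξ * (c - e) ≈ a - b }) (quads G)

  quotient? : ∀ G ξ → Dec (Quotient G ξ)
  quotient? G ξ = Any.any? (λ { ((a , b) , (c , e)) → ¬? (c ≈? e) ×-dec (ξ * (c - e) ≈? a - b) }) (quads G)

  last-true : {Q : ℕ → Set} → (∀ i → Dec (Q i)) → Q 0 → ∀ k → ¬ Q k → ∃ λ i → Q i × ¬ Q (suc i)
  last-true Q? q0 zero ¬q = ⊥-elim (¬q q0)
  last-true Q? q0 (suc k) ¬q with Q? k
  ... | yes q = k , q , ¬q
  ... | no ¬qk = last-true Q? q0 k ¬qk

  -- That ζ is not a quotient will make x + ζ y injective; that ζ - 1 is one will keep its multiple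
  -- by g₃ - g₄ short.
  record Pivot (G : List ℤ) : Set where
    field
      g₁ g₂ g₃ g₄ ζ : ℤ
      g₁∈ : g₁ ∈ G
      g₂∈ : g₂ ∈ G
      g₃∈ : g₃ ∈ G
      g₄∈ : g₄ ∈ G
      g₃≉g₄ : g₃ ≉ g₄
      ζ-rep : (ζ - 1ℤ) * (g₃ - g₄) ≈ g₁ - g₂
      ζ-not-quotient : ¬ Quotient G ζ

  zero-quotient : ∀ {G} → Unique G → (∀ {g} → g ∈ G → g ∈ H) → 2 ℕ.≤ length G → Quotient G 0ℤ
  zero-quotient {_ ∷ []} _ _ (s≤s ())
  zero-quotient {a ∷ b ∷ G} ((a≢b ∷ _) ∷ _) G⊆H _ =
    lose (∈-quads⁺ {a ∷ b ∷ G} (here refl) (here refl) (here refl) (there (here refl)))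
      ((λ h → a≢b (H-≈ (G⊆H (here refl)) (G⊆H (there (here refl))) h)) , ≈-reflexive (sym (+-inverseʳ a)))

  opaque
    -- The quotient set has at most |G|⁴ < p elements, so it misses some residue. It contains 0, so
    -- repeatedly adding 1 must leave it at some step.
    pivot : ∀ G → Unique G → (∀ {g} → g ∈ G → g ∈ H) → 2 ℕ.≤ length G →
      length G ℕ.* length G ℕ.* (length G ℕ.* length G) ℕ.< p → Pivot G
    pivot G uniq G⊆H 2≤ small with count (quotient? G) Res ℕ.<? p
    ... | no ≮ = ⊥-elim (≮ (ℕ.≤-<-trans few small))
      where
      Rel : ℤ → Quad → Set
      Rel ξ ((a , b) , (c , e)) = c ≉ e × ξ * (c - e) ≈ a - b
      total : ∀ {ξ} → ξ ∈ filter (quotient? G) Res → ∃ λ g → g ∈ quads G × Rel ξ g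
      total {ξ} i with find (proj₂ (∈-filter⁻ (quotient? G) {xs = Res} i))
      ... | ((a , b) , (c , e)) , k , h = ((a , b) , (c , e)) , k , h
      unique : ∀ {ξ ξ′} g → ξ ∈ filter (quotient? G) Res → ξ′ ∈ filter (quotient? G) Res → Rel ξ g → Rel ξ′ g → ξ ≡ ξ′
      unique {ξ} {ξ′} ((a , b) , (c , e)) i i′ (c≉e , h) (_ , h′) =
        Res-≈ (proj₁ (∈-filter⁻ (quotient? G) {xs = Res} i)) (proj₁ (∈-filter⁻ (quotient? G) {xs = Res} i′))
          (≈-cancelʳ (c - e) {ξ} {ξ′} (λ z → c≉e (-≈0⇒≈ z)) (≈-trans h (≈-sym h′)))
      few : count (quotient? G) Res ℕ.≤ length G ℕ.* length G ℕ.* (length G ℕ.* length G)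
      few = ℕ.≤-trans (ℕ.≤-reflexive (sym (length-filter≡count (quotient? G) Res)))
        (ℕ.≤-trans (left-unique-relation Rel (quads G) (filter⁺ (quotient? G) Res-unique) total unique)
          (ℕ.≤-reflexive (length-quads G)))
    ... | yes lt = result (last-true (λ i → quotient? G (+ i)) (zero-quotient uniq G⊆H 2≤) (proj₁ missing) (proj₂ missing))
      where
      missing : ∃ λ i → ¬ Quotient G (+ i)
      missing with Any.any? (λ ξ → ¬? (quotient? G ξ)) Res
      ... | yes some with find some
      ...   | ξ , k , ¬q with ∈-Res⁻ k
      ...     | i , refl , _ = i , ¬q
      missing | no none = ⊥-elim (ℕ.<⇒≢ lt (trans (∑-cong Res (λ {ξ} k → 𝟙-yes (quotient? G ξ) (all k))) (trans (∑-one Res) length-Res)))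
        where
        all : ∀ {ξ} → ξ ∈ Res → Quotient G ξ
        all {ξ} k with quotient? G ξ
        ... | yes q = q
        ... | no ¬q = ⊥-elim (none (lose k ¬q))
      result : (∃ λ i → Quotient G (+ i) × ¬ Quotient G (+ suc i)) → Pivot G
      result (i , q , ¬q) with find q
      ... | ((a , b) , (c , e)) , k , (c≉e , h) with ∈-quads⁻ {G} k
      ...   | (ia , ib) , (ic , ie) = record
        { g₁ = a ; g₂ = b ; g₃ = c ; g₄ = e ; ζ = + suc i
        ; g₁∈ = ia ; g₂∈ = ib ; g₃∈ = ic ; g₄∈ = ie ; g₃≉g₄ = c≉e
        ; ζ-rep = subst (λ z → z * (c - e) ≈ a - b) (sym (eqn (+ i))) h
        ; ζ-not-quotient = ¬q }
        where
        eqn : ∀ z → (1ℤ + z) - 1ℤ ≡ z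
        eqn = solve-∀

  module _ {A : List ℤ} {n : ℕ} (hyp : CosetInInterval A n) where

    open CosetInInterval hyp

    T : ℕ
    T = length A

    degree : ℤ → ℕ
    degree g = count (λ x → inA? (g * x)) A

    opaque
      -- Every pair (y , x) of elements of `A` contributes to g = y / x.
      T²≤∑degree : T ℕ.* T ℕ.≤ ∑ H degree
      T²≤∑degree = begin
        T ℕ.* T ≤⟨ ∑-bound≥ A T each ⟩
        ∑ A (λ x → count (λ g → inA? (g * x)) H) ≡⟨ ∑-swap A H (λ x g → 𝟙 (inA? (g * x))) ⟩
        ∑ H degree ∎
        where
        open ℕ.≤-Reasoning
        each : ∀ {x} → x ∈ A → T ℕ.≤ count (λ g → inA? (g * x)) H
        each {x} i = ℕ.≤-trans (left-unique-relation (λ y g → y ≈ g * x) (filter (λ g → inA? (g * x)) H) unique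
            (λ {y} j → let (g , k , e) = A-ratio j i in g , ∈-filter⁺ (λ g → inA? (g * x)) k (lose j e) , e)
            (λ g j j′ e e′ → A-≈ j j′ (≈-trans e (≈-sym e′))))
          (ℕ.≤-reflexive (length-filter≡count (λ g → inA? (g * x)) H))

    Hits : Quad → ℤ → Set
    Hits ((a , b) , (c , e)) x = (InA (a * x) × InA (b * x)) × (InA (c * x) × InA (e * x))

    hits? : ∀ g x → Dec (Hits g x)
    hits? ((a , b) , (c , e)) x = (inA? (a * x) ×-dec inA? (b * x)) ×-dec (inA? (c * x) ×-dec inA? (e * x))

    degree₄ : Quad → ℕ
    degree₄ g = count (hits? g) A

    Popular : List ℤ → ℕ → Set
    Popular G θ = ∀ {a b c e} → a ∈ G → b ∈ G → c ∈ G → e ∈ G → θ ℕ.≤ degree₄ ((a , b) , (c , e))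

    -- Dependent random choice: G consists of the g that map all of a well chosen
    -- tuple of elements of A into A.
    module _ (e γ θ : ℕ)
      (big : t ℕ.^ e ℕ.* (T ℕ.^ suc e ℕ.* γ ℕ.+ t ℕ.* (t ℕ.* t ℕ.* (t ℕ.* t) ℕ.* θ ℕ.^ suc e)) ℕ.< (T ℕ.* T) ℕ.^ suc e) where

      tups : List (List ℤ)
      tups = tuples (suc e) A

      choice? : ∀ xs g → Dec (All (λ x → InA (g * x)) xs)
      choice? xs g = All.all? (λ x → inA? (g * x)) xs

      G : List ℤ → List ℤ
      G xs = filter (choice? xs) H

      Bad : List ℤ → Quad → Set
      Bad xs g = degree₄ g ℕ.< θ × All (Hits g) xs

      bad? : ∀ xs g → Dec (Bad xs g)
      bad? xs g = (degree₄ g ℕ.<? θ) ×-dec All.all? (hits? g) xs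

      bad : List ℤ → ℕ
      bad xs = count (bad? xs) (quads H)

      opaque
        -- The mean size of `G`: for a random tuple, g survives with probability (degree g /
        -- T)^(e+1), and convexity bounds the sum of these powers from below.
        ∑G : (T ℕ.* T) ℕ.^ suc e ℕ.≤ t ℕ.^ e ℕ.* ∑ tups (λ xs → length (G xs))
        ∑G = begin
          (T ℕ.* T) ℕ.^ suc e ≤⟨ ℕ.^-monoˡ-≤ (suc e) T²≤∑degree ⟩
          ∑ H degree ℕ.^ suc e ≤⟨ power-mean e H degree ⟩
          t ℕ.^ e ℕ.* ∑ H (λ g → degree g ℕ.^ suc e)
            ≡⟨ cong (t ℕ.^ e ℕ.*_) (∑-cong H (λ {g} _ → sym (count-tuples (λ x → inA? (g * x)) (suc e) A))) ⟩
          t ℕ.^ e ℕ.* ∑ H (λ g → ∑ tups (λ xs → 𝟙 (choice? xs g)))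
            ≡⟨ cong (t ℕ.^ e ℕ.*_) (∑-swap H tups (λ g xs → 𝟙 (choice? xs g))) ⟩
          t ℕ.^ e ℕ.* ∑ tups (λ xs → count (choice? xs) H)
            ≡⟨ cong (t ℕ.^ e ℕ.*_) (∑-cong tups (λ {xs} _ → sym (length-filter≡count (choice? xs) H))) ⟩
          t ℕ.^ e ℕ.* ∑ tups (λ xs → length (G xs)) ∎
          where open ℕ.≤-Reasoning

        -- A quadruple of small degree survives only if every entry of the tuple falls into a set of
        -- fewer than θ elements.
        ∑bad : ∑ tups bad ℕ.≤ t ℕ.* t ℕ.* (t ℕ.* t) ℕ.* θ ℕ.^ suc e
        ∑bad = begin
          ∑ tups bad ≡⟨ ∑-swap tups (quads H) (λ xs g → 𝟙 (bad? xs g)) ⟩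
          ∑ (quads H) (λ g → ∑ tups (λ xs → 𝟙 (bad? xs g))) ≤⟨ ∑-bound (quads H) (θ ℕ.^ suc e) (λ {g} _ → each g) ⟩
          length (quads H) ℕ.* θ ℕ.^ suc e ≡⟨ cong (ℕ._* θ ℕ.^ suc e) (length-quads H) ⟩
          t ℕ.* t ℕ.* (t ℕ.* t) ℕ.* θ ℕ.^ suc e ∎
          where
          open ℕ.≤-Reasoning
          each : ∀ g → ∑ tups (λ xs → 𝟙 (bad? xs g)) ℕ.≤ θ ℕ.^ suc e
          each g = begin
            ∑ tups (λ xs → 𝟙 (bad? xs g)) ≡⟨ ∑-cong tups (λ {xs} _ → 𝟙-× (degree₄ g ℕ.<? θ) (All.all? (hits? g) xs)) ⟩
            ∑ tups (λ xs → 𝟙 (degree₄ g ℕ.<? θ) ℕ.* 𝟙 (All.all? (hits? g) xs)) ≡⟨ ∑-*ˡ tups (𝟙 (degree₄ g ℕ.<? θ)) _ ⟩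
            𝟙 (degree₄ g ℕ.<? θ) ℕ.* count (All.all? (hits? g)) tups ≡⟨ cong (𝟙 (degree₄ g ℕ.<? θ) ℕ.*_) (count-tuples (hits? g) (suc e) A) ⟩
            𝟙 (degree₄ g ℕ.<? θ) ℕ.* degree₄ g ℕ.^ suc e ≤⟨ cut (degree₄ g ℕ.<? θ) ⟩
            θ ℕ.^ suc e ∎
            where
            cut : (dec : Dec (degree₄ g ℕ.< θ)) → 𝟙 dec ℕ.* degree₄ g ℕ.^ suc e ℕ.≤ θ ℕ.^ suc e
            cut (yes lt) = ℕ.≤-trans (ℕ.≤-reflexive (ℕ.*-identityˡ _)) (ℕ.^-monoˡ-≤ (suc e) (ℕ.<⇒≤ lt))
            cut (no _) = z≤n

      Good : List ℤ → Set
      Good xs = γ ℕ.≤ length (G xs) × bad xs ≡ 0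

      good? : ∀ xs → Dec (Good xs)
      good? xs = (γ ℕ.≤? length (G xs)) ×-dec (bad xs ℕ.≟ 0)

      opaque
        -- A tuple that leaves a bad quadruple is charged t ≥ |G|. If no tuple were good, |G| would
        -- be at most γ + t · bad throughout, and summing this contradicts `big`.
        good-tuple : ∃ Good
        good-tuple = search (Any.any? good? tups)
         where
         open ℕ.≤-Reasoning
         each : ∀ xs → ¬ Good xs → length (G xs) ℕ.≤ γ ℕ.+ t ℕ.* bad xs
         each xs ¬good = cases (γ ℕ.≤? length (G xs))
           where
           cases : Dec (γ ℕ.≤ length (G xs)) → length (G xs) ℕ.≤ γ ℕ.+ t ℕ.* bad xs
           cases (no γ≰) = ℕ.≤-trans (ℕ.<⇒≤ (ℕ.≰⇒> γ≰)) (ℕ.m≤m+n γ _)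
           cases (yes γ≤) = begin
             length (G xs) ≡⟨ length-filter≡count (choice? xs) H ⟩
             count (choice? xs) H ≤⟨ count≤length (choice? xs) H ⟩
             t ≤⟨ ℕ.m≤m*n t (bad xs) {{ℕ.≢-nonZero (λ z → ¬good (γ≤ , z))}} ⟩
             t ℕ.* bad xs ≤⟨ ℕ.m≤n+m _ γ ⟩
             γ ℕ.+ t ℕ.* bad xs ∎
         search : Dec (Any Good tups) → ∃ Good
         search (yes some) = let (xs , _ , h) = find some in xs , h
         search (no none) = ⊥-elim (ℕ.<⇒≱ big (begin
          (T ℕ.* T) ℕ.^ suc e ≤⟨ ∑G ⟩
          t ℕ.^ e ℕ.* ∑ tups (λ xs → length (G xs)) ≤⟨ ℕ.*-monoʳ-≤ (t ℕ.^ e) (∑-mono tups (λ {xs} i → each xs (λ h → none (lose i h)))) ⟩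
          t ℕ.^ e ℕ.* ∑ tups (λ xs → γ ℕ.+ t ℕ.* bad xs) ≡⟨ cong (t ℕ.^ e ℕ.*_) (∑-+ tups (λ _ → γ) (λ xs → t ℕ.* bad xs)) ⟩
          t ℕ.^ e ℕ.* (∑ tups (λ _ → γ) ℕ.+ ∑ tups (λ xs → t ℕ.* bad xs))
            ≡⟨ cong₂ (λ a b → t ℕ.^ e ℕ.* (a ℕ.+ b)) (trans (∑-const tups γ) (cong (ℕ._* γ) (length-tuples (suc e) A))) (∑-*ˡ tups t bad) ⟩
          t ℕ.^ e ℕ.* (T ℕ.^ suc e ℕ.* γ ℕ.+ t ℕ.* ∑ tups bad) ≤⟨ ℕ.*-monoʳ-≤ (t ℕ.^ e) (ℕ.+-monoʳ-≤ (T ℕ.^ suc e ℕ.* γ) (ℕ.*-monoʳ-≤ t ∑bad)) ⟩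
          t ℕ.^ e ℕ.* (T ℕ.^ suc e ℕ.* γ ℕ.+ t ℕ.* (t ℕ.* t ℕ.* (t ℕ.* t) ℕ.* θ ℕ.^ suc e)) ∎))

      opaque
        popular-set : ∃ λ G → Unique G × (∀ {g} → g ∈ G → g ∈ H) × length G ≡ γ × Popular G θ
        popular-set = build good-tuple
         where
         build : ∃ Good → ∃ λ G → Unique G × (∀ {g} → g ∈ G → g ∈ H) × length G ≡ γ × Popular G θ
         -- Truncated to exactly γ elements, as both a lower bound for |G| and |G|⁴ < p will be
         -- needed.
         build (xs , γ≤ , none) = take γ (G xs) , take⁺ γ (filter⁺ (choice? xs) H-unique) ,
          (λ i → proj₁ (∈G⁻ (take⊆ γ (G xs) i))) ,
          trans (length-take γ (G xs)) (ℕ.m≤n⇒m⊓n≡m γ≤) ,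
          (λ ia ib ic ie → ℕ.≮⇒≥ (λ lt → ℕ.<⇒≢ (count≥1 (bad? xs)
              (∈-quads⁺ {H} (inH ia) (inH ib) (inH ic) (inH ie))
              (lt , All.zipWith (λ { ((a , b) , (c , e)) → (a , b) , (c , e) })
                      (All.zip (inxs ia , inxs ib) , All.zip (inxs ic , inxs ie)))) (sym none)))
          where
          take⊆ : ∀ k (ys : List ℤ) {y} → y ∈ take k ys → y ∈ ys
          take⊆ (suc k) (y ∷ ys) (here refl) = here refl
          take⊆ (suc k) (y ∷ ys) (there i) = there (take⊆ k ys i)
          ∈G⁻ : ∀ {g} → g ∈ G xs → g ∈ H × All (λ x → InA (g * x)) xs
          ∈G⁻ = ∈-filter⁻ (choice? xs) {xs = H}
          inH : ∀ {g} → g ∈ take γ (G xs) → g ∈ H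
          inH i = proj₁ (∈G⁻ (take⊆ γ (G xs) i))
          inxs : ∀ {g} → g ∈ take γ (G xs) → All (λ x → InA (g * x)) xs
          inxs i = proj₂ (∈G⁻ (take⊆ γ (G xs) i))

    module _ {G : List ℤ} (G⊆H : ∀ {g} → g ∈ G → g ∈ H) (piv : Pivot G) {x₀ : ℤ} (x₀∈A : x₀ ∈ A) where

      open Pivot piv

      gs : Quad
      gs = (g₁ , g₂) , (g₃ , g₄)

      α : ℤ
      α = g₃ - g₄

      α≉0 : α ≉ 0ℤ
      α≉0 z = g₃≉g₄ (-≈0⇒≈ z)

      opaque
        A′ : List ℤ
        A′ = filter (hits? gs) A

        A′-unique : Unique A′
        A′-unique = filter⁺ (hits? gs) unique

        length-A′ : length A′ ≡ degree₄ gs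
        length-A′ = length-filter≡count (hits? gs) A

        ∈A′⁻ : ∀ {x} → x ∈ A′ → x ∈ A × Hits gs x
        ∈A′⁻ = ∈-filter⁻ (hits? gs) {xs = A}

      opaque
        small-difference : ∀ {g g′ x} → InA (g * x) → InA (g′ * x) → ∃ λ z → ∣ z ∣ ℕ.≤ n × z ≈ (g - g′) * x
        small-difference {g} {g′} {x} h h′ with find h | find h′
        ... | a , i , e | a′ , i′ , e′ = a - a′ , close i i′ , lin₂ e e′ 1ℤ -1ℤ (eqn a a′ g g′ x)
          where
          eqn : ∀ a a′ g g′ x → (a - a′) - (g - g′) * x ≡ 1ℤ * (a - g * x) + -1ℤ * (a′ - g′ * x)
          eqn = solve-∀

      opaque
        -- Since (ζ - 1) α = g₁ - g₂, the product equals α x + α y + (g₁ - g₂) y, and each summand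
        -- is congruent to a difference of two elements of `A`.
        small-sum : ∀ {x y} → x ∈ A′ → y ∈ A′ → ∃ λ z → ∣ z ∣ ℕ.≤ 3 ℕ.* n × z ≈ α * (x + ζ * y)
        small-sum {x} {y} i j with proj₂ (∈A′⁻ i) | proj₂ (∈A′⁻ j)
        ... | _ , (h₃ , h₄) | (k₁ , k₂) , (k₃ , k₄)
          with small-difference {g₃} {g₄} h₃ h₄ | small-difference {g₃} {g₄} k₃ k₄ | small-difference {g₁} {g₂} k₁ k₂
        ...   | u , hu , eu | v , hv , ev | w , hw , ew = u + (v + w) , bound , sum≈
          where
          open ℕ.≤-Reasoning
          bound : ∣ u + (v + w) ∣ ℕ.≤ 3 ℕ.* n
          bound = begin
            ∣ u + (v + w) ∣ ≤⟨ ∣i+j∣≤∣i∣+∣j∣ u (v + w) ⟩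
            ∣ u ∣ ℕ.+ ∣ v + w ∣ ≤⟨ ℕ.+-mono-≤ hu (ℕ.≤-trans (∣i+j∣≤∣i∣+∣j∣ v w) (ℕ.+-mono-≤ hv hw)) ⟩
            n ℕ.+ (n ℕ.+ n) ≡⟨ cong (λ k → n ℕ.+ (n ℕ.+ k)) (ℕ.+-identityʳ n) ⟨
            3 ℕ.* n ∎
          eqn₁ : ∀ α x y g → α * x + (α * y + g * y) ≡ α * x + (α + g) * y
          eqn₁ = solve-∀
          eqn₂ : ∀ α x y ζ → α * x + (α + (ζ - 1ℤ) * α) * y ≡ α * (x + ζ * y)
          eqn₂ = solve-∀
          sum≈ : u + (v + w) ≈ α * (x + ζ * y)
          sum≈ = u + (v + w) ≈⟨ ≈-+ eu (≈-+ ev ew) ⟩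
                 α * x + (α * y + (g₁ - g₂) * y) ≡⟨ eqn₁ α x y (g₁ - g₂) ⟩≈
                 α * x + (α + (g₁ - g₂)) * y ≈⟨ ≈-+ (≈-refl {α * x}) (≈-* (≈-+ (≈-refl {α}) (≈-sym ζ-rep)) (≈-refl {y})) ⟩
                 α * x + (α + (ζ - 1ℤ) * α) * y ≡⟨ eqn₂ α x y ζ ⟩≈
                 α * (x + ζ * y) ≈∎

      -- The base point x₀ carries `G`, a subset of `H`, into the coset that contains `A`.
      InTranslate : ℤ → ℤ → Set
      InTranslate h x = Any (λ g → x ≈ h * (x₀ * g)) G

      inTranslate? : ∀ h x → Dec (InTranslate h x)
      inTranslate? h x = Any.any? (λ g → x ≈? h * (x₀ * g)) G

      opaque
        -- On pairs from A′ ∩ h x₀ G the form x + ζ y is injective, because ζ ∉ (G - G) / (G - G).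
        injective : ∀ {h x y x′ y′} → h ∈ H → x ∈ A → x′ ∈ A → y ∈ A → y′ ∈ A →
          InTranslate h x → InTranslate h y → InTranslate h x′ → InTranslate h y′ →
          α * (x + ζ * y) ≈ α * (x′ + ζ * y′) → x ≡ x′ × y ≡ y′
        injective {h} {x} {y} {x′} {y′} h∈H ix ix′ iy iy′ tx ty tx′ ty′ e
          with find tx | find ty | find tx′ | find ty′
        ... | a , ia , ea | b , ib , eb | a′ , ia′ , ea′ | b′ , ib′ , eb′ = A-≈ ix ix′ x≈x′ , A-≈ iy iy′ y≈y′
          where
          e₁ : x + ζ * y ≈ x′ + ζ * y′
          e₁ = ≈-cancelˡ α {x + ζ * y} {x′ + ζ * y′} α≉0 e
          c : ℤ
          c = h * x₀
          c≉0 : c ≉ 0ℤ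
          c≉0 = *≉0 (H≉0 h∈H) (unit x₀∈A)
          c* : ∀ {x g} → x ≈ h * (x₀ * g) → c * g ≈ x
          c* {x} {g} f = c * g ≡⟨ *-assoc h x₀ g ⟩≈ h * (x₀ * g) ≈⟨ ≈-sym f ⟩ x ≈∎
          quotient-eq : ζ * (b′ - b) ≈ a - a′
          quotient-eq = ≈-cancelˡ c {ζ * (b′ - b)} {a - a′} c≉0 (
            c * (ζ * (b′ - b)) ≡⟨ eqn₁ c ζ b b′ ⟩≈
            ζ * (c * b′ - c * b) ≈⟨ ≈-* (≈-refl {ζ}) (≈-- (c* {y′} {b′} eb′) (c* {y} {b} eb)) ⟩
            ζ * (y′ - y) ≈⟨ lin₁ e₁ -1ℤ (eqn₂ x y x′ y′ ζ) ⟩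
            x - x′ ≈⟨ ≈-sym (≈-- (c* {x} {a} ea) (c* {x′} {a′} ea′)) ⟩
            c * a - c * a′ ≡⟨ eqn₃ c a a′ ⟩≈
            c * (a - a′) ≈∎)
            where
            eqn₁ : ∀ c ζ b b′ → c * (ζ * (b′ - b)) ≡ ζ * (c * b′ - c * b)
            eqn₁ = solve-∀
            eqn₂ : ∀ x y x′ y′ ζ → ζ * (y′ - y) - (x - x′) ≡ -1ℤ * ((x + ζ * y) - (x′ + ζ * y′))
            eqn₂ = solve-∀
            eqn₃ : ∀ c a a′ → c * a - c * a′ ≡ c * (a - a′)
            eqn₃ = solve-∀
          b′≈b : b′ ≈ b
          b′≈b with b′ ≈? b
          ... | yes z = z
          ... | no b′≉b = ⊥-elim (ζ-not-quotient (lose (∈-quads⁺ {G} ia ia′ ib′ ib) (b′≉b , quotient-eq)))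
          y≈y′ : y ≈ y′
          y≈y′ = y ≈⟨ ≈-sym (c* {y} {b} eb) ⟩ c * b ≈⟨ ≈-* (≈-refl {c}) (≈-sym b′≈b) ⟩ c * b′ ≈⟨ c* {y′} {b′} eb′ ⟩ y′ ≈∎
          x≈x′ : x ≈ x′
          x≈x′ = lin₂ e₁ y≈y′ 1ℤ (- ζ) (eqn x y x′ y′ ζ)
            where
            eqn : ∀ x y x′ y′ ζ → x - x′ ≡ 1ℤ * ((x + ζ * y) - (x′ + ζ * y′)) + - ζ * (y - y′)
            eqn = solve-∀

      opaque
        A″ : ℤ → List ℤ
        A″ h = filter (inTranslate? h) A′

        A″-unique : ∀ h → Unique (A″ h)
        A″-unique h = filter⁺ (inTranslate? h) A′-unique

        ∈A″⁻ : ∀ {h x} → x ∈ A″ h → x ∈ A′ × InTranslate h x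
        ∈A″⁻ {h} = ∈-filter⁻ (inTranslate? h) {xs = A′}

        ∈A″⁺ : ∀ {h x} → x ∈ A′ → InTranslate h x → x ∈ A″ h
        ∈A″⁺ {h} = ∈-filter⁺ (inTranslate? h)

      opaque
        -- Each pair (x , g) of A′ × G has x = h x₀ g for some h in `H`, so the best of the t
        -- translates meets A′ in at least |A′| |G| / t elements.
        some-translate : Unique G → 1 ℕ.≤ t → ∃ λ h → h ∈ H × length A′ ℕ.* length G ℕ.≤ t ℕ.* length (A″ h)
        some-translate G-unique 1≤t = conclude (average H (λ h → length (A″ h)) 1≤t)
          where
          open ℕ.≤-Reasoning
          Rel : ℤ × ℤ → ℤ → Set
          Rel (x , g) h = x ≈ h * (x₀ * g)
          rel? : ∀ xg h → Dec (Rel xg h)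
          rel? (x , g) h = x ≈? h * (x₀ * g)
          total : ∀ {xg} → xg ∈ cartesianProduct A′ G → ∃ λ h → h ∈ H × Rel xg h
          total {x , g} k with ∈-cartesianProduct⁻ A′ G k
          ... | ix , ig = ratio (*≉0 (unit x₀∈A) (H≉0 (G⊆H ig)))
            (x ^ d ≈⟨ coset (proj₁ (∈A′⁻ ix)) x₀∈A ⟩ x₀ ^ d ≈⟨ ≈-sym (H-coset (G⊆H ig) x₀) ⟩
             (g * x₀) ^ d ≡⟨ cong (_^ d) (*-comm g x₀) ⟩≈ (x₀ * g) ^ d ≈∎)
          fibre : ∀ {h} → h ∈ H → count (λ xg → rel? xg h) (cartesianProduct A′ G) ℕ.≤ length (A″ h)
          fibre {h} h∈H = ℕ.≤-trans (ℕ.≤-reflexive (sym (length-filter≡count (λ xg → rel? xg h) (cartesianProduct A′ G))))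
            (left-unique-relation (λ xg x → proj₁ xg ≡ x) (A″ h)
              (filter⁺ (λ xg → rel? xg h) (cartesianProduct⁺ A′-unique G-unique)) tot uni)
            where
            F : List (ℤ × ℤ)
            F = filter (λ xg → rel? xg h) (cartesianProduct A′ G)
            ∈F⁻ : ∀ {xg} → xg ∈ F → (proj₁ xg ∈ A′ × proj₂ xg ∈ G) × Rel xg h
            ∈F⁻ {x , g} k with ∈-filter⁻ (λ xg → rel? xg h) {xs = cartesianProduct A′ G} k
            ... | k′ , r = ∈-cartesianProduct⁻ A′ G k′ , r
            tot : ∀ {xg} → xg ∈ F → ∃ λ x → x ∈ A″ h × proj₁ xg ≡ x
            tot {x , g} k with ∈F⁻ k
            ... | (ix , ig) , r = x , ∈A″⁺ ix (lose ig r) , refl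
            uni : ∀ {xg xg′} x → xg ∈ F → xg′ ∈ F → proj₁ xg ≡ x → proj₁ xg′ ≡ x → xg ≡ xg′
            uni {x , g} {.x , g′} .x k k′ refl refl with ∈F⁻ k | ∈F⁻ k′
            ... | (_ , ig) , r | (_ , ig′) , r′ = cong (x ,_) (H-≈ (G⊆H ig) (G⊆H ig′)
                    (≈-cancelˡ x₀ {g} {g′} (unit x₀∈A) (≈-cancelˡ h {x₀ * g} {x₀ * g′} (H≉0 h∈H) (≈-trans (≈-sym r) r′))))
          conclude : (∃ λ h → h ∈ H × ∑ H (λ h → length (A″ h)) ℕ.≤ t ℕ.* length (A″ h)) →
            ∃ λ h → h ∈ H × length A′ ℕ.* length G ℕ.≤ t ℕ.* length (A″ h)
          conclude (h , i , av) = h , i , (begin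
            length A′ ℕ.* length G ≡⟨ length-× A′ G ⟨
            length (cartesianProduct A′ G) ≤⟨ total-relation rel? (cartesianProduct A′ G) H total ⟩
            ∑ H (λ h → count (λ xg → rel? xg h) (cartesianProduct A′ G)) ≤⟨ ∑-mono H fibre ⟩
            ∑ H (λ h → length (A″ h)) ≤⟨ av ⟩
            t ℕ.* length (A″ h) ∎)

      module _ {h : ℤ} (h∈H : h ∈ H) (3n<p : 3 ℕ.* n ℕ.< p) where

        MovedTo : ℤ → ℤ → Set
        MovedTo k x = Any (λ x′ → x′ ≈ k * x) A′

        movedTo? : ∀ k x → Dec (MovedTo k x)
        movedTo? k x = Any.any? (λ x′ → x′ ≈? k * x) A′

        opaque
          Q : ℤ → List ℤ
          Q k = filter (movedTo? k) (A″ h)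

          Q-unique : ∀ k → Unique (Q k)
          Q-unique k = filter⁺ (movedTo? k) (A″-unique h)

          ∈Q⁻ : ∀ {k x} → x ∈ Q k → x ∈ A″ h × MovedTo k x
          ∈Q⁻ {k} = ∈-filter⁻ (movedTo? k) {xs = A″ h}

          length-Q : ∀ k → length (Q k) ≡ count (movedTo? k) (A″ h)
          length-Q k = length-filter≡count (movedTo? k) (A″ h)

        opaque
          -- For x and y in `Q k`, both α (x + ζ y) and its multiple by k have representatives of
          -- size at most 3 n. They form a lattice point whose second coordinate determines (x , y).
          Q²≤Λ : ∀ k → length (Q k) ℕ.* length (Q k) ℕ.≤ Λ (3 ℕ.* n) k
          Q²≤Λ k = ℕ.≤-trans (ℕ.≤-reflexive (sym (length-× (Q k) (Q k))))
            (left-unique-relation Rel (Λ-points (3 ℕ.* n) k) (cartesianProduct⁺ (Q-unique k) (Q-unique k)) total uni)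
            where
            Rel : ℤ × ℤ → ℤ × ℤ → Set
            Rel (x , y) (_ , Y) = Y ≈ α * (x + ζ * y)
            split : ∀ {x} → x ∈ Q k → (x ∈ A′ × InTranslate h x) × MovedTo k x
            split i = ∈A″⁻ (proj₁ (∈Q⁻ i)) , proj₂ (∈Q⁻ i)
            total : ∀ {xy} → xy ∈ cartesianProduct (Q k) (Q k) → ∃ λ XY → XY ∈ Λ-points (3 ℕ.* n) k × Rel xy XY
            total {x , y} i =
              let (ix , iy) = ∈-cartesianProduct⁻ (Q k) (Q k) i
                  ((jx , _) , mx) = split ix
                  ((jy , _) , my) = split iy
                  (x′ , jx′ , ex) = find mx
                  (y′ , jy′ , ey) = find my
                  (Y , hY , eY) = small-sum jx jy
                  (X , hX , eX) = small-sum jx′ jy′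
              in (X , Y) , ∈-Λ⁺ {X} {Y} hX hY
                   (X ≈⟨ eX ⟩ α * (x′ + ζ * y′) ≈⟨ ≈-* (≈-refl {α}) (≈-+ ex (≈-* (≈-refl {ζ}) ey)) ⟩
                    α * (k * x + ζ * (k * y)) ≡⟨ eqn α k x y ζ ⟩≈ k * (α * (x + ζ * y)) ≈⟨ ≈-* (≈-refl {k}) (≈-sym eY) ⟩ k * Y ≈∎) , eY
              where
              eqn : ∀ α k x y ζ → α * (k * x + ζ * (k * y)) ≡ k * (α * (x + ζ * y))
              eqn = solve-∀
            uni : ∀ {xy xy′} XY → xy ∈ cartesianProduct (Q k) (Q k) → xy′ ∈ cartesianProduct (Q k) (Q k) →
              Rel xy XY → Rel xy′ XY → xy ≡ xy′
            uni {x , y} {x′ , y′} (X , Y) i i′ e e′ =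
              let (ix , iy) = ∈-cartesianProduct⁻ (Q k) (Q k) i
                  (ix′ , iy′) = ∈-cartesianProduct⁻ (Q k) (Q k) i′
                  ((jx , tx) , _) = split ix
                  ((jy , ty) , _) = split iy
                  ((jx′ , tx′) , _) = split ix′
                  ((jy′ , ty′) , _) = split iy′
                  (x≡ , y≡) = injective h∈H (proj₁ (∈A′⁻ jx)) (proj₁ (∈A′⁻ jx′)) (proj₁ (∈A′⁻ jy)) (proj₁ (∈A′⁻ jy′))
                    tx ty tx′ ty′ (≈-trans (≈-sym e) e′)
              in cong₂ _,_ x≡ y≡

        opaque
          -- A pair (x , y) of A″ × A′ is counted at k = y / x.
          ∑Q : length (A″ h) ℕ.* length A′ ℕ.≤ ∑ H (λ k → length (Q k))
          ∑Q = begin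
            length (A″ h) ℕ.* length A′ ≤⟨ ∑-bound≥ (A″ h) (length A′) each ⟩
            ∑ (A″ h) (λ x → count (λ k → movedTo? k x) H) ≡⟨ ∑-swap (A″ h) H (λ x k → 𝟙 (movedTo? k x)) ⟩
            ∑ H (λ k → count (movedTo? k) (A″ h)) ≡⟨ ∑-cong H (λ {k} _ → length-Q k) ⟨
            ∑ H (λ k → length (Q k)) ∎
            where
            open ℕ.≤-Reasoning
            each : ∀ {x} → x ∈ A″ h → length A′ ℕ.≤ count (λ k → movedTo? k x) H
            each {x} i = ℕ.≤-trans (left-unique-relation (λ y k → y ≈ k * x) (filter (λ k → movedTo? k x) H) A′-unique
                (λ {y} j → let (k , l , e) = A-ratio (proj₁ (∈A′⁻ j)) (proj₁ (∈A′⁻ (proj₁ (∈A″⁻ i))))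
                           in k , ∈-filter⁺ (λ k → movedTo? k x) l (lose j e) , e)
                (λ k j j′ e e′ → A-≈ (proj₁ (∈A′⁻ j)) (proj₁ (∈A′⁻ j′)) (≈-trans e (≈-sym e′))))
              (ℕ.≤-reflexive (length-filter≡count (λ k → movedTo? k x) H))

        opaque
          translate-bound : (let a = length (A″ h) ℕ.* length A′) → a ℕ.* a ℕ.≤ t ℕ.* (t ℕ.+ 𝒥 (3 ℕ.* n))
          translate-bound = begin
            length (A″ h) ℕ.* length A′ ℕ.* (length (A″ h) ℕ.* length A′) ≤⟨ ℕ.*-mono-≤ ∑Q ∑Q ⟩
            ∑ H (λ k → length (Q k)) ℕ.* ∑ H (λ k → length (Q k)) ≤⟨ cauchy-schwarz H (λ k → length (Q k)) ⟩
            t ℕ.* ∑ H (λ k → length (Q k) ℕ.* length (Q k)) ≤⟨ ℕ.*-monoʳ-≤ t (∑-mono H (λ {k} _ → Q²≤Λ k)) ⟩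
            t ℕ.* ∑ H (Λ (3 ℕ.* n)) ≤⟨ ℕ.*-monoʳ-≤ t (∑Λ≤ (3 ℕ.* n) 3n<p) ⟩
            t ℕ.* (t ℕ.+ 𝒥 (3 ℕ.* n)) ∎
            where open ℕ.≤-Reasoning

    opaque
      -- From |A′| ≥ θ and |A″| ≥ |A′| |G| / t it follows that |A″| |A′| ≥ θ² |G| / t, which
      -- `translate-bound` limits. The result is contradictory when t ≈ p^(1/3), θ is close to that
      -- and |G| ≈ p^(1/4).
      pivot-bound : ∀ {G θ} → Unique G → (∀ {g} → g ∈ G → g ∈ H) → Popular G θ → 2 ℕ.≤ length G →
        length G ℕ.* length G ℕ.* (length G ℕ.* length G) ℕ.< p → 1 ℕ.≤ T → 3 ℕ.* n ℕ.< p →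
        (let a = θ ℕ.* θ ℕ.* length G) → a ℕ.* a ℕ.≤ t ℕ.* t ℕ.* (t ℕ.* (t ℕ.+ 𝒥 (3 ℕ.* n)))
      pivot-bound {G} {θ} G-unique G⊆H pop 2≤ small 1≤T 3n<p with nonempty A 1≤T
      ... | x₀ , x₀∈A = conclude (some-translate G⊆H piv x₀∈A G-unique (ℕ.≤-trans 1≤T length≤t))
        where
        open ℕ.≤-Reasoning
        piv : Pivot G
        piv = pivot G G-unique G⊆H 2≤ small
        open Pivot piv
        B′ : List ℤ
        B′ = A′ G⊆H piv x₀∈A
        B″ : ℤ → List ℤ
        B″ = A″ G⊆H piv x₀∈A
        θ≤ : θ ℕ.≤ length B′
        θ≤ = ℕ.≤-trans (pop g₁∈ g₂∈ g₃∈ g₄∈) (ℕ.≤-reflexive (sym (length-A′ G⊆H piv x₀∈A)))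
        conclude : (∃ λ h → h ∈ H × length B′ ℕ.* length G ℕ.≤ t ℕ.* length (B″ h)) →
          θ ℕ.* θ ℕ.* length G ℕ.* (θ ℕ.* θ ℕ.* length G) ℕ.≤ t ℕ.* t ℕ.* (t ℕ.* (t ℕ.+ 𝒥 (3 ℕ.* n)))
        conclude (h , h∈H , le) = begin
          θ ℕ.* θ ℕ.* length G ℕ.* (θ ℕ.* θ ℕ.* length G) ≤⟨ ℕ.*-mono-≤ step step ⟩
          t ℕ.* a ℕ.* (t ℕ.* a) ≡⟨ eqn t a ⟩
          t ℕ.* t ℕ.* (a ℕ.* a) ≤⟨ ℕ.*-monoʳ-≤ (t ℕ.* t) (translate-bound G⊆H piv x₀∈A h∈H 3n<p) ⟩
          t ℕ.* t ℕ.* (t ℕ.* (t ℕ.+ 𝒥 (3 ℕ.* n))) ∎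
          where
          a : ℕ
          a = length (B″ h) ℕ.* length B′
          eqn : ∀ t a → t ℕ.* a ℕ.* (t ℕ.* a) ≡ t ℕ.* t ℕ.* (a ℕ.* a)
          eqn = ℕ.solve-∀
          eqn′ : ∀ x y z → x ℕ.* (y ℕ.* z) ≡ y ℕ.* (z ℕ.* x)
          eqn′ = ℕ.solve-∀
          step : θ ℕ.* θ ℕ.* length G ℕ.≤ t ℕ.* a
          step = begin
            θ ℕ.* θ ℕ.* length G ≤⟨ ℕ.*-monoˡ-≤ (length G) (ℕ.*-mono-≤ θ≤ θ≤) ⟩
            length B′ ℕ.* length B′ ℕ.* length G ≡⟨ ℕ.*-assoc (length B′) (length B′) (length G) ⟩
            length B′ ℕ.* (length B′ ℕ.* length G) ≤⟨ ℕ.*-monoʳ-≤ (length B′) le ⟩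
            length B′ ℕ.* (t ℕ.* length (B″ h)) ≡⟨ eqn′ (length B′) t (length (B″ h)) ⟩
            t ℕ.* a ∎

-- Variance of incidences between H × H and lines.

module Lines (p : ℕ) (pr : Prime p) (d : ℕ) .{{d≢0 : NonZero d}} where

  open Counting
  open ModP p pr
  open Group p pr d
  import Data.Nat.Properties as ℕ
  open import Data.Integer hiding (suc; pred)
  open import Data.Integer.Properties
  open import Data.Integer.Tactic.RingSolver using (solve-∀)
  import Data.Nat.Tactic.RingSolver as ℕ

  ∣x-y∣²-ordered : ∀ x y → x ℕ.≤ y → ℕ.∣ x - y ∣ ℕ.* ℕ.∣ x - y ∣ ℕ.+ 2 ℕ.* (x ℕ.* y) ≡ x ℕ.* x ℕ.+ y ℕ.* y
  ∣x-y∣²-ordered x y x≤y = trans (cong (λ e → e ℕ.* e ℕ.+ 2 ℕ.* (x ℕ.* y)) (ℕ.m≤n⇒∣m-n∣≡n∸m x≤y))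
    (subst (λ z → e ℕ.* e ℕ.+ 2 ℕ.* (x ℕ.* z) ≡ x ℕ.* x ℕ.+ z ℕ.* z) (ℕ.m+[n∸m]≡n x≤y) (eqn x e))
    where
    e : ℕ
    e = y ℕ.∸ x
    eqn : ∀ x e → e ℕ.* e ℕ.+ 2 ℕ.* (x ℕ.* (x ℕ.+ e)) ≡ x ℕ.* x ℕ.+ (x ℕ.+ e) ℕ.* (x ℕ.+ e)
    eqn = ℕ.solve-∀

  ∣x-y∣² : ∀ x y → ℕ.∣ x - y ∣ ℕ.* ℕ.∣ x - y ∣ ℕ.+ 2 ℕ.* (x ℕ.* y) ≡ x ℕ.* x ℕ.+ y ℕ.* y
  ∣x-y∣² x y with ℕ.≤-total x y
  ... | inj₁ x≤y = ∣x-y∣²-ordered x y x≤y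
  ... | inj₂ y≤x = trans (cong₂ (λ e m → e ℕ.* e ℕ.+ 2 ℕ.* m) (ℕ.∣-∣-comm x y) (ℕ.*-comm x y))
    (trans (∣x-y∣²-ordered y x y≤x) (ℕ.+-comm (y ℕ.* y) (x ℕ.* x)))

  module _ {w : ℤ} (w≉0 : w ≉ 0ℤ) where

    HH RR : List (ℤ × ℤ)
    HH = cartesianProduct H H
    RR = cartesianProduct Res Res

    -- Lines that miss the origin, written with the common right-hand side `w`, so that a line is
    -- its pair of coefficients.
    Incident : ℤ × ℤ → ℤ × ℤ → Set
    Incident (a , b) (h , k) = a * h + b * k ≈ w

    incident? : ∀ l pt → Dec (Incident l pt)
    incident? (a , b) (h , k) = a * h + b * k ≈? w

    N : ℤ × ℤ → ℕ
    N l = count (incident? l) HH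

    length-HH : length HH ≡ t ℕ.* t
    length-HH = length-× H H

    opaque
      -- As k is invertible, each a is completed by some b to a line through (h , k).
      ∑N≥ : t ℕ.* t ℕ.* p ℕ.≤ ∑ RR N
      ∑N≥ = begin
        t ℕ.* t ℕ.* p ≡⟨ cong (ℕ._* p) length-HH ⟨
        length HH ℕ.* p ≤⟨ ∑-bound≥ HH p each ⟩
        ∑ HH (λ pt → count (λ l → incident? l pt) RR) ≡⟨ ∑-swap RR HH (λ l pt → 𝟙 (incident? l pt)) ⟨
        ∑ RR N ∎
        where
        open ℕ.≤-Reasoning
        each : ∀ {pt} → pt ∈ HH → p ℕ.≤ count (λ l → incident? l pt) RR
        each {h , k} i = begin
          p ≡⟨ length-Res ⟨
          length Res ≤⟨ left-unique-relation (λ a l → proj₁ l ≡ a) (filter (λ l → incident? l (h , k)) RR) Res-unique total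
                          (λ l _ _ e e′ → trans (sym e) e′) ⟩
          length (filter (λ l → incident? l (h , k)) RR) ≡⟨ length-filter≡count (λ l → incident? l (h , k)) RR ⟩
          count (λ l → incident? l (h , k)) RR ∎
          where
          k≉0 : k ≉ 0ℤ
          k≉0 = H≉0 (proj₂ (∈-cartesianProduct⁻ H H i))
          total : ∀ {a} → a ∈ Res → ∃ λ l → l ∈ filter (λ l → incident? l (h , k)) RR × proj₁ l ≡ a
          total {a} j = let (b , jb , e) = solve-linear k≉0 (w - a * h) in
            (a , b) , ∈-filter⁺ (λ l → incident? l (h , k)) (∈-cartesianProduct⁺ j jb)
              (lin₁ e 1ℤ (eqn a b h k w)) , refl
            where
            eqn : ∀ a b h k w → (a * h + b * k) - w ≡ 1ℤ * (b * k - (w - a * h))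
            eqn = solve-∀

    opaque
      -- Two points with vanishing determinant on one line that misses the origin coincide. So
      -- distinct points have an invertible determinant, and Cramer's rule fixes the line; for equal
      -- points, a fixes b.
      lines-through : ∀ {pt pt′} → pt ∈ HH → pt′ ∈ HH →
        ∑ RR (λ l → 𝟙 (incident? l pt) ℕ.* 𝟙 (incident? l pt′)) ℕ.≤ 𝟙 (≡-dec _≟_ _≟_ pt pt′) ℕ.* p ℕ.+ 1
      lines-through {h , k} {h′ , k′} i i′ = cases (≡-dec _≟_ _≟_ (h , k) (h′ , k′))
        where
        open ℕ.≤-Reasoning
        ih : h ∈ H
        ih = proj₁ (∈-cartesianProduct⁻ H H i)
        ik : k ∈ H
        ik = proj₂ (∈-cartesianProduct⁻ H H i)
        ih′ : h′ ∈ H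
        ih′ = proj₁ (∈-cartesianProduct⁻ H H i′)
        ik′ : k′ ∈ H
        ik′ = proj₂ (∈-cartesianProduct⁻ H H i′)
        both? : ∀ l → Dec (Incident l (h , k) × Incident l (h′ , k′))
        both? l = incident? l (h , k) ×-dec incident? l (h′ , k′)
        rewrite-both : ∑ RR (λ l → 𝟙 (incident? l (h , k)) ℕ.* 𝟙 (incident? l (h′ , k′))) ≡ count both? RR
        rewrite-both = ∑-cong RR (λ {l} _ → sym (𝟙-× (incident? l (h , k)) (incident? l (h′ , k′))))
        same : count both? RR ℕ.≤ p
        same = begin
          count both? RR ≡⟨ length-filter≡count both? RR ⟨
          length (filter both? RR) ≤⟨ left-unique-relation (λ l a → proj₁ l ≡ a) Res (filter⁺ both? (cartesianProduct⁺ Res-unique Res-unique)) total uni ⟩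
          length Res ≡⟨ length-Res ⟩
          p ∎
          where
          total : ∀ {l} → l ∈ filter both? RR → ∃ λ a → a ∈ Res × proj₁ l ≡ a
          total {a , b} j = a , proj₁ (∈-cartesianProduct⁻ Res Res (proj₁ (∈-filter⁻ both? {xs = RR} j))) , refl
          uni : ∀ {l l′} a → l ∈ filter both? RR → l′ ∈ filter both? RR → proj₁ l ≡ a → proj₁ l′ ≡ a → l ≡ l′
          uni {a , b} {.a , b′} .a j j′ refl refl =
            let (j₁ , e , _) = ∈-filter⁻ both? {xs = RR} j
                (j₁′ , e′ , _) = ∈-filter⁻ both? {xs = RR} j′
            in cong (a ,_) (Res-≈ (proj₂ (∈-cartesianProduct⁻ Res Res j₁)) (proj₂ (∈-cartesianProduct⁻ Res Res j₁′))
                 (≈-cancelʳ k {b} {b′} (H≉0 ik) (lin₂ e e′ 1ℤ -1ℤ (eqn a b b′ h k w))))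
            where
            eqn : ∀ a b b′ h k w → b * k - b′ * k ≡ 1ℤ * (a * h + b * k - w) + -1ℤ * (a * h + b′ * k - w)
            eqn = solve-∀
        distinct : (h , k) ≢ (h′ , k′) → count both? RR ℕ.≤ 1
        distinct ne = count≤1 both? (cartesianProduct⁺ Res-unique Res-unique) uni
          where
          Δ : ℤ
          Δ = h * k′ - k * h′
          Δ≉0 : ∀ {a b} → Incident (a , b) (h , k) → Incident (a , b) (h′ , k′) → Δ ≉ 0ℤ
          Δ≉0 {a} {b} e e′ z = ne (cong₂ _,_ (H-≈ ih ih′ h≈) (H-≈ ik ik′ k≈))
            where
            eqn₁ : ∀ a b h k h′ k′ w → w * h - w * h′ ≡ h′ * (a * h + b * k - w) + - h * (a * h′ + b * k′ - w) + b * (h * k′ - k * h′ - 0ℤ)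
            eqn₁ = solve-∀
            eqn₂ : ∀ a b h k h′ k′ w → w * k - w * k′ ≡ k′ * (a * h + b * k - w) + - k * (a * h′ + b * k′ - w) + - a * (h * k′ - k * h′ - 0ℤ)
            eqn₂ = solve-∀
            lin₃ : ∀ {x y x₁ y₁ x₂ y₂ x₃ y₃} c₁ c₂ c₃ → x₁ ≈ y₁ → x₂ ≈ y₂ → x₃ ≈ y₃ →
              x - y ≡ c₁ * (x₁ - y₁) + c₂ * (x₂ - y₂) + c₃ * (x₃ - y₃) → x ≈ y
            lin₃ {x} {y} {x₁} {y₁} {x₂} {y₂} {x₃} {y₃} c₁ c₂ c₃ e₁ e₂ e₃ eq =
              -≈0⇒≈ (subst (_≈ 0ℤ) (sym eq) (lin₂ (lin₂ {c₁ * (x₁ - y₁) + c₂ * (x₂ - y₂)} {0ℤ} e₁ e₂ c₁ c₂ (x-0≡x _)) e₃ 1ℤ c₃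
                (eqn₀ (c₁ * (x₁ - y₁) + c₂ * (x₂ - y₂)) c₃ (x₃ - y₃))))
              where
              eqn₀ : ∀ s c z → (s + c * z) - 0ℤ ≡ 1ℤ * (s - 0ℤ) + c * z
              eqn₀ = solve-∀
            h≈ : h ≈ h′
            h≈ = ≈-cancelˡ w {h} {h′} w≉0 (lin₃ h′ (- h) b e e′ z (eqn₁ a b h k h′ k′ w))
            k≈ : k ≈ k′
            k≈ = ≈-cancelˡ w {k} {k′} w≉0 (lin₃ k′ (- k) (- a) e e′ z (eqn₂ a b h k h′ k′ w))
          uni : ∀ {l l′} → l ∈ RR → l′ ∈ RR → Incident l (h , k) × Incident l (h′ , k′) →
            Incident l′ (h , k) × Incident l′ (h′ , k′) → l ≡ l′
          uni {a , b} {a′ , b′} j j′ (e₁ , e₂) (f₁ , f₂) =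
            let (ja , jb) = ∈-cartesianProduct⁻ Res Res j
                (ja′ , jb′) = ∈-cartesianProduct⁻ Res Res j′
                δ₁ : (a * h + b * k) - (a′ * h + b′ * k) ≈ 0ℤ
                δ₁ = ≈⇒-≈0 (≈-trans e₁ (≈-sym f₁))
                δ₂ : (a * h′ + b * k′) - (a′ * h′ + b′ * k′) ≈ 0ℤ
                δ₂ = ≈⇒-≈0 (≈-trans e₂ (≈-sym f₂))
                Δ≢ = Δ≉0 {a} {b} e₁ e₂
            in cong₂ _,_
                 (Res-≈ ja ja′ (≈-cancelʳ Δ {a} {a′} Δ≢ (lin₂ δ₁ δ₂ k′ (- k) (eqn₁ a b a′ b′ h k h′ k′))))
                 (Res-≈ jb jb′ (≈-cancelʳ Δ {b} {b′} Δ≢ (lin₂ δ₁ δ₂ (- h′) h (eqn₂ a b a′ b′ h k h′ k′))))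
            where
            eqn₁ : ∀ a b a′ b′ h k h′ k′ → a * (h * k′ - k * h′) - a′ * (h * k′ - k * h′) ≡
              k′ * ((a * h + b * k) - (a′ * h + b′ * k) - 0ℤ) + - k * ((a * h′ + b * k′) - (a′ * h′ + b′ * k′) - 0ℤ)
            eqn₁ = solve-∀
            eqn₂ : ∀ a b a′ b′ h k h′ k′ → b * (h * k′ - k * h′) - b′ * (h * k′ - k * h′) ≡
              - h′ * ((a * h + b * k) - (a′ * h + b′ * k) - 0ℤ) + h * ((a * h′ + b * k′) - (a′ * h′ + b′ * k′) - 0ℤ)
            eqn₂ = solve-∀
        cases : (dec : Dec ((h , k) ≡ (h′ , k′))) →
          ∑ RR (λ l → 𝟙 (incident? l (h , k)) ℕ.* 𝟙 (incident? l (h′ , k′))) ℕ.≤ 𝟙 dec ℕ.* p ℕ.+ 1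
        cases (yes _) = ℕ.≤-trans (ℕ.≤-reflexive rewrite-both) (ℕ.≤-trans same
          (ℕ.≤-trans (ℕ.≤-reflexive (sym (ℕ.*-identityˡ p))) (ℕ.m≤m+n (1 ℕ.* p) 1)))
        cases (no ne) = ℕ.≤-trans (ℕ.≤-reflexive rewrite-both) (distinct ne)

    opaque
      ∑N²≤ : ∑ RR (λ l → N l ℕ.* N l) ℕ.≤ t ℕ.* t ℕ.* (p ℕ.+ t ℕ.* t)
      ∑N²≤ = begin
        ∑ RR (λ l → N l ℕ.* N l) ≡⟨ ∑-cong RR (λ {l} _ → sym (∑-product HH HH (λ pt → 𝟙 (incident? l pt)) (λ pt → 𝟙 (incident? l pt)))) ⟩
        ∑ RR (λ l → ∑ HH (λ pt → ∑ HH (λ pt′ → 𝟙 (incident? l pt) ℕ.* 𝟙 (incident? l pt′)))) ≡⟨ ∑-swap RR HH _ ⟩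
        ∑ HH (λ pt → ∑ RR (λ l → ∑ HH (λ pt′ → 𝟙 (incident? l pt) ℕ.* 𝟙 (incident? l pt′)))) ≡⟨ ∑-cong HH (λ _ → ∑-swap RR HH _) ⟩
        ∑ HH (λ pt → ∑ HH (λ pt′ → ∑ RR (λ l → 𝟙 (incident? l pt) ℕ.* 𝟙 (incident? l pt′)))) ≤⟨ ∑-bound HH (p ℕ.+ t ℕ.* t) each ⟩
        length HH ℕ.* (p ℕ.+ t ℕ.* t) ≡⟨ cong (ℕ._* (p ℕ.+ t ℕ.* t)) length-HH ⟩
        t ℕ.* t ℕ.* (p ℕ.+ t ℕ.* t) ∎
        where
        open ℕ.≤-Reasoning
        each : ∀ {pt} → pt ∈ HH → ∑ HH (λ pt′ → ∑ RR (λ l → 𝟙 (incident? l pt) ℕ.* 𝟙 (incident? l pt′))) ℕ.≤ p ℕ.+ t ℕ.* t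
        each {pt} i = begin
          ∑ HH (λ pt′ → ∑ RR (λ l → 𝟙 (incident? l pt) ℕ.* 𝟙 (incident? l pt′))) ≤⟨ ∑-mono HH (λ i′ → lines-through i i′) ⟩
          ∑ HH (λ pt′ → 𝟙 (≡-dec _≟_ _≟_ pt pt′) ℕ.* p ℕ.+ 1) ≡⟨ ∑-+ HH (λ pt′ → 𝟙 (≡-dec _≟_ _≟_ pt pt′) ℕ.* p) (λ _ → 1) ⟩
          ∑ HH (λ pt′ → 𝟙 (≡-dec _≟_ _≟_ pt pt′) ℕ.* p) ℕ.+ ∑ HH (λ _ → 1)
            ≡⟨ cong₂ ℕ._+_ (∑-*ʳ HH p (λ pt′ → 𝟙 (≡-dec _≟_ _≟_ pt pt′))) (trans (∑-one HH) length-HH) ⟩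
          count (≡-dec _≟_ _≟_ pt) HH ℕ.* p ℕ.+ t ℕ.* t
            ≤⟨ ℕ.+-monoˡ-≤ (t ℕ.* t) (ℕ.*-monoˡ-≤ p (count≤1 (≡-dec _≟_ _≟_ pt) (cartesianProduct⁺ H-unique H-unique) (λ _ _ e e′ → trans (sym e) e′))) ⟩
          1 ℕ.* p ℕ.+ t ℕ.* t ≡⟨ cong (ℕ._+ t ℕ.* t) (ℕ.*-identityˡ p) ⟩
          p ℕ.+ t ℕ.* t ∎

    -- The squared distance of N from its expected value t² / p, multiplied by p² to stay among
    -- natural numbers.
    deviation : ℤ × ℤ → ℕ
    deviation l = ℕ.∣ p ℕ.* N l - t ℕ.* t ∣ ℕ.* ℕ.∣ p ℕ.* N l - t ℕ.* t ∣

    opaque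
      -- Expanding the square, the first moment enters the mixed term from below and the second
      -- moment from above. The terms in t⁴ cancel, and the diagonal p³ t² is left.
      variance : ∑ RR deviation ℕ.≤ p ℕ.* p ℕ.* p ℕ.* (t ℕ.* t)
      variance = ℕ.+-cancelʳ-≤ (2 ℕ.* (p ℕ.* c) ℕ.* (c ℕ.* p)) (∑ RR deviation) (p ℕ.* p ℕ.* p ℕ.* c) (begin
        ∑ RR deviation ℕ.+ 2 ℕ.* (p ℕ.* c) ℕ.* (c ℕ.* p) ≤⟨ ℕ.+-monoʳ-≤ (∑ RR deviation) (ℕ.*-monoʳ-≤ (2 ℕ.* (p ℕ.* c)) ∑N≥) ⟩
        ∑ RR deviation ℕ.+ 2 ℕ.* (p ℕ.* c) ℕ.* ∑ RR N ≡⟨ cong (∑ RR deviation ℕ.+_) (∑-*ˡ RR (2 ℕ.* (p ℕ.* c)) N) ⟨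
        ∑ RR deviation ℕ.+ ∑ RR (λ l → 2 ℕ.* (p ℕ.* c) ℕ.* N l) ≡⟨ ∑-+ RR deviation _ ⟨
        ∑ RR (λ l → deviation l ℕ.+ 2 ℕ.* (p ℕ.* c) ℕ.* N l) ≡⟨ ∑-cong RR (λ {l} _ → pointwise (N l)) ⟩
        ∑ RR (λ l → p ℕ.* p ℕ.* (N l ℕ.* N l) ℕ.+ c ℕ.* c) ≡⟨ ∑-+ RR _ _ ⟩
        ∑ RR (λ l → p ℕ.* p ℕ.* (N l ℕ.* N l)) ℕ.+ ∑ RR (λ _ → c ℕ.* c)
          ≡⟨ cong₂ ℕ._+_ (∑-*ˡ RR (p ℕ.* p) (λ l → N l ℕ.* N l)) (trans (∑-const RR (c ℕ.* c)) (cong (ℕ._* (c ℕ.* c)) (trans (length-× Res Res) (cong₂ ℕ._*_ length-Res length-Res)))) ⟩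
        p ℕ.* p ℕ.* ∑ RR (λ l → N l ℕ.* N l) ℕ.+ p ℕ.* p ℕ.* (c ℕ.* c) ≤⟨ ℕ.+-monoˡ-≤ (p ℕ.* p ℕ.* (c ℕ.* c)) (ℕ.*-monoʳ-≤ (p ℕ.* p) ∑N²≤) ⟩
        p ℕ.* p ℕ.* (c ℕ.* (p ℕ.+ c)) ℕ.+ p ℕ.* p ℕ.* (c ℕ.* c) ≡⟨ eqn p c ⟩
        p ℕ.* p ℕ.* p ℕ.* c ℕ.+ 2 ℕ.* (p ℕ.* c) ℕ.* (c ℕ.* p) ∎)
        where
        open ℕ.≤-Reasoning
        c : ℕ
        c = t ℕ.* t
        eqn : ∀ p c → p ℕ.* p ℕ.* (c ℕ.* (p ℕ.+ c)) ℕ.+ p ℕ.* p ℕ.* (c ℕ.* c) ≡ p ℕ.* p ℕ.* p ℕ.* c ℕ.+ 2 ℕ.* (p ℕ.* c) ℕ.* (c ℕ.* p)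
        eqn = ℕ.solve-∀
        eqn₁ : ∀ p c n → 2 ℕ.* (p ℕ.* c) ℕ.* n ≡ 2 ℕ.* (p ℕ.* n ℕ.* c)
        eqn₁ = ℕ.solve-∀
        eqn₂ : ∀ p n → p ℕ.* n ℕ.* (p ℕ.* n) ≡ p ℕ.* p ℕ.* (n ℕ.* n)
        eqn₂ = ℕ.solve-∀
        pointwise : ∀ n → ℕ.∣ p ℕ.* n - c ∣ ℕ.* ℕ.∣ p ℕ.* n - c ∣ ℕ.+ 2 ℕ.* (p ℕ.* c) ℕ.* n ≡ p ℕ.* p ℕ.* (n ℕ.* n) ℕ.+ c ℕ.* c
        pointwise n = trans (cong (ℕ.∣ p ℕ.* n - c ∣ ℕ.* ℕ.∣ p ℕ.* n - c ∣ ℕ.+_) (eqn₁ p c n))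
          (trans (∣x-y∣² (p ℕ.* n) c) (cong (ℕ._+ c ℕ.* c) (eqn₂ p n)))

    module _ {a₀ b₀ : ℤ} (a₀≉0 : a₀ ≉ 0ℤ) (b₀≉0 : b₀ ≉ 0ℤ) where

      n₀ : ℕ
      n₀ = N (a₀ , b₀)

      rich? : ∀ l → Dec (n₀ ℕ.≤ N l)
      rich? l = n₀ ℕ.≤? N l

      opaque
        -- H × H acts on the lines a h + b k = w without changing the number of incidences.
        N-scale : ∀ {a b g g′} → g ∈ H → g′ ∈ H → a₀ * g ≈ a → b₀ * g′ ≈ b → n₀ ℕ.≤ N (a , b)
        N-scale {a} {b} {g} {g′} ig ig′ ea eb = begin
          n₀ ≡⟨ length-filter≡count (incident? (a₀ , b₀)) HH ⟨
          length (filter (incident? (a₀ , b₀)) HH)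
            ≤⟨ left-unique-relation Rel (filter (incident? (a , b)) HH) (filter⁺ (incident? (a₀ , b₀)) (cartesianProduct⁺ H-unique H-unique)) total uni ⟩
          length (filter (incident? (a , b)) HH) ≡⟨ length-filter≡count (incident? (a , b)) HH ⟩
          N (a , b) ∎
          where
          open ℕ.≤-Reasoning
          Rel : ℤ × ℤ → ℤ × ℤ → Set
          Rel (h , k) (h′ , k′) = h ≈ h′ * g × k ≈ k′ * g′
          total : ∀ {pt} → pt ∈ filter (incident? (a₀ , b₀)) HH → ∃ λ pt′ → pt′ ∈ filter (incident? (a , b)) HH × Rel pt pt′
          total {h , k} i =
            let (j , e) = ∈-filter⁻ (incident? (a₀ , b₀)) {xs = HH} i
                (jh , jk) = ∈-cartesianProduct⁻ H H j
                (h′ , ih′ , eh) = ratio (H≉0 ig) (≈-trans (proj₂ (∈H⁻ jh)) (≈-sym (proj₂ (∈H⁻ ig))))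
                (k′ , ik′ , ek) = ratio (H≉0 ig′) (≈-trans (proj₂ (∈H⁻ jk)) (≈-sym (proj₂ (∈H⁻ ig′))))
            in (h′ , k′) , ∈-filter⁺ (incident? (a , b)) (∈-cartesianProduct⁺ ih′ ik′)
                 (a * h′ + b * k′ ≈⟨ ≈-+ (≈-* (≈-sym ea) (≈-refl {h′})) (≈-* (≈-sym eb) (≈-refl {k′})) ⟩
                  a₀ * g * h′ + b₀ * g′ * k′ ≡⟨ eqn a₀ g h′ b₀ g′ k′ ⟩≈
                  a₀ * (h′ * g) + b₀ * (k′ * g′) ≈⟨ ≈-+ (≈-* (≈-refl {a₀}) (≈-sym eh)) (≈-* (≈-refl {b₀}) (≈-sym ek)) ⟩
                  a₀ * h + b₀ * k ≈⟨ e ⟩ w ≈∎) , eh , ek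
            where
            eqn : ∀ a g h b g′ k → a * g * h + b * g′ * k ≡ a * (h * g) + b * (k * g′)
            eqn = solve-∀
          uni : ∀ {pt pt′} z → pt ∈ filter (incident? (a₀ , b₀)) HH → pt′ ∈ filter (incident? (a₀ , b₀)) HH → Rel pt z → Rel pt′ z → pt ≡ pt′
          uni {h , k} {h₁ , k₁} (h′ , k′) i i₁ (e , f) (e₁ , f₁) =
            let (jh , jk) = ∈-cartesianProduct⁻ H H (proj₁ (∈-filter⁻ (incident? (a₀ , b₀)) {xs = HH} i))
                (jh₁ , jk₁) = ∈-cartesianProduct⁻ H H (proj₁ (∈-filter⁻ (incident? (a₀ , b₀)) {xs = HH} i₁))
            in cong₂ _,_ (H-≈ jh jh₁ (≈-trans e (≈-sym e₁))) (H-≈ jk jk₁ (≈-trans f (≈-sym f₁)))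

      opaque
        -- The orbit of (a₀ , b₀) under H × H has t² members, because a₀ and b₀ are invertible.
        many-rich : t ℕ.* t ℕ.≤ count rich? RR
        many-rich = begin
          t ℕ.* t ≡⟨ length-HH ⟨
          length HH ≤⟨ left-unique-relation Rel (filter rich? RR) (cartesianProduct⁺ H-unique H-unique) total uni ⟩
          length (filter rich? RR) ≡⟨ length-filter≡count rich? RR ⟩
          count rich? RR ∎
          where
          open ℕ.≤-Reasoning
          Rel : ℤ × ℤ → ℤ × ℤ → Set
          Rel (g , g′) (a , b) = a₀ * g ≈ a × b₀ * g′ ≈ b
          total : ∀ {gg} → gg ∈ HH → ∃ λ l → l ∈ filter rich? RR × Rel gg l
          total {g , g′} i =
            let (ig , ig′) = ∈-cartesianProduct⁻ H H i
                (a , ia , ea) = residue (a₀ * g)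
                (b , ib , eb) = residue (b₀ * g′)
            in (a , b) , ∈-filter⁺ rich? (∈-cartesianProduct⁺ ia ib) (N-scale ig ig′ ea eb) , ea , eb
          uni : ∀ {gg gg′} l → gg ∈ HH → gg′ ∈ HH → Rel gg l → Rel gg′ l → gg ≡ gg′
          uni {g , k} {g′ , k′} (a , b) i i′ (e , f) (e′ , f′) =
            let (ig , ik) = ∈-cartesianProduct⁻ H H i
                (ig′ , ik′) = ∈-cartesianProduct⁻ H H i′
            in cong₂ _,_ (H-≈ ig ig′ (≈-cancelˡ a₀ {g} {g′} a₀≉0 (≈-trans e (≈-sym e′))))
                         (H-≈ ik ik′ (≈-cancelˡ b₀ {k} {k′} b₀≉0 (≈-trans f (≈-sym f′))))

      opaque
        -- All t² lines of the orbit deviate by at least e = p n₀ - t², so t² e² ≤ p³ t². Once p n₀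
        -- exceeds twice t², it is at most 2 e.
        incidence-bound : 1 ℕ.≤ t → p ℕ.* n₀ ℕ.≤ 2 ℕ.* (t ℕ.* t) ⊎ n₀ ℕ.* n₀ ℕ.≤ 4 ℕ.* p
        incidence-bound 1≤t = cases (ℕ.≤-total (p ℕ.* n₀) (2 ℕ.* c))
          where
          open ℕ.≤-Reasoning
          c e : ℕ
          c = t ℕ.* t
          e = p ℕ.* n₀ ℕ.∸ c
          instance
            c≢0 : ℕ.NonZero c
            c≢0 = ℕ.m*n≢0 t t {{ℕ.>-nonZero 1≤t}} {{ℕ.>-nonZero 1≤t}}
            pp≢0 : ℕ.NonZero (p ℕ.* p)
            pp≢0 = ℕ.m*n≢0 p p
          dev≥ : ∀ l → 𝟙 (rich? l) ℕ.* (e ℕ.* e) ℕ.≤ deviation l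
          dev≥ l with rich? l
          ... | no _ = z≤n
          ... | yes h = ℕ.≤-trans (ℕ.≤-reflexive (ℕ.*-identityˡ (e ℕ.* e))) (ℕ.*-mono-≤ e≤ e≤)
            where
            e≤ : e ℕ.≤ ℕ.∣ p ℕ.* N l - c ∣
            e≤ = ℕ.≤-trans (ℕ.∸-monoˡ-≤ c (ℕ.*-monoʳ-≤ p h)) (ℕ.m∸n≤∣m-n∣ (p ℕ.* N l) c)
          e²≤p³ : e ℕ.* e ℕ.≤ p ℕ.* p ℕ.* p
          e²≤p³ = ℕ.*-cancelˡ-≤ c (begin
            c ℕ.* (e ℕ.* e) ≤⟨ ℕ.*-monoˡ-≤ (e ℕ.* e) many-rich ⟩
            count rich? RR ℕ.* (e ℕ.* e) ≡⟨ ∑-*ʳ RR (e ℕ.* e) (λ l → 𝟙 (rich? l)) ⟨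
            ∑ RR (λ l → 𝟙 (rich? l) ℕ.* (e ℕ.* e)) ≤⟨ ∑-mono RR (λ {l} _ → dev≥ l) ⟩
            ∑ RR deviation ≤⟨ variance ⟩
            p ℕ.* p ℕ.* p ℕ.* c ≡⟨ ℕ.*-comm (p ℕ.* p ℕ.* p) c ⟩
            c ℕ.* (p ℕ.* p ℕ.* p) ∎)
          cases : p ℕ.* n₀ ℕ.≤ 2 ℕ.* c ⊎ 2 ℕ.* c ℕ.≤ p ℕ.* n₀ → p ℕ.* n₀ ℕ.≤ 2 ℕ.* c ⊎ n₀ ℕ.* n₀ ℕ.≤ 4 ℕ.* p
          cases (inj₁ le) = inj₁ le
          cases (inj₂ ge) = inj₂ (ℕ.*-cancelˡ-≤ (p ℕ.* p) (begin
            p ℕ.* p ℕ.* (n₀ ℕ.* n₀) ≡⟨ eqn₁ p n₀ ⟩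
            p ℕ.* n₀ ℕ.* (p ℕ.* n₀) ≤⟨ ℕ.*-mono-≤ pn₀≤2e pn₀≤2e ⟩
            2 ℕ.* e ℕ.* (2 ℕ.* e) ≡⟨ eqn₂ e ⟩
            4 ℕ.* (e ℕ.* e) ≤⟨ ℕ.*-monoʳ-≤ 4 e²≤p³ ⟩
            4 ℕ.* (p ℕ.* p ℕ.* p) ≡⟨ eqn₃ p ⟩
            p ℕ.* p ℕ.* (4 ℕ.* p) ∎))
            where
            eqn₁ : ∀ p n → p ℕ.* p ℕ.* (n ℕ.* n) ≡ p ℕ.* n ℕ.* (p ℕ.* n)
            eqn₁ = ℕ.solve-∀
            eqn₂ : ∀ e → 2 ℕ.* e ℕ.* (2 ℕ.* e) ≡ 4 ℕ.* (e ℕ.* e)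
            eqn₂ = ℕ.solve-∀
            eqn₃ : ∀ p → 4 ℕ.* (p ℕ.* p ℕ.* p) ≡ p ℕ.* p ℕ.* (4 ℕ.* p)
            eqn₃ = ℕ.solve-∀
            pn₀≤2e : p ℕ.* n₀ ℕ.≤ 2 ℕ.* e
            pn₀≤2e = begin
              p ℕ.* n₀ ≡⟨ ℕ.m+[n∸m]≡n (ℕ.≤-trans (ℕ.m≤n*m c 2) ge) ⟨
              c ℕ.+ e ≤⟨ ℕ.+-monoˡ-≤ e (begin
                c ≡⟨ ℕ.m+n∸n≡m c c ⟨
                c ℕ.+ c ℕ.∸ c ≡⟨ cong (λ z → c ℕ.+ z ℕ.∸ c) (ℕ.+-identityʳ c) ⟨
                2 ℕ.* c ℕ.∸ c ≤⟨ ℕ.∸-monoˡ-≤ c ge ⟩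
                e ∎) ⟩
              e ℕ.+ e ≡⟨ cong (e ℕ.+_) (ℕ.+-identityʳ e) ⟨
              2 ℕ.* e ∎

-- The case t ≈ p^(2/3): Burgess's shifts.

module High (p : ℕ) (pr : Prime p) (d : ℕ) .{{d≢0 : NonZero d}} where

  open Counting
  open Box
  open Divisor
  open ModP p pr
  open Group p pr d
  open Lattice p pr
  open Energy p pr d
  open Interval p pr d
  open Lines p pr d
  import Data.Nat.Properties as ℕ
  open import Data.Integer hiding (suc; pred)
  open import Data.Integer.Properties
  open import Data.Integer.Tactic.RingSolver using (solve-∀)
  import Data.Nat.Tactic.RingSolver as ℕ

  opaque
    Pos : ℕ → List ℤ
    Pos k = map (λ i → + suc i) (upTo k)

    length-Pos : ∀ k → length (Pos k) ≡ k
    length-Pos k = trans (length-map _ (upTo k)) (length-upTo k)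

    Pos-unique : ∀ k → Unique (Pos k)
    Pos-unique k = map⁺ (λ e → ℕ.suc-injective (+-injective e)) (upTo⁺ k)

    ∈-Pos⁻ : ∀ {k z} → z ∈ Pos k → ∃ λ i → z ≡ + suc i × i ℕ.< k
    ∈-Pos⁻ i = let (j , k , e) = ∈-map⁻ (λ i → + suc i) i in j , e , ∈-upTo⁻ k

  Pos-abs : ∀ {k z} → z ∈ Pos k → ∣ z ∣ ℕ.≤ k
  Pos-abs i with ∈-Pos⁻ i
  ... | _ , refl , lt = lt

  Pos≢0 : ∀ {k z} → z ∈ Pos k → z ≢ 0ℤ
  Pos≢0 i with ∈-Pos⁻ i
  ... | _ , refl , _ = λ ()

  Pos≉0 : ∀ {k z} → k ℕ.< p → z ∈ Pos k → z ≉ 0ℤ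
  Pos≉0 k<p i h = Pos≢0 i (small≈0 (ℕ.≤-<-trans (Pos-abs i) k<p) h)

  Pos-diff : ∀ {k z w} → k ℕ.+ k ℕ.< p → z ∈ Pos k → w ∈ Pos k → z ≢ w → z - w ≉ 0ℤ
  Pos-diff {k} {z} {w} lt i j z≢w h = z≢w (i-j≡0⇒i≡j z w (small≈0
    (ℕ.≤-<-trans (∣i-j∣≤∣i∣+∣j∣ z w) (ℕ.≤-<-trans (ℕ.+-mono-≤ (Pos-abs i) (Pos-abs j)) lt)) h))

  three-distinct : {Q : ℤ → Set} (Q? : ∀ x → Dec (Q x)) {xs : List ℤ} → Unique xs → 3 ℕ.≤ count Q? xs →
    ∃ λ a → ∃ λ b → ∃ λ c → (a ∈ xs × Q a) × (b ∈ xs × Q b) × (c ∈ xs × Q c) × a ≢ b × a ≢ c × b ≢ c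
  three-distinct Q? {xs} u h = build (filter Q? xs) (filter⁺ Q? u) (λ i → ∈-filter⁻ Q? {xs = xs} i)
      (subst (3 ℕ.≤_) (sym (length-filter≡count Q? xs)) h)
    where
    build : ∀ ys → Unique ys → (∀ {y} → y ∈ ys → y ∈ xs × _) → 3 ℕ.≤ length ys → _
    build (_ ∷ []) _ _ (s≤s ())
    build (_ ∷ _ ∷ []) _ _ (s≤s (s≤s ()))
    build (a ∷ b ∷ c ∷ _) ((a≢b ∷ a≢c ∷ _) ∷ (b≢c ∷ _) ∷ _) mem _ =
      a , b , c , mem (here refl) , mem (there (here refl)) , mem (there (there (here refl))) , a≢b , a≢c , b≢c

  -- The two conditions on `f` make it an upper bound for n₀ under either alternative of
  -- `incidence-bound`.
  module _ {C f : ℕ} (2C<p : C ℕ.+ C ℕ.< p) (1≤t : 1 ℕ.≤ t) (f-large : 2 ℕ.* (t ℕ.* t) ℕ.≤ p ℕ.* f) (f²-large : 4 ℕ.* p ℕ.≤ f ℕ.* f) where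

    SameCoset : ℤ → ℤ × (ℤ × ℤ) → Set
    SameCoset y (a , b , c) = (a ≢ b × a ≢ c × b ≢ c) × y + c ≉ 0ℤ ×
      ((y + a) ^ d ≈ (y + c) ^ d × (y + b) ^ d ≈ (y + c) ^ d)

    sameCoset? : ∀ y abc → Dec (SameCoset y abc)
    sameCoset? y (a , b , c) = (¬? (a ≟ b) ×-dec ¬? (a ≟ c) ×-dec ¬? (b ≟ c)) ×-dec ¬? (y + c ≈? 0ℤ) ×-dec
      ((y + a) ^ d ≈? (y + c) ^ d) ×-dec ((y + b) ^ d ≈? (y + c) ^ d)

    triples : List (ℤ × (ℤ × ℤ))
    triples = cartesianProduct (Pos C) (cartesianProduct (Pos C) (Pos C))

    opaque
      -- The quotients (y + a) / (y + c) and (y + b) / (y + c) are points of H × H on a line.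
      coset-triples-bound : ∀ {abc} → abc ∈ triples → count (λ y → sameCoset? y abc) Res ℕ.≤ f
      coset-triples-bound {a , b , c} i = cases (a ≟ b) (a ≟ c) (b ≟ c)
        where
        open ℕ.≤-Reasoning
        ia : a ∈ Pos C
        ia = proj₁ (∈-cartesianProduct⁻ (Pos C) (cartesianProduct (Pos C) (Pos C)) i)
        ibc : b ∈ Pos C × c ∈ Pos C
        ibc = ∈-cartesianProduct⁻ (Pos C) (Pos C) (proj₂ (∈-cartesianProduct⁻ (Pos C) (cartesianProduct (Pos C) (Pos C)) i))
        none : ¬ (a ≢ b × a ≢ c × b ≢ c) → count (λ y → sameCoset? y (a , b , c)) Res ℕ.≤ f
        none h = ℕ.≤-trans (ℕ.≤-reflexive (count-none (λ y → sameCoset? y (a , b , c)) Res (λ _ s → h (proj₁ s)))) z≤n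
        main : a ≢ b → a ≢ c → b ≢ c → count (λ y → sameCoset? y (a , b , c)) Res ℕ.≤ f
        main a≢b a≢c b≢c = ℕ.≤-trans step (bound (incidence-bound w≉0 (Pos-diff 2C<p (proj₁ ibc) (proj₂ ibc) b≢c)
            (Pos-diff 2C<p (proj₂ ibc) ia (λ e → a≢c (sym e))) 1≤t))
          where
          w≉0 : b - a ≉ 0ℤ
          w≉0 = Pos-diff 2C<p (proj₁ ibc) ia (λ e → a≢b (sym e))
          n : ℕ
          n = N w≉0 (b - c , c - a)
          bound : p ℕ.* n ℕ.≤ 2 ℕ.* (t ℕ.* t) ⊎ n ℕ.* n ℕ.≤ 4 ℕ.* p → n ℕ.≤ f
          bound (inj₁ le) = ℕ.*-cancelˡ-≤ p (ℕ.≤-trans le f-large)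
          bound (inj₂ le) = ℕ.≮⇒≥ (λ f<n → ℕ.<⇒≱ (ℕ.*-mono-< f<n f<n) (ℕ.≤-trans le f²-large))
          S? : ∀ y → Dec (SameCoset y (a , b , c))
          S? y = sameCoset? y (a , b , c)
          L? : ∀ pt → Dec (Incident w≉0 (b - c , c - a) pt)
          L? = incident? w≉0 (b - c , c - a)
          Rel : ℤ → ℤ × ℤ → Set
          Rel y (h , k) = y + a ≈ h * (y + c) × y + b ≈ k * (y + c)
          total : ∀ {y} → y ∈ filter S? Res → ∃ λ pt → pt ∈ filter L? (HH w≉0) × Rel y pt
          total {y} j =
            let (_ , _ , y+c≉0 , ea , eb) = ∈-filter⁻ S? {xs = Res} j
                (h , ih , eh) = ratio y+c≉0 ea
                (k , ik , ek) = ratio y+c≉0 eb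
            in (h , k) , ∈-filter⁺ L? (∈-cartesianProduct⁺ ih ik)
                 -- The line comes from the identity (b - c) (y + a) + (c - a) (y + b) = (b - a) (y
                 -- + c), divided by y + c.
                 (≈-cancelʳ (y + c) {(b - c) * h + (c - a) * k} {b - a} y+c≉0
                   (lin₂ eh ek (- (b - c)) (- (c - a)) (eqn a b c y h k))) , eh , ek
            where
            eqn : ∀ a b c y h k → ((b - c) * h + (c - a) * k) * (y + c) - (b - a) * (y + c) ≡
              - (b - c) * ((y + a) - h * (y + c)) + - (c - a) * ((y + b) - k * (y + c))
            eqn = solve-∀
          uni : ∀ {y y′} pt → y ∈ filter S? Res → y′ ∈ filter S? Res → Rel y pt → Rel y′ pt → y ≡ y′
          uni {y} {y′} (h , k) j j′ (e , _) (e′ , _) =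
            let (iy , _ , y+c≉0 , _) = ∈-filter⁻ S? {xs = Res} j
                (iy′ , _ , _) = ∈-filter⁻ S? {xs = Res} j′
            in Res-≈ iy iy′ (≈-cancelˡ (a - c) {y} {y′} (Pos-diff 2C<p ia (proj₂ ibc) a≢c)
                 (lin₂ e e′ (- (y′ + c)) (y + c) (eqn a c y y′ h)))
            where
            eqn : ∀ a c y y′ h → (a - c) * y - (a - c) * y′ ≡
              - (y′ + c) * ((y + a) - h * (y + c)) + (y + c) * ((y′ + a) - h * (y′ + c))
            eqn = solve-∀
          step : count S? Res ℕ.≤ n
          step = begin
            count S? Res ≡⟨ length-filter≡count S? Res ⟨
            length (filter S? Res) ≤⟨ left-unique-relation Rel (filter L? (HH w≉0)) (filter⁺ S? Res-unique) total uni ⟩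
            length (filter L? (HH w≉0)) ≡⟨ length-filter≡count L? (HH w≉0) ⟩
            n ∎
        cases : Dec (a ≡ b) → Dec (a ≡ c) → Dec (b ≡ c) → count (λ y → sameCoset? y (a , b , c)) Res ℕ.≤ f
        cases (yes e) _ _ = none (λ z → proj₁ z e)
        cases (no _) (yes e) _ = none (λ z → proj₁ (proj₂ z) e)
        cases (no _) (no _) (yes e) = none (λ z → proj₂ (proj₂ z) e)
        cases (no x) (no y) (no z) = main x y z

    module _ {A : List ℤ} {n : ℕ} (hyp : CosetInInterval A n) {x₀ : ℤ} (x₀∈A : x₀ ∈ A)
      {B n′ D : ℕ} (n+BC≤n′ : n ℕ.+ B ℕ.* C ℕ.≤ n′) (4n′B<p : 4 ℕ.* n′ ℕ.* B ℕ.< p) (B<p : B ℕ.< p)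
      (few-divisors : ∀ k .{{_ : ℕ.NonZero k}} → k ℕ.≤ 2 ℕ.* n′ ℕ.* B → τ k ℕ.+ τ k ℕ.≤ D) where

      open CosetInInterval hyp

      T : ℕ
      T = length A

      Shift : Set
      Shift = ℤ × ℤ

      -- Divided by b this is y + c with y = (x₀ + i) / b, so the shifts that fall into `A` make the
      -- corresponding y + c members of one coset.
      shift : Shift → ℤ → ℤ
      shift (i , b) c = x₀ + i + b * c

      weight : Shift → ℕ
      weight ib = count (λ c → inA? (shift ib c)) (Pos C)

      shifts : List Shift
      shifts = cartesianProduct (Box n′) (Pos B)

      opaque
        row-sum : ∀ {b} → b ∈ Pos B → T ℕ.* C ℕ.≤ ∑ (Box n′) (λ i → weight (i , b))
        row-sum {b} ib = begin
          T ℕ.* C ≡⟨ cong (T ℕ.*_) (length-Pos C) ⟨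
          T ℕ.* length (Pos C) ≡⟨ length-× A (Pos C) ⟨
          length (cartesianProduct A (Pos C)) ≤⟨ total-relation rel? (cartesianProduct A (Pos C)) (Box n′) total ⟩
          ∑ (Box n′) (λ i → count (λ xc → rel? xc i) (cartesianProduct A (Pos C))) ≤⟨ ∑-mono (Box n′) (λ {i} _ → fibre i) ⟩
          ∑ (Box n′) (λ i → weight (i , b)) ∎
          where
          open ℕ.≤-Reasoning
          Rel : ℤ × ℤ → ℤ → Set
          Rel (x , c) i = x ≡ shift (i , b) c
          rel? : ∀ xc i → Dec (Rel xc i)
          rel? (x , c) i = x ≟ shift (i , b) c
          eqn : ∀ x x₀ b c → x ≡ x₀ + (x - x₀ - b * c) + b * c
          eqn = solve-∀
          total : ∀ {xc} → xc ∈ cartesianProduct A (Pos C) → ∃ λ i → i ∈ Box n′ × Rel xc i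
          total {x , c} k = let (ix , ic) = ∈-cartesianProduct⁻ A (Pos C) k in
            x - x₀ - b * c , ∈-Box⁺ {x - x₀ - b * c} (ℕ.≤-trans (∣i-j∣≤∣i∣+∣j∣ (x - x₀) (b * c))
              (ℕ.≤-trans (ℕ.+-mono-≤ (close ix x₀∈A)
                (ℕ.≤-trans (ℕ.≤-reflexive (abs-* b c)) (ℕ.*-mono-≤ (Pos-abs ib) (Pos-abs ic)))) n+BC≤n′)) ,
            eqn x x₀ b c
          fibre : ∀ i → count (λ xc → rel? xc i) (cartesianProduct A (Pos C)) ℕ.≤ weight (i , b)
          fibre i = begin
            count (λ xc → rel? xc i) (cartesianProduct A (Pos C)) ≡⟨ ∑-× A (Pos C) _ ⟩
            ∑ A (λ x → ∑ (Pos C) (λ c → 𝟙 (rel? (x , c) i))) ≡⟨ ∑-swap A (Pos C) _ ⟩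
            ∑ (Pos C) (λ c → count (λ x → rel? (x , c) i) A) ≤⟨ ∑-mono (Pos C) (λ {c} _ → each c (inA? (shift (i , b) c))) ⟩
            weight (i , b) ∎
            where
            each : ∀ c (dec : Dec (InA (shift (i , b) c))) → count (λ x → rel? (x , c) i) A ℕ.≤ 𝟙 dec
            each c (yes _) = count≤1 (λ x → rel? (x , c) i) unique (λ _ _ e e′ → trans e (sym e′))
            each c (no ¬in) = ℕ.≤-reflexive (count-none (λ x → rel? (x , c) i) A (λ ix e → ¬in (lose ix (≈-reflexive e))))

      -- Three shifts in `A` yield two quotients, that is, one point of H × H.
      heavy? : ∀ ib → Dec (3 ℕ.≤ weight ib)
      heavy? ib = 3 ℕ.≤? weight ib

      opaque
        Heavy : List Shift
        Heavy = filter heavy? shifts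

        ∈-Heavy⁻ : ∀ {ib} → ib ∈ Heavy → (proj₁ ib ∈ Box n′ × proj₂ ib ∈ Pos B) × 3 ℕ.≤ weight ib
        ∈-Heavy⁻ {i , b} k = let (k′ , h) = ∈-filter⁻ heavy? {xs = shifts} k in ∈-cartesianProduct⁻ (Box n′) (Pos B) k′ , h

        length-Heavy : length Heavy ≡ count heavy? shifts
        length-Heavy = length-filter≡count heavy? shifts

        ∑-Heavy≤ : ∀ g → ∑ Heavy g ℕ.≤ ∑ shifts g
        ∑-Heavy≤ g = ℕ.≤-trans (ℕ.≤-reflexive (∑-filter heavy? shifts g))
          (∑-mono shifts (λ {ib} _ → ℕ.≤-trans (ℕ.*-monoˡ-≤ (g ib) (𝟙≤1 (heavy? ib))) (ℕ.≤-reflexive (ℕ.*-identityˡ (g ib)))))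

      opaque
        -- Each shift is allowed a weight of 3, and only the heavy ones a further `C`.
        many-heavy : B ℕ.* (T ℕ.* C) ℕ.≤ suc (n′ ℕ.+ n′) ℕ.* B ℕ.* 3 ℕ.+ length Heavy ℕ.* C
        many-heavy = begin
          B ℕ.* (T ℕ.* C) ≡⟨ cong (ℕ._* (T ℕ.* C)) (length-Pos B) ⟨
          length (Pos B) ℕ.* (T ℕ.* C) ≤⟨ ∑-bound≥ (Pos B) (T ℕ.* C) row-sum ⟩
          ∑ (Pos B) (λ b → ∑ (Box n′) (λ i → weight (i , b))) ≡⟨ ∑-swap (Box n′) (Pos B) (λ i b → weight (i , b)) ⟨
          ∑ (Box n′) (λ i → ∑ (Pos B) (λ b → weight (i , b))) ≡⟨ ∑-× (Box n′) (Pos B) weight ⟨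
          ∑ shifts weight ≤⟨ ∑-mono shifts (λ {ib} _ → each ib (heavy? ib)) ⟩
          ∑ shifts (λ ib → 3 ℕ.+ 𝟙 (heavy? ib) ℕ.* C) ≡⟨ ∑-+ shifts (λ _ → 3) (λ ib → 𝟙 (heavy? ib) ℕ.* C) ⟩
          ∑ shifts (λ _ → 3) ℕ.+ ∑ shifts (λ ib → 𝟙 (heavy? ib) ℕ.* C)
            ≡⟨ cong₂ ℕ._+_ (trans (∑-const shifts 3) (cong (ℕ._* 3) (trans (length-× (Box n′) (Pos B)) (cong₂ ℕ._*_ (length-Box n′) (length-Pos B)))))
                 (trans (∑-*ʳ shifts C (λ ib → 𝟙 (heavy? ib))) (cong (ℕ._* C) (sym length-Heavy))) ⟩
          suc (n′ ℕ.+ n′) ℕ.* B ℕ.* 3 ℕ.+ length Heavy ℕ.* C ∎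
          where
          open ℕ.≤-Reasoning
          each : ∀ ib (dec : Dec (3 ℕ.≤ weight ib)) → weight ib ℕ.≤ 3 ℕ.+ 𝟙 dec ℕ.* C
          each ib (yes _) = ℕ.≤-trans (ℕ.≤-trans (count≤length _ (Pos C)) (ℕ.≤-reflexive (length-Pos C)))
            (ℕ.≤-trans (ℕ.≤-reflexive (sym (ℕ.*-identityˡ C))) (ℕ.m≤n+m (1 ℕ.* C) 3))
          each ib (no ¬h) = ℕ.≤-trans (ℕ.<⇒≤ (ℕ.≰⇒> ¬h)) (ℕ.m≤m+n 3 _)

      Quot : Shift → ℤ → Set
      Quot (i , b) y = b * y ≈ x₀ + i

      quot? : ∀ ib y → Dec (Quot ib y)
      quot? (i , b) y = b * y ≈? x₀ + i

      Cross : Shift → Shift → Set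
      Cross (i , b) (i′ , b′) = (x₀ + i) * b′ ≈ (x₀ + i′) * b

      cross? : ∀ ib ib′ → Dec (Cross ib ib′)
      cross? (i , b) (i′ , b′) = (x₀ + i) * b′ ≈? (x₀ + i′) * b

      opaque
        Ys : List ℤ
        Ys = filter (λ y → Any.any? (λ ib → quot? ib y) Heavy) Res

        Ys-unique : Unique Ys
        Ys-unique = filter⁺ (λ y → Any.any? (λ ib → quot? ib y) Heavy) Res-unique

        ∈-Ys⁻ : ∀ {y} → y ∈ Ys → y ∈ Res × Any (λ ib → Quot ib y) Heavy
        ∈-Ys⁻ = ∈-filter⁻ (λ y → Any.any? (λ ib → quot? ib y) Heavy) {xs = Res}

        ∈-Ys⁺ : ∀ {y} → y ∈ Res → Any (λ ib → Quot ib y) Heavy → y ∈ Ys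
        ∈-Ys⁺ = ∈-filter⁺ (λ y → Any.any? (λ ib → quot? ib y) Heavy)

      ν : ℤ → ℕ
      ν y = count (λ ib → quot? ib y) Heavy

      crossings : ℕ
      crossings = ∑ shifts (λ ib → count (cross? ib) shifts)

      opaque
        -- Cauchy-Schwarz over the quotients y. The second moment counts pairs of heavy shifts with
        -- equal quotients; it is enlarged to all pairs of shifts, which is a purely arithmetic
        -- count.
        heavy²≤ : length Heavy ℕ.* length Heavy ℕ.≤ length Ys ℕ.* crossings
        heavy²≤ = begin
          length Heavy ℕ.* length Heavy ≤⟨ ℕ.*-mono-≤ Heavy≤ Heavy≤ ⟩
          ∑ Ys ν ℕ.* ∑ Ys ν ≤⟨ cauchy-schwarz Ys ν ⟩
          length Ys ℕ.* ∑ Ys (λ y → ν y ℕ.* ν y) ≤⟨ ℕ.*-monoʳ-≤ (length Ys) ν²≤ ⟩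
          length Ys ℕ.* crossings ∎
          where
          open ℕ.≤-Reasoning
          Heavy≤ : length Heavy ℕ.≤ ∑ Ys ν
          Heavy≤ = total-relation quot? Heavy Ys total
            where
            total : ∀ {ib} → ib ∈ Heavy → ∃ λ y → y ∈ Ys × Quot ib y
            total {i , b} k =
              let (y , iy , e) = solve-linear (Pos≉0 B<p (proj₂ (proj₁ (∈-Heavy⁻ k)))) (x₀ + i)
                  e′ = ≈-trans (≈-reflexive (*-comm b y)) e
              in y , ∈-Ys⁺ iy (lose k e′) , e′
          ν²≤ : ∑ Ys (λ y → ν y ℕ.* ν y) ℕ.≤ crossings
          ν²≤ = begin
            ∑ Ys (λ y → ν y ℕ.* ν y) ≡⟨ ∑-cong Ys (λ {y} _ → sym (∑-product Heavy Heavy (λ ib → 𝟙 (quot? ib y)) (λ ib → 𝟙 (quot? ib y)))) ⟩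
            ∑ Ys (λ y → ∑ Heavy (λ ib → ∑ Heavy (λ ib′ → 𝟙 (quot? ib y) ℕ.* 𝟙 (quot? ib′ y)))) ≡⟨ ∑-swap Ys Heavy _ ⟩
            ∑ Heavy (λ ib → ∑ Ys (λ y → ∑ Heavy (λ ib′ → 𝟙 (quot? ib y) ℕ.* 𝟙 (quot? ib′ y)))) ≡⟨ ∑-cong Heavy (λ _ → ∑-swap Ys Heavy _) ⟩
            ∑ Heavy (λ ib → ∑ Heavy (λ ib′ → ∑ Ys (λ y → 𝟙 (quot? ib y) ℕ.* 𝟙 (quot? ib′ y))))
              ≤⟨ ∑-mono Heavy (λ {ib} k → ∑-mono Heavy (λ {ib′} k′ → each k (cross? ib ib′))) ⟩
            ∑ Heavy (λ ib → count (cross? ib) Heavy) ≤⟨ ∑-mono Heavy (λ {ib} _ → ∑-Heavy≤ (λ ib′ → 𝟙 (cross? ib ib′))) ⟩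
            ∑ Heavy (λ ib → count (cross? ib) shifts) ≤⟨ ∑-Heavy≤ (λ ib → count (cross? ib) shifts) ⟩
            crossings ∎
            where
            each : ∀ {ib ib′} → ib ∈ Heavy → (dec : Dec (Cross ib ib′)) → ∑ Ys (λ y → 𝟙 (quot? ib y) ℕ.* 𝟙 (quot? ib′ y)) ℕ.≤ 𝟙 dec
            each {i , b} {i′ , b′} k dec = ℕ.≤-trans (ℕ.≤-reflexive (∑-cong Ys (λ {y} _ → sym (𝟙-× (quot? (i , b) y) (quot? (i′ , b′) y))))) (cases dec)
              where
              both? : ∀ y → Dec (Quot (i , b) y × Quot (i′ , b′) y)
              both? y = quot? (i , b) y ×-dec quot? (i′ , b′) y
              eqn : ∀ X X′ b b′ y → X * b′ - X′ * b ≡ - b′ * (b * y - X) + b * (b′ * y - X′)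
              eqn = solve-∀
              cases : (dec : Dec (Cross (i , b) (i′ , b′))) → count both? Ys ℕ.≤ 𝟙 dec
              cases (yes _) = count≤1 both? Ys-unique (λ {y} {y′} iy iy′ e e′ → Res-≈ (proj₁ (∈-Ys⁻ iy)) (proj₁ (∈-Ys⁻ iy′))
                (≈-cancelˡ b {y} {y′} (Pos≉0 B<p (proj₂ (proj₁ (∈-Heavy⁻ k)))) (≈-trans (proj₁ e) (≈-sym (proj₁ e′)))))
              cases (no ¬c) = ℕ.≤-reflexive (count-none both? Ys (λ {y} _ e → ¬c (lin₂ (proj₁ e) (proj₂ e) (- b′) b (eqn (x₀ + i) (x₀ + i′) b b′ y))))

      n″ : ℕ
      n″ = n′ ℕ.+ n′

      Exact : ℤ → ℤ → ℤ → ℤ → Set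
      Exact b b′ k l = k * b′ ≡ l * b

      exact? : ∀ b b′ k l → Dec (Exact b b′ k l)
      exact? b b′ k l = k * b′ ≟ l * b

      opaque
        -- For fixed b and b′, subtracting one solution removes x₀. The remaining congruence is
        -- between integers that differ by at most 4 n′ B < p, so it is an equality.
        crossings-fixed : ∀ {b b′} → b ∈ Pos B → b′ ∈ Pos B →
          ∑ (Box n′) (λ i → ∑ (Box n′) (λ i′ → 𝟙 (cross? (i , b) (i′ , b′)))) ℕ.≤
          ∑ (Box n″) (λ k → ∑ (Box n″) (λ l → 𝟙 (exact? b b′ k l)))
        crossings-fixed {b} {b′} ib ib′ = begin
          ∑ (Box n′) (λ i → ∑ (Box n′) (λ i′ → 𝟙 (cross? (i , b) (i′ , b′)))) ≡⟨ ∑-× (Box n′) (Box n′) (λ ii → 𝟙 (c? ii)) ⟨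
          count c? (Square n′) ≡⟨ length-filter≡count c? (Square n′) ⟨
          length (filter c? (Square n′)) ≤⟨ compare (length (filter c? (Square n′)) ℕ.≟ 0) ⟩
          length (filter e? (Square n″)) ≡⟨ length-filter≡count e? (Square n″) ⟩
          count e? (Square n″) ≡⟨ ∑-× (Box n″) (Box n″) (λ kl → 𝟙 (e? kl)) ⟩
          ∑ (Box n″) (λ k → ∑ (Box n″) (λ l → 𝟙 (exact? b b′ k l))) ∎
          where
          open ℕ.≤-Reasoning
          c? : ∀ ii → Dec (Cross (proj₁ ii , b) (proj₂ ii , b′))
          c? (i , i′) = cross? (i , b) (i′ , b′)
          e? : ∀ kl → Dec (Exact b b′ (proj₁ kl) (proj₂ kl))
          e? (k , l) = exact? b b′ k l
          ∈F⁻ : ∀ {i i′} → (i , i′) ∈ filter c? (Square n′) → (∣ i ∣ ℕ.≤ n′ × ∣ i′ ∣ ℕ.≤ n′) × Cross (i , b) (i′ , b′)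
          ∈F⁻ {i} {i′} k = let (k′ , h) = ∈-filter⁻ c? {xs = Square n′} k in ∈-Square⁻ {i} {i′} k′ , h
          compare : Dec (length (filter c? (Square n′)) ≡ 0) → length (filter c? (Square n′)) ℕ.≤ length (filter e? (Square n″))
          compare (yes e) = ℕ.≤-trans (ℕ.≤-reflexive e) z≤n
          compare (no ne) = based (nonempty (filter c? (Square n′)) (ℕ.n≢0⇒n>0 ne))
            where
            based : (∃ λ ii → ii ∈ filter c? (Square n′)) → length (filter c? (Square n′)) ℕ.≤ length (filter e? (Square n″))
            based ((i₀ , i₀′) , k₀) = left-unique-relation Rel (filter e? (Square n″)) (filter⁺ c? (Square-unique n′)) total uni
              where
              Rel : ℤ × ℤ → ℤ × ℤ → Set
              Rel (i , i′) (k , l) = i - i₀ ≡ k × i′ - i₀′ ≡ l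
              diff≤ : ∀ i j → ∣ i ∣ ℕ.≤ n′ → ∣ j ∣ ℕ.≤ n′ → ∣ i - j ∣ ℕ.≤ n″
              diff≤ i j hi hj = ℕ.≤-trans (∣i-j∣≤∣i∣+∣j∣ i j) (ℕ.+-mono-≤ hi hj)
              eqn : ∀ x₀ i i′ i₀ i₀′ b b′ → (i - i₀) * b′ - (i′ - i₀′) * b ≡
                1ℤ * ((x₀ + i) * b′ - (x₀ + i′) * b) + -1ℤ * ((x₀ + i₀) * b′ - (x₀ + i₀′) * b)
              eqn = solve-∀
              total : ∀ {ii} → ii ∈ filter c? (Square n′) → ∃ λ kl → kl ∈ filter e? (Square n″) × Rel ii kl
              total {i , i′} k =
                let ((hi , hi′) , c) = ∈F⁻ k
                    ((hi₀ , hi₀′) , c₀) = ∈F⁻ k₀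
                in (i - i₀ , i′ - i₀′) , ∈-filter⁺ e? (∈-Square⁺ {i - i₀} {i′ - i₀′} (diff≤ i i₀ hi hi₀) (diff≤ i′ i₀′ hi′ hi₀′))
                     (small≈ (ℕ.≤-<-trans (small i i₀ i′ i₀′ hi hi₀ hi′ hi₀′) 4n′B<p) (lin₂ c c₀ 1ℤ -1ℤ (eqn x₀ i i′ i₀ i₀′ b b′))) , refl , refl
                where
                eqn′ : ∀ n B → (n ℕ.+ n) ℕ.* B ℕ.+ (n ℕ.+ n) ℕ.* B ≡ 4 ℕ.* n ℕ.* B
                eqn′ = ℕ.solve-∀
                small : ∀ i i₀ i′ i₀′ → ∣ i ∣ ℕ.≤ n′ → ∣ i₀ ∣ ℕ.≤ n′ → ∣ i′ ∣ ℕ.≤ n′ → ∣ i₀′ ∣ ℕ.≤ n′ →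
                  ∣ (i - i₀) * b′ - (i′ - i₀′) * b ∣ ℕ.≤ 4 ℕ.* n′ ℕ.* B
                small i i₀ i′ i₀′ hi hi₀ hi′ hi₀′ = begin
                  ∣ (i - i₀) * b′ - (i′ - i₀′) * b ∣ ≤⟨ ∣i-j∣≤∣i∣+∣j∣ ((i - i₀) * b′) ((i′ - i₀′) * b) ⟩
                  ∣ (i - i₀) * b′ ∣ ℕ.+ ∣ (i′ - i₀′) * b ∣ ≡⟨ cong₂ ℕ._+_ (abs-* (i - i₀) b′) (abs-* (i′ - i₀′) b) ⟩
                  ∣ i - i₀ ∣ ℕ.* ∣ b′ ∣ ℕ.+ ∣ i′ - i₀′ ∣ ℕ.* ∣ b ∣
                    ≤⟨ ℕ.+-mono-≤ (ℕ.*-mono-≤ (diff≤ i i₀ hi hi₀) (Pos-abs ib′)) (ℕ.*-mono-≤ (diff≤ i′ i₀′ hi′ hi₀′) (Pos-abs ib)) ⟩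
                  n″ ℕ.* B ℕ.+ n″ ℕ.* B ≡⟨ eqn′ n′ B ⟩
                  4 ℕ.* n′ ℕ.* B ∎
              uni : ∀ {ii ii′} kl → ii ∈ filter c? (Square n′) → ii′ ∈ filter c? (Square n′) → Rel ii kl → Rel ii′ kl → ii ≡ ii′
              uni {i , i′} {j , j′} _ _ _ (e , e′) (f , f′) =
                cong₂ _,_ (minus-cancelʳ i₀ (trans e (sym f))) (minus-cancelʳ i₀′ (trans e′ (sym f′)))

      opaque
        -- For k ≠ 0, l is one of the few divisors of k b′ and determines b. For k = 0, each b
        -- leaves at most one l.
        factorings : ∀ {b′ k} → b′ ∈ Pos B → k ∈ Box n″ →
          ∑ (Pos B) (λ b → ∑ (Box n″) (λ l → 𝟙 (exact? b b′ k l))) ℕ.≤ 𝟙 (k ≟ 0ℤ) ℕ.* B ℕ.+ D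
        factorings {b′} {k} ib′ ik = cases (k ≟ 0ℤ)
          where
          open ℕ.≤-Reasoning
          cases : (dec : Dec (k ≡ 0ℤ)) → ∑ (Pos B) (λ b → ∑ (Box n″) (λ l → 𝟙 (exact? b b′ k l))) ℕ.≤ 𝟙 dec ℕ.* B ℕ.+ D
          cases (yes _) = begin
            ∑ (Pos B) (λ b → ∑ (Box n″) (λ l → 𝟙 (exact? b b′ k l)))
              ≤⟨ ∑-bound (Pos B) 1 (λ {b} ib → count≤1 (exact? b b′ k) (Box-unique n″)
                   (λ {l} {l′} _ _ e e′ → *-cancelʳ-≡ l l′ b {{≢-nonZero (Pos≢0 ib)}} (trans (sym e) e′))) ⟩
            length (Pos B) ℕ.* 1 ≡⟨ trans (ℕ.*-identityʳ (length (Pos B))) (length-Pos B) ⟩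
            B ≡⟨ ℕ.*-identityˡ B ⟨
            1 ℕ.* B ≤⟨ ℕ.m≤m+n (1 ℕ.* B) D ⟩
            1 ℕ.* B ℕ.+ D ∎
          cases (no k≢0) = begin
            ∑ (Pos B) (λ b → ∑ (Box n″) (λ l → 𝟙 (exact? b b′ k l))) ≡⟨ ∑-× (Pos B) (Box n″) (λ bl → 𝟙 (e? bl)) ⟨
            count e? (cartesianProduct (Pos B) (Box n″)) ≡⟨ length-filter≡count e? (cartesianProduct (Pos B) (Box n″)) ⟨
            length (filter e? (cartesianProduct (Pos B) (Box n″)))
              ≤⟨ left-unique-relation (λ bl z → proj₂ bl ≡ z) (divisorsℤ (k * b′)) (filter⁺ e? (cartesianProduct⁺ (Pos-unique B) (Box-unique n″))) total uni ⟩
            length (divisorsℤ (k * b′)) ≡⟨ length-divisorsℤ (k * b′) ⟩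
            τ ∣ k * b′ ∣ ℕ.+ τ ∣ k * b′ ∣ ≤⟨ few-divisors ∣ k * b′ ∣ {{ℕ.≢-nonZero (λ e → kb′≢0 (∣i∣≡0⇒i≡0 e))}} kb′≤ ⟩
            D ∎
            where
            e? : ∀ bl → Dec (Exact (proj₁ bl) b′ k (proj₂ bl))
            e? (b , l) = exact? b b′ k l
            kb′≢0 : k * b′ ≢ 0ℤ
            kb′≢0 e with i*j≡0⇒i≡0∨j≡0 k e
            ... | inj₁ z = k≢0 z
            ... | inj₂ z = Pos≢0 ib′ z
            eqn′ : ∀ n B → (n ℕ.+ n) ℕ.* B ≡ 2 ℕ.* n ℕ.* B
            eqn′ = ℕ.solve-∀
            kb′≤ : ∣ k * b′ ∣ ℕ.≤ 2 ℕ.* n′ ℕ.* B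
            kb′≤ = ℕ.≤-trans (ℕ.≤-reflexive (abs-* k b′))
              (ℕ.≤-trans (ℕ.*-mono-≤ (∈-Box⁻ {k} ik) (Pos-abs ib′)) (ℕ.≤-reflexive (eqn′ n′ B)))
            F : List (ℤ × ℤ)
            F = filter e? (cartesianProduct (Pos B) (Box n″))
            ∈F⁻ : ∀ {b l} → (b , l) ∈ F → b ∈ Pos B × Exact b b′ k l
            ∈F⁻ i = let (j , e) = ∈-filter⁻ e? {xs = cartesianProduct (Pos B) (Box n″)} i in proj₁ (∈-cartesianProduct⁻ (Pos B) (Box n″) j) , e
            total : ∀ {bl} → bl ∈ F → ∃ λ z → z ∈ divisorsℤ (k * b′) × proj₂ bl ≡ z
            total {b , l} i = l , ∈-divisorsℤ l b (sym (proj₂ (∈F⁻ i))) kb′≢0 , refl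
            uni : ∀ {bl bl′} z → bl ∈ F → bl′ ∈ F → proj₂ bl ≡ z → proj₂ bl′ ≡ z → bl ≡ bl′
            uni {b , l} {b₁ , .l} .l i i₁ refl refl = cong (_, l) (*-cancelˡ-≡ l b b₁ {{≢-nonZero l≢0}}
                (trans (sym (proj₂ (∈F⁻ i))) (proj₂ (∈F⁻ i₁))))
              where
              l≢0 : l ≢ 0ℤ
              l≢0 refl = kb′≢0 (trans (proj₂ (∈F⁻ i)) (*-zeroˡ b))

      opaque
        crossings≤ : crossings ℕ.≤ B ℕ.* (B ℕ.+ suc (n″ ℕ.+ n″) ℕ.* D)
        crossings≤ = begin
          crossings ≡⟨ ∑-× (Box n′) (Pos B) (λ ib → count (cross? ib) shifts) ⟩
          ∑ (Box n′) (λ i → ∑ (Pos B) (λ b → count (cross? (i , b)) shifts))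
            ≡⟨ ∑-cong (Box n′) (λ {i} _ → ∑-cong (Pos B) (λ {b} _ → ∑-× (Box n′) (Pos B) (λ ib′ → 𝟙 (cross? (i , b) ib′)))) ⟩
          ∑ (Box n′) (λ i → ∑ (Pos B) (λ b → ∑ (Box n′) (λ i′ → ∑ (Pos B) (λ b′ → X b b′ i i′)))) ≡⟨ ∑-swap (Box n′) (Pos B) _ ⟩
          ∑ (Pos B) (λ b → ∑ (Box n′) (λ i → ∑ (Box n′) (λ i′ → ∑ (Pos B) (λ b′ → X b b′ i i′))))
            ≡⟨ ∑-cong (Pos B) (λ {b} _ → ∑-cong (Box n′) (λ {i} _ → ∑-swap (Box n′) (Pos B) (λ i′ b′ → X b b′ i i′))) ⟩
          ∑ (Pos B) (λ b → ∑ (Box n′) (λ i → ∑ (Pos B) (λ b′ → ∑ (Box n′) (λ i′ → X b b′ i i′))))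
            ≡⟨ ∑-cong (Pos B) (λ {b} _ → ∑-swap (Box n′) (Pos B) (λ i b′ → ∑ (Box n′) (λ i′ → X b b′ i i′))) ⟩
          ∑ (Pos B) (λ b → ∑ (Pos B) (λ b′ → ∑ (Box n′) (λ i → ∑ (Box n′) (λ i′ → X b b′ i i′))))
            ≤⟨ ∑-mono (Pos B) (λ ib → ∑-mono (Pos B) (λ ib′ → crossings-fixed ib ib′)) ⟩
          ∑ (Pos B) (λ b → ∑ (Pos B) (λ b′ → ∑ (Box n″) (λ k → ∑ (Box n″) (λ l → E b b′ k l)))) ≡⟨ ∑-swap (Pos B) (Pos B) _ ⟩
          ∑ (Pos B) (λ b′ → ∑ (Pos B) (λ b → ∑ (Box n″) (λ k → ∑ (Box n″) (λ l → E b b′ k l))))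
            ≡⟨ ∑-cong (Pos B) (λ {b′} _ → ∑-swap (Pos B) (Box n″) (λ b k → ∑ (Box n″) (λ l → E b b′ k l))) ⟩
          ∑ (Pos B) (λ b′ → ∑ (Box n″) (λ k → ∑ (Pos B) (λ b → ∑ (Box n″) (λ l → E b b′ k l))))
            ≤⟨ ∑-mono (Pos B) (λ ib′ → ∑-mono (Box n″) (λ ik → factorings ib′ ik)) ⟩
          ∑ (Pos B) (λ b′ → ∑ (Box n″) (λ k → 𝟙 (k ≟ 0ℤ) ℕ.* B ℕ.+ D)) ≤⟨ ∑-bound (Pos B) (B ℕ.+ suc (n″ ℕ.+ n″) ℕ.* D) (λ _ → inner) ⟩
          length (Pos B) ℕ.* (B ℕ.+ suc (n″ ℕ.+ n″) ℕ.* D) ≡⟨ cong (ℕ._* (B ℕ.+ suc (n″ ℕ.+ n″) ℕ.* D)) (length-Pos B) ⟩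
          B ℕ.* (B ℕ.+ suc (n″ ℕ.+ n″) ℕ.* D) ∎
          where
          open ℕ.≤-Reasoning
          X : ℤ → ℤ → ℤ → ℤ → ℕ
          X b b′ i i′ = 𝟙 (cross? (i , b) (i′ , b′))
          E : ℤ → ℤ → ℤ → ℤ → ℕ
          E b b′ k l = 𝟙 (exact? b b′ k l)
          inner : ∑ (Box n″) (λ k → 𝟙 (k ≟ 0ℤ) ℕ.* B ℕ.+ D) ℕ.≤ B ℕ.+ suc (n″ ℕ.+ n″) ℕ.* D
          inner = begin
            ∑ (Box n″) (λ k → 𝟙 (k ≟ 0ℤ) ℕ.* B ℕ.+ D) ≡⟨ ∑-+ (Box n″) (λ k → 𝟙 (k ≟ 0ℤ) ℕ.* B) (λ _ → D) ⟩
            ∑ (Box n″) (λ k → 𝟙 (k ≟ 0ℤ) ℕ.* B) ℕ.+ ∑ (Box n″) (λ _ → D)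
              ≡⟨ cong₂ ℕ._+_ (∑-*ʳ (Box n″) B (λ k → 𝟙 (k ≟ 0ℤ))) (trans (∑-const (Box n″) D) (cong (ℕ._* D) (length-Box n″))) ⟩
            count (_≟ 0ℤ) (Box n″) ℕ.* B ℕ.+ suc (n″ ℕ.+ n″) ℕ.* D
              ≤⟨ ℕ.+-monoˡ-≤ _ (ℕ.*-monoˡ-≤ B (count≤1 (_≟ 0ℤ) (Box-unique n″) (λ _ _ e e′ → trans e (sym e′)))) ⟩
            1 ℕ.* B ℕ.+ suc (n″ ℕ.+ n″) ℕ.* D ≡⟨ cong (ℕ._+ suc (n″ ℕ.+ n″) ℕ.* D) (ℕ.*-identityˡ B) ⟩
            B ℕ.+ suc (n″ ℕ.+ n″) ℕ.* D ∎

      opaque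
        -- Every y is charged to a triple of distinct c with y + c in one coset, and each triple can
        -- take at most `f` of them.
        Ys≤ : length Ys ℕ.≤ C ℕ.* (C ℕ.* C) ℕ.* f
        Ys≤ = begin
          length Ys ≤⟨ total-relation sameCoset? Ys triples total ⟩
          ∑ triples (λ abc → count (λ y → sameCoset? y abc) Ys) ≤⟨ ∑-bound triples f each ⟩
          length triples ℕ.* f ≡⟨ cong (ℕ._* f) (trans (length-× (Pos C) (cartesianProduct (Pos C) (Pos C)))
              (cong₂ ℕ._*_ (length-Pos C) (trans (length-× (Pos C) (Pos C)) (cong₂ ℕ._*_ (length-Pos C) (length-Pos C))))) ⟩
          C ℕ.* (C ℕ.* C) ℕ.* f ∎
          where
          open ℕ.≤-Reasoning
          each : ∀ {abc} → abc ∈ triples → count (λ y → sameCoset? y abc) Ys ℕ.≤ f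
          each {abc} i = ℕ.≤-trans (ℕ.≤-trans (ℕ.≤-reflexive (sym (length-filter≡count (λ y → sameCoset? y abc) Ys)))
              (ℕ.≤-trans (left-unique-relation _≡_ (filter (λ y → sameCoset? y abc) Res) (filter⁺ (λ y → sameCoset? y abc) Ys-unique)
                (λ {y} k → let (k′ , h) = ∈-filter⁻ (λ y → sameCoset? y abc) {xs = Ys} k in y , ∈-filter⁺ (λ y → sameCoset? y abc) (proj₁ (∈-Ys⁻ k′)) h , refl)
                (λ _ _ _ e e′ → trans e (sym e′)))
              (ℕ.≤-reflexive (length-filter≡count (λ y → sameCoset? y abc) Res)))) (coset-triples-bound i)
          total : ∀ {y} → y ∈ Ys → ∃ λ abc → abc ∈ triples × SameCoset y abc
          total {y} iy =
            let ((i , b) , k , e) = find (proj₂ (∈-Ys⁻ iy))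
                ((_ , ib) , h) = ∈-Heavy⁻ k
                (c₁ , c₂ , c₃ , (i₁ , h₁) , (i₂ , h₂) , (i₃ , h₃) , ne) = three-distinct (λ c → inA? (shift (i , b) c)) (Pos-unique C) h
                (a₁ , j₁ , e₁) = find h₁
                (a₂ , j₂ , e₂) = find h₂
                (a₃ , j₃ , e₃) = find h₃
            in (c₁ , c₂ , c₃) , ∈-cartesianProduct⁺ i₁ (∈-cartesianProduct⁺ i₂ i₃) , ne ,
               *≉0⁻ʳ b {y + c₃} (≉0-resp (moved i b c₃ e e₃) (unit j₃)) ,
               same b c₁ c₃ (Pos≉0 B<p ib) (moved i b c₁ e e₁) (moved i b c₃ e e₃) (coset j₁ j₃) ,
               same b c₂ c₃ (Pos≉0 B<p ib) (moved i b c₂ e e₂) (moved i b c₃ e e₃) (coset j₂ j₃)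
            where
            moved : ∀ (i b c : ℤ) {a} → b * y ≈ x₀ + i → a ≈ x₀ + i + b * c → a ≈ b * (y + c)
            moved i b c {a} e f = a ≈⟨ f ⟩ x₀ + i + b * c ≈⟨ ≈-+ (≈-sym e) (≈-refl {b * c}) ⟩ b * y + b * c ≡⟨ sym (*-distribˡ-+ b y c) ⟩≈ b * (y + c) ≈∎
            same : ∀ b c c′ {a a′} → b ≉ 0ℤ → a ≈ b * (y + c) → a′ ≈ b * (y + c′) → a ^ d ≈ a′ ^ d → (y + c) ^ d ≈ (y + c′) ^ d
            same b c c′ {a} {a′} b≉0 e e′ f = ≈-cancelˡ (b ^ d) {(y + c) ^ d} {(y + c′) ^ d} (^≉0 d b≉0) (
              b ^ d * (y + c) ^ d ≡⟨ sym (^-distribʳ-*ℤ d b (y + c)) ⟩≈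
              (b * (y + c)) ^ d ≈⟨ ≈-^ d (≈-sym e) ⟩ a ^ d ≈⟨ f ⟩ a′ ^ d ≈⟨ ≈-^ d e′ ⟩
              (b * (y + c′)) ^ d ≡⟨ ^-distribʳ-*ℤ d b (y + c′) ⟩≈
              b ^ d * (y + c′) ^ d ≈∎)

      opaque
        burgess : ∃ λ X → B ℕ.* (T ℕ.* C) ℕ.≤ suc (n′ ℕ.+ n′) ℕ.* B ℕ.* 3 ℕ.+ X ℕ.* C ×
          X ℕ.* X ℕ.≤ C ℕ.* (C ℕ.* C) ℕ.* f ℕ.* (B ℕ.* (B ℕ.+ suc (n″ ℕ.+ n″) ℕ.* D))
        burgess = length Heavy , many-heavy , ℕ.≤-trans heavy²≤ (ℕ.*-mono-≤ Ys≤ crossings≤)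

-- From rational endpoints to integer inequalities.

module Bridge where

  open import Defs
  import Data.Nat.Properties as ℕ
  open import Data.Integer as ℤ using (ℤ; +_; 1ℤ; -1ℤ)
  import Data.Integer.Properties as ℤ
  open import Data.Integer.Tactic.RingSolver using (solve-∀)
  open import Data.Rational as ℚ using (ℚ; _/_; 1ℚ)
  import Data.Rational.Properties as ℚ
  open import Data.Rational.Unnormalised as ℚᵘ using (ℚᵘ; mkℚᵘ; ↥_; ↧_)
  import Data.Rational.Unnormalised.Properties as ℚᵘ

  opaque
    -- Eliminating L gives x - y ≤ p / d - 1 with d = e + 1. The 1, from the left endpoint L + 1, is
    -- what later makes d n smaller than p.
    spread : ∀ e p x y L → (L ℚ.+ 1ℚ) ℚ.≤ ℕ→ℚ y → ℕ→ℚ x ℚ.≤ (L ℚ.+ (+ p) / suc e) →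
      suc e ℕ.* x ℕ.+ suc e ℕ.≤ suc e ℕ.* y ℕ.+ p
    spread e p x y L hy hx = ℤ.drop‿+≤+ (subst₂ ℤ._≤_ (sym lhs) (sym rhs) shifted)
      where
      N : ℚ
      N = (+ p) / suc e
      cancel-one : L ℚ.+ 1ℚ ℚ.+ ℚ.- 1ℚ ≡ L
      cancel-one = trans (ℚ.+-assoc L 1ℚ (ℚ.- 1ℚ)) (trans (cong (L ℚ.+_) (ℚ.+-inverseʳ 1ℚ)) (ℚ.+-identityʳ L))
      inℚ : ℕ→ℚ x ℚ.≤ ℕ→ℚ y ℚ.+ ℚ.- 1ℚ ℚ.+ N
      inℚ = ℚ.≤-trans hx (ℚ.+-monoˡ-≤ N (subst (ℚ._≤ ℕ→ℚ y ℚ.+ ℚ.- 1ℚ) cancel-one (ℚ.+-monoˡ-≤ (ℚ.- 1ℚ) hy)))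
      yᵘ Nᵘ sumᵘ : ℚᵘ
      yᵘ = mkℚᵘ (+ y) 0 ℚᵘ.+ mkℚᵘ -1ℤ 0
      Nᵘ = mkℚᵘ (+ p) e
      sumᵘ = yᵘ ℚᵘ.+ Nᵘ
      inℚᵘ : mkℚᵘ (+ x) 0 ℚᵘ.≤ sumᵘ
      inℚᵘ = ℚᵘ.≤-trans (ℚᵘ.≤-reflexive (ℚᵘ.≃-sym (ℚ.toℚᵘ-fromℚᵘ (mkℚᵘ (+ x) 0))))
        (ℚᵘ.≤-trans (ℚ.toℚᵘ-mono-≤ inℚ) (ℚᵘ.≤-reflexive
          (ℚᵘ.≃-trans (ℚ.toℚᵘ-homo-+ (ℕ→ℚ y ℚ.+ ℚ.- 1ℚ) N)
            (ℚᵘ.+-cong (ℚᵘ.≃-trans (ℚ.toℚᵘ-homo-+ (ℕ→ℚ y) (ℚ.- 1ℚ))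
                          (ℚᵘ.+-cong (ℚ.toℚᵘ-fromℚᵘ (mkℚᵘ (+ y) 0)) ℚᵘ.≃-refl))
                       (ℚ.toℚᵘ-fromℚᵘ (mkℚᵘ (+ p) e))))))
      D : ℤ
      D = + suc e
      cleared : + x ℤ.* (↧ sumᵘ) ℤ.≤ (↥ sumᵘ) ℤ.* 1ℤ
      cleared = ℚᵘ.drop-*≤* inℚᵘ
      num : (↥ sumᵘ) ℤ.* 1ℤ ≡ (+ y ℤ.+ -1ℤ) ℤ.* D ℤ.+ + p
      num = trans (ℤ.*-identityʳ _) (cong₂ ℤ._+_ (cong (ℤ._* D) (cong₂ ℤ._+_ (ℤ.*-identityʳ (+ y)) refl)) (ℤ.*-identityʳ (+ p)))
      den : + x ℤ.* (↧ sumᵘ) ≡ + x ℤ.* D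
      den = cong (λ k → + x ℤ.* + k) (ℕ.*-identityˡ (suc e))
      lhs : + (suc e ℕ.* x ℕ.+ suc e) ≡ + x ℤ.* D ℤ.+ D
      lhs = cong (ℤ._+ D) (trans (ℤ.pos-* (suc e) x) (ℤ.*-comm D (+ x)))
      rhs : + (suc e ℕ.* y ℕ.+ p) ≡ (+ y ℤ.+ -1ℤ) ℤ.* D ℤ.+ + p ℤ.+ D
      rhs = trans (cong (ℤ._+ + p) (ℤ.pos-* (suc e) y)) (eqn (+ y) D (+ p))
        where
        eqn : ∀ y D p → D ℤ.* y ℤ.+ p ≡ (y ℤ.+ -1ℤ) ℤ.* D ℤ.+ p ℤ.+ D
        eqn = solve-∀
      shifted : + x ℤ.* D ℤ.+ D ℤ.≤ (+ y ℤ.+ -1ℤ) ℤ.* D ℤ.+ + p ℤ.+ D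
      shifted = ℤ.+-monoˡ-≤ D (subst₂ ℤ._≤_ den num cleared)

-- Calculus of exponents to a common base, and the divisor bound in it.

module Powers where

  open Counting using (^-distribʳ-*)
  open Divisor using (τ; divisor-bound)
  open import Data.Nat
  open import Data.Nat.Properties
  open import Data.Bool using (T)
  open import Data.Nat.Tactic.RingSolver using (solve-∀)

  -- Opaque, so that the large numeral exponents below are never unfolded.
  opaque
    pow : ℕ → ℕ → ℕ
    pow q e = q ^ e

    pow-def : ∀ q e → pow q e ≡ q ^ e
    pow-def q e = refl

    pow-+ : ∀ q a b → pow q a * pow q b ≡ pow q (a + b)
    pow-+ q a b = sym (^-distribˡ-+-* q a b)

    pow-^ : ∀ q a e → pow q a ^ e ≡ pow q (a * e)
    pow-^ q a e = ^-*-assoc q a e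

    pow-1 : ∀ q → pow q 1 ≡ q
    pow-1 q = *-identityʳ q

    pow-mono : ∀ {q a b} → 1 ≤ q → a ≤ b → pow q a ≤ pow q b
    pow-mono {q} 1≤q = ^-monoʳ-≤ q {{>-nonZero 1≤q}}

    pow-mono-< : ∀ {q a b} → 2 ≤ q → a < b → pow q a < pow q b
    pow-mono-< {q} 2≤q = ^-monoʳ-< q 2≤q

    pow>0 : ∀ {q} a → 1 ≤ q → 1 ≤ pow q a
    pow>0 {q} a 1≤q = m^n>0 q {{>-nonZero 1≤q}} a

  module Bounds {q : ℕ} (2≤q : 2 ≤ q) where

    1≤q : 1 ≤ q
    1≤q = ≤-trans (s≤s z≤n) 2≤q

    pow≢0 : ∀ a → NonZero (pow q a)
    pow≢0 a = >-nonZero (pow>0 a 1≤q)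

    mul≤ : ∀ {x y} a b → x ≤ pow q a → y ≤ pow q b → x * y ≤ pow q (a + b)
    mul≤ a b h k = ≤-trans (*-mono-≤ h k) (≤-reflexive (pow-+ q a b))

    mul≥ : ∀ {x y} a b → pow q a ≤ x → pow q b ≤ y → pow q (a + b) ≤ x * y
    mul≥ a b h k = ≤-trans (≤-reflexive (sym (pow-+ q a b))) (*-mono-≤ h k)

    power≤ : ∀ e {x} a → x ≤ pow q a → x ^ e ≤ pow q (a * e)
    power≤ e a h = ≤-trans (^-monoˡ-≤ e h) (≤-reflexive (pow-^ q a e))

    power≥ : ∀ e {x} a → pow q a ≤ x → pow q (a * e) ≤ x ^ e
    power≥ e a h = ≤-trans (≤-reflexive (sym (pow-^ q a e))) (^-monoˡ-≤ e h)

    -- The comparison of the numerals is a Boolean computation, so its proof is filled in as an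
    -- implicit argument; likewise in `clash`.
    weaken : ∀ {x} a b {_ : T (a ≤ᵇ b)} → x ≤ pow q a → x ≤ pow q b
    weaken a b {le} h = ≤-trans h (pow-mono 1≤q (≤ᵇ⇒≤ a b le))

    add≤ : ∀ {x y} a → x ≤ pow q a → y ≤ pow q a → x + y ≤ pow q (1 + a)
    add≤ {x} {y} a h k = begin
      x + y ≤⟨ +-mono-≤ h k ⟩
      pow q a + pow q a ≡⟨ cong (pow q a +_) (+-identityʳ (pow q a)) ⟨
      2 * pow q a ≤⟨ *-monoˡ-≤ (pow q a) 2≤q ⟩
      q * pow q a ≡⟨ cong (_* pow q a) (pow-1 q) ⟨
      pow q 1 * pow q a ≡⟨ pow-+ q 1 a ⟩
      pow q (1 + a) ∎
      where open ≤-Reasoning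

    base≤ : ∀ {x} → x ≤ q → x ≤ pow q 1
    base≤ h = ≤-trans h (≤-reflexive (sym (pow-1 q)))

    clash : ∀ {x} a b {_ : T (b <ᵇ a)} → pow q a ≤ x → x ≤ pow q b → ⊥
    clash a b {lt} h k = <⇒≱ (pow-mono-< 2≤q (<ᵇ⇒< b a lt)) (≤-trans h k)

    cancel : ∀ {x y} a b → pow q a ≤ y → y * x ≤ pow q (a + b) → x ≤ pow q b
    cancel {x} {y} a b hy h = *-cancelˡ-≤ (pow q a) {{pow≢0 a}}
      (≤-trans (*-monoˡ-≤ x hy) (≤-trans h (≤-reflexive (sym (pow-+ q a b)))))

    root≤ : ∀ e {x} a → x ^ suc e ≤ pow q (a * suc e) → x ≤ pow q a
    root≤ e {x} a h = ≮⇒≥ (λ lt → <⇒≱ (^-monoˡ-< (suc e) lt) (≤-trans h (≤-reflexive (sym (pow-^ q a (suc e))))))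

  opaque
    integer-root : ∀ e p → ∃ λ q → q ^ suc e ≤ p × p < suc q ^ suc e
    integer-root e p = search p (n<n^ p)
      where
      n<n^ : ∀ p → p < suc p ^ suc e
      n<n^ p = ≤-trans (≤-reflexive (sym (*-identityʳ (suc p)))) (*-monoʳ-≤ (suc p) (m^n>0 (suc p) e))
      search : ∀ k → p < suc k ^ suc e → ∃ λ q → q ^ suc e ≤ p × p < suc q ^ suc e
      search zero h = 0 , z≤n , h
      search (suc k) h with suc k ^ suc e ≤? p
      ... | yes le = suc k , le , h
      ... | no ≰ = search k (≰⇒> ≰)

  opaque
    -- From τ(n)^k ≤ C q^(2K) follows (4 τ(n)²)^k ≤ 4^k C² q^(4K). With k = 4 K + 1, one factor q is
    -- left to pay for 4^k C², so 2 τ(n) is at most the integer square root `D` of q.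
    few-divisors : ∀ K → ∃ λ Q → ∀ q → Q ≤ q → 1 ≤ q → ∃ λ D → D * D ≤ q ×
      (∀ n .{{_ : NonZero n}} → n ≤ pow q K * pow q K → τ n + τ n ≤ D)
    few-divisors K = 4 ^ k * (C * C) , result
      where
      k C : ℕ
      k = suc (4 * K)
      C = proj₁ (divisor-bound k)
      result : ∀ q → 4 ^ k * (C * C) ≤ q → 1 ≤ q → ∃ λ D → D * D ≤ q × (∀ n .{{_ : NonZero n}} → n ≤ pow q K * pow q K → τ n + τ n ≤ D)
      result q Q≤q 1≤q with integer-root 1 q
      ... | D , lo , hi = D , subst (_≤ q) (cong (D *_) (*-identityʳ D)) lo , bound
        where
        bound : ∀ n .{{_ : NonZero n}} → n ≤ pow q K * pow q K → τ n + τ n ≤ D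
        bound n n≤ = ≮⇒≥ (λ D<2τ → <⇒≱ hi (≤-trans (^-monoˡ-≤ 2 D<2τ)
            (≮⇒≥ (λ q< → <⇒≱ (^-monoˡ-< k q<) (begin
              ((τ n + τ n) ^ 2) ^ k ≡⟨ cong (_^ k) (eqn (τ n)) ⟩
              (4 * (τ n * τ n)) ^ k ≡⟨ ^-distribʳ-* k 4 (τ n * τ n) ⟩
              4 ^ k * (τ n * τ n) ^ k ≡⟨ cong (4 ^ k *_) (^-distribʳ-* k (τ n) (τ n)) ⟩
              4 ^ k * (τ n ^ k * τ n ^ k) ≤⟨ *-monoʳ-≤ (4 ^ k) (*-mono-≤ τᵏ≤ τᵏ≤) ⟩
              4 ^ k * (C * pow q (K + K) * (C * pow q (K + K))) ≡⟨ eqn′ (4 ^ k) C (pow q (K + K)) ⟩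
              4 ^ k * (C * C) * (pow q (K + K) * pow q (K + K)) ≤⟨ *-monoˡ-≤ _ Q≤q ⟩
              q * (pow q (K + K) * pow q (K + K)) ≡⟨ cong (q *_) (trans (pow-+ q (K + K) (K + K)) (trans (cong (pow q) (eqn″ K)) (pow-def q (4 * K)))) ⟩
              q ^ k ∎)))))
          where
          open ≤-Reasoning
          τᵏ≤ : τ n ^ k ≤ C * pow q (K + K)
          τᵏ≤ = ≤-trans (proj₂ (divisor-bound k) n) (*-monoʳ-≤ C (≤-trans n≤ (≤-reflexive (pow-+ q K K))))
          eqn : ∀ x → (x + x) * ((x + x) * 1) ≡ 4 * (x * x)
          eqn = solve-∀
          eqn′ : ∀ a c x → a * (c * x * (c * x)) ≡ a * (c * c) * (x * x)
          eqn′ = solve-∀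
          eqn″ : ∀ K → K + K + (K + K) ≡ 4 * K
          eqn″ = solve-∀

-- The contradiction in each range of t, in exponents of q.

module Final (p : ℕ) (pr : Prime p) (d : ℕ) .{{d≢0 : NonZero d}} where

  open import Data.Nat as ℕ using (ℕ; zero; suc; z≤n; s≤s; _≤_; _<_; _+_; _*_; _^_; NonZero)
  open Counting
  open Divisor using (τ)
  open Powers
  open Group p pr d using (t; H)
  open Lattice p pr using (nonempty)
  open Energy p pr d
  open Interval p pr d
  open Low p pr d
  open High p pr d using (burgess)
  open import Data.Nat.Properties
  open import Data.Integer using (ℤ)
  import Data.Bool
  open import Data.Nat.Tactic.RingSolver using (solve-∀)

  opaque
    energy : ∀ q R D → 2 ≤ q → p ≤ pow q (suc R) → D * D ≤ q →
      (∀ n .{{_ : NonZero n}} → n ≤ pow q (suc R) * pow q (suc R) → τ n + τ n ≤ D) → 36 * suc R ≤ q →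
      ∀ M → t * M ≤ 3 * p → 𝒥 M ≤ M * pow q 6 ⊎ p * 𝒥 M ^ 4 ≤ pow q 11 * M ^ 4 * t ^ 3
    energy q R D 2≤q p≤ D²≤ few 36≤ M tM≤ = subst₂ (λ a b → 𝒥 M ≤ M * a ⊎ p * 𝒥 M ^ 4 ≤ b * M ^ 4 * t ^ 3)
      (sym (pow-def q 6)) (sym (pow-def q 11))
      (Heights.energy-bound q R D 2≤q (subst (p ≤_) (pow-def q (suc R)) p≤) D²≤
        (λ n n≤ → few n (subst (λ x → n ≤ x * x) (sym (pow-def q (suc R))) n≤)) 36≤ M tM≤)

  module _ {q D : ℕ} (q-large : 1000000 ≤ q) (D²≤q : D * D ≤ q)
    (few : ∀ n .{{_ : NonZero n}} → n ≤ pow q 24001 * pow q 24001 → τ n + τ n ≤ D)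
    (p≥ : pow q 24000 ≤ p) (p≤ : p ≤ pow q 24001)
    {A : List ℤ} {n : ℕ} (hyp : CosetInInterval A n) (tn≤p : t * n ≤ p) where

    open CosetInInterval hyp using (second-moment; length≤t; length≤1+2n; n<p)
    open ≤-Reasoning

    2≤q : 2 ≤ q
    2≤q = ≤-trans (m≤m+n 2 999998) q-large

    open Bounds 2≤q

    ≤q : ∀ c {_ : Data.Bool.T (c ℕ.≤ᵇ 1000000)} → c ≤ pow q 1
    ≤q c {h} = base≤ (≤-trans (≤ᵇ⇒≤ c 1000000 h) q-large)

    en : ∀ M → t * M ≤ 3 * p → 𝒥 M ≤ M * pow q 6 ⊎ p * 𝒥 M ^ 4 ≤ pow q 11 * M ^ 4 * t ^ 3
    en = energy q 24000 D 2≤q p≤ D²≤q few (≤-trans (≤ᵇ⇒≤ (36 * 24001) 1000000 _) q-large)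

    module _ (T≥ : pow q 7999 ≤ length A) where

      opaque
        -- Out of T² ≥ q^15998, the bound on t leaves at least q^15997 for the energy. Multiplying
        -- either alternative of the energy bound by t turns the powers of n into powers of t n ≤ p
        -- and isolates t.
        middle : t ≤ pow q 15997 → t ≤ pow q 8026
        middle t≤ = cases (en n (≤-trans tn≤p (m≤n*m p 3)))
          where
          E : ℕ
          E = 𝒥 n
          E≥ : pow q 15997 ≤ E
          E≥ = ≮⇒≥ (λ E< → <⇒≱ (begin-strict
            t + E <⟨ +-mono-≤-< t≤ E< ⟩
            pow q 15997 + pow q 15997 ≤⟨ add≤ 15997 ≤-refl ≤-refl ⟩
            pow q 15998 ∎) (≤-trans (mul≥ 7999 7999 T≥ T≥) second-moment))
          cases : E ≤ n * pow q 6 ⊎ p * E ^ 4 ≤ pow q 11 * n ^ 4 * t ^ 3 → t ≤ pow q 8026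
          cases (inj₁ h) = weaken 8010 8026 (cancel 15997 8010 E≥ (begin
            E * t ≤⟨ *-monoˡ-≤ t h ⟩
            n * pow q 6 * t ≡⟨ eqn n (pow q 6) t ⟩
            t * n * pow q 6 ≤⟨ mul≤ 24001 6 (≤-trans tn≤p p≤) ≤-refl ⟩
            pow q 24007 ∎))
            where
            eqn : ∀ n x t → n * x * t ≡ t * n * x
            eqn = solve-∀
          cases (inj₂ h) = cancel 63988 8026 (power≥ 4 15997 E≥) (*-cancelˡ-≤ p {{p≢0}} (begin
            p * (E ^ 4 * t) ≡⟨ *-assoc p (E ^ 4) t ⟨
            p * E ^ 4 * t ≤⟨ *-monoˡ-≤ t h ⟩
            pow q 11 * n ^ 4 * t ^ 3 * t ≡⟨ eqn (pow q 11) n t ⟩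
            pow q 11 * (t * n) ^ 4 ≤⟨ *-monoʳ-≤ (pow q 11) (^-monoˡ-≤ 4 tn≤p) ⟩
            pow q 11 * p ^ 4 ≡⟨ eqn′ (pow q 11) p ⟩
            p * (pow q 11 * p ^ 3) ≤⟨ *-monoʳ-≤ p (mul≤ 11 72003 ≤-refl (power≤ 3 24001 p≤)) ⟩
            p * pow q 72014 ∎))
            where
            p≢0 : NonZero p
            p≢0 = ℕ.>-nonZero (≤-trans (pow>0 24000 1≤q) p≥)
            eqn : ∀ x n t → x * (n * (n * (n * (n * 1)))) * (t * (t * (t * 1))) * t ≡ x * (t * n * (t * n * (t * n * (t * n * 1))))
            eqn = solve-∀
            eqn′ : ∀ x p → x * (p * (p * (p * (p * 1)))) ≡ p * (x * (p * (p * (p * 1))))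
            eqn′ = solve-∀

      -- The size condition of the dependent random choice in exponents: either summand is at most a
      -- quarter of the right side, the 1 in each hypothesis paying for the factor 4.
      drc-size : ∀ {T t γ θ} e a b g ϑ → pow q a ≤ T → t ≤ pow q b → γ ≤ pow q g → θ ≤ pow q ϑ →
        b * e + g + 1 ≤ a * suc e → b * e + (b + (b + b + (b + b) + ϑ * suc e)) + 1 ≤ a * suc e + a * suc e →
        t ^ e * (T ^ suc e * γ + t * (t * t * (t * t) * θ ^ suc e)) < (T * T) ^ suc e
      drc-size {T} {t} {γ} {θ} e a b g ϑ hT ht hγ hθ h₁ h₂ = *-cancelˡ-< 4 _ _ (begin-strict
        4 * (t ^ e * (T ^ suc e * γ + t * (t * t * (t * t) * θ ^ suc e))) ≡⟨ eq₀ (t ^ e) (T ^ suc e) γ _ ⟩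
        4 * (T ^ suc e * (t ^ e * γ)) + 4 * (t ^ e * (t * (t * t * (t * t) * θ ^ suc e))) ≤⟨ +-mono-≤ first second ⟩
        Z + Z <⟨ m<m+n (Z + Z) (≤-trans Z>0 (m≤m+n Z Z)) ⟩
        Z + Z + (Z + Z) ≡⟨ eq₁ Z ⟩
        4 * Z ∎)
        where
        Z : ℕ
        Z = (T * T) ^ suc e
        Z≡ : T ^ suc e * T ^ suc e ≡ Z
        Z≡ = sym (^-distribʳ-* (suc e) T T)
        eq₀ : ∀ x y g z → 4 * (x * (y * g + z)) ≡ 4 * (y * (x * g)) + 4 * (x * z)
        eq₀ = solve-∀
        eq₁ : ∀ z → z + z + (z + z) ≡ 4 * z
        eq₁ = solve-∀
        eq₂ : ∀ x y → 4 * (x * y) ≡ x * (y * 4)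
        eq₂ = solve-∀
        Z≥ : pow q (a * suc e + a * suc e) ≤ Z
        Z≥ = ≤-trans (mul≥ (a * suc e) (a * suc e) (power≥ (suc e) a hT) (power≥ (suc e) a hT)) (≤-reflexive Z≡)
        Z>0 : 1 ≤ Z
        Z>0 = ≤-trans (pow>0 _ 1≤q) Z≥
        first : 4 * (T ^ suc e * (t ^ e * γ)) ≤ Z
        first = begin
          4 * (T ^ suc e * (t ^ e * γ)) ≡⟨ eq₂ (T ^ suc e) (t ^ e * γ) ⟩
          T ^ suc e * (t ^ e * γ * 4) ≤⟨ *-monoʳ-≤ (T ^ suc e) (mul≤ (b * e + g) 1 (mul≤ (b * e) g (power≤ e b ht) hγ) (≤q 4)) ⟩
          T ^ suc e * pow q (b * e + g + 1) ≤⟨ *-monoʳ-≤ (T ^ suc e) (≤-trans (pow-mono 1≤q h₁) (power≥ (suc e) a hT)) ⟩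
          T ^ suc e * T ^ suc e ≡⟨ Z≡ ⟩
          Z ∎
        second : 4 * (t ^ e * (t * (t * t * (t * t) * θ ^ suc e))) ≤ Z
        second = begin
          4 * (t ^ e * (t * (t * t * (t * t) * θ ^ suc e))) ≡⟨ *-comm 4 (t ^ e * (t * (t * t * (t * t) * θ ^ suc e))) ⟩
          t ^ e * (t * (t * t * (t * t) * θ ^ suc e)) * 4
            ≤⟨ mul≤ _ 1 (mul≤ (b * e) _ (power≤ e b ht) (mul≤ b _ ht (mul≤ (b + b + (b + b)) (ϑ * suc e) (mul≤ (b + b) (b + b) (mul≤ b b ht ht) (mul≤ b b ht ht)) (power≤ (suc e) ϑ hθ)))) (≤q 4) ⟩
          pow q (b * e + (b + (b + b + (b + b) + ϑ * suc e)) + 1) ≤⟨ pow-mono 1≤q h₂ ⟩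
          pow q (a * suc e + a * suc e) ≤⟨ Z≥ ⟩
          Z ∎

      opaque
        low : t ≤ pow q 8026 → ⊥
        -- 5999 is the largest exponent for γ with 4 · 5999 < 24000, which ensures |G|⁴ < p. Tuples
        -- of length 64 satisfy the first condition of `drc-size`, which amounts to 27 · 63 ≤ 1999,
        -- and 7470 is the largest exponent for θ that the second then admits.
        low t≤ = conclude (popular-set hyp 63 (pow q 5999) (pow q 7470)
            (drc-size 63 7999 8026 5999 7470 T≥ t≤ ≤-refl ≤-refl (≤ᵇ⇒≤ _ _ _) (≤ᵇ⇒≤ _ _ _)))
          where
          n≤ : n ≤ pow q 16002
          n≤ = cancel 7999 16002 (≤-trans T≥ length≤t) (≤-trans tn≤p p≤)
          3n≤ : 3 * n ≤ pow q 16003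
          3n≤ = mul≤ 1 16002 (≤q 3) n≤
          3n<p : 3 * n < p
          3n<p = ≤-<-trans 3n≤ (<-≤-trans (pow-mono-< 2≤q (<ᵇ⇒< 16003 24000 _)) p≥)
          t*3n≤ : t * (3 * n) ≤ 3 * p
          t*3n≤ = begin
            t * (3 * n) ≡⟨ eqn t n ⟩
            3 * (t * n) ≤⟨ *-monoʳ-≤ 3 tn≤p ⟩
            3 * p ∎
            where
            eqn : ∀ t n → t * (3 * n) ≡ 3 * (t * n)
            eqn = solve-∀
          E : ℕ
          E = 𝒥 (3 * n)
          E≤ : E ≤ pow q 16026
          E≤ = cases (en (3 * n) t*3n≤)
            where
            cases : E ≤ 3 * n * pow q 6 ⊎ p * E ^ 4 ≤ pow q 11 * (3 * n) ^ 4 * t ^ 3 → E ≤ pow q 16026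
            cases (inj₁ h) = weaken 16009 16026 (≤-trans h (mul≤ 16003 6 3n≤ ≤-refl))
            cases (inj₂ h) = root≤ 3 16026 (weaken 64101 64104 (cancel 24000 64101 p≥
              (≤-trans h (mul≤ 64023 24078 (mul≤ 11 64012 ≤-refl (power≤ 4 16003 3n≤)) (power≤ 3 8026 t≤)))))
          conclude : (∃ λ G → Unique G × (∀ {g} → g ∈ G → g ∈ H) × length G ≡ pow q 5999 × Popular hyp G (pow q 7470)) → ⊥
          -- θ⁴ γ² against t³ (t + E). With no losses this would be p^(11/6) against p^(5/3).
          conclude (G , G-unique , G⊆H , len , pop) = clash 41878 40105 lower upper
            where
            2≤G : 2 ≤ length G
            2≤G = ≤-trans 2≤q (≤-trans (≤-reflexive (sym (pow-1 q))) (≤-trans (pow-mono 1≤q (≤ᵇ⇒≤ 1 5999 _)) (≤-reflexive (sym len))))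
            G≤ : length G ≤ pow q 5999
            G≤ = ≤-reflexive len
            G≥ : pow q 5999 ≤ length G
            G≥ = ≤-reflexive (sym len)
            G⁴<p : length G * length G * (length G * length G) < p
            G⁴<p = ≤-<-trans (mul≤ 11998 11998 (mul≤ 5999 5999 G≤ G≤) (mul≤ 5999 5999 G≤ G≤)) (<-≤-trans (pow-mono-< 2≤q (<ᵇ⇒< 23996 24000 _)) p≥)
            a : ℕ
            a = pow q 7470 * pow q 7470 * length G
            a≥ : pow q 20939 ≤ a
            a≥ = mul≥ 14940 5999 (mul≥ 7470 7470 ≤-refl ≤-refl) G≥
            lower : pow q 41878 ≤ t * t * (t * (t + E))
            lower = ≤-trans (mul≥ 20939 20939 a≥ a≥)
              (pivot-bound hyp {G} {pow q 7470} G-unique G⊆H pop 2≤G G⁴<p (≤-trans (pow>0 7999 1≤q) T≥) 3n<p)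
            upper : t * t * (t * (t + E)) ≤ pow q 40105
            upper = mul≤ 16052 24053 (mul≤ 8026 8026 t≤ t≤) (mul≤ 8026 16027 t≤ (add≤ 16026 (weaken 8026 16026 t≤) E≤))

        high : pow q 15997 ≤ t → ⊥
        high t≥ = conclude (nonempty A (≤-trans (pow>0 7999 1≤q) T≥))
          where
          n≥ : pow q 7998 ≤ n
          n≥ = ≮⇒≥ (λ n< → <⇒≱ (begin-strict
            suc (n + n) <⟨ s≤s (≤-reflexive (sym (+-suc n n))) ⟩
            suc n + suc n ≤⟨ add≤ 7998 n< n< ⟩
            pow q 7999 ∎) (≤-trans T≥ length≤1+2n))
          t≤ : t ≤ pow q 16003
          t≤ = cancel 7998 16003 n≥ (≤-trans (≤-reflexive (*-comm n t)) (≤-trans tn≤p p≤))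
          n≤ : n ≤ pow q 8004
          n≤ = cancel 15997 8004 t≥ (≤-trans tn≤p p≤)
          -- `C` exceeds n′ / T ≤ q^6 by enough to make the mean weight, about T C / (2 n′), much
          -- larger than 3. `B` keeps B C = q^8000 below the bound q^8004 for n, so shifting hardly
          -- lengthens the interval. `f` is about p^(1/2), with f² ≥ 4 p even if p reaches q^24001.
          B C n′ f : ℕ
          B = pow q 7990
          C = pow q 10
          n′ = pow q 8005
          f = pow q 12002
          below-p : ∀ {x} a {_ : Data.Bool.T (a ℕ.<ᵇ 24000)} → x ≤ pow q a → x < p
          below-p a {h} x≤ = ≤-<-trans x≤ (<-≤-trans (pow-mono-< 2≤q (<ᵇ⇒< a 24000 h)) p≥)
          1≤t : 1 ≤ t
          1≤t = ≤-trans (pow>0 15997 1≤q) t≥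
          f-large : 2 * (t * t) ≤ p * f
          f-large = ≤-trans (weaken 32007 36002 (mul≤ 1 32006 (≤q 2) (mul≤ 16003 16003 t≤ t≤))) (mul≥ 24000 12002 p≥ ≤-refl)
          f²-large : 4 * p ≤ f * f
          f²-large = ≤-trans (weaken 24002 24004 (mul≤ 1 24001 (≤q 4) p≤)) (mul≥ 12002 12002 ≤-refl ≤-refl)
          n+BC≤ : n + B * C ≤ n′
          n+BC≤ = add≤ 8004 n≤ (weaken 8000 8004 (mul≤ 7990 10 ≤-refl ≤-refl))
          2n′B≤ : 2 * n′ * B ≤ pow q 24001 * pow q 24001
          2n′B≤ = ≤-trans (weaken 15996 48002 (mul≤ 8006 7990 (mul≤ 1 8005 (≤q 2) ≤-refl) ≤-refl)) (≤-reflexive (sym (pow-+ q 24001 24001)))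
          D≤ : D ≤ pow q 1
          D≤ = base≤ (≤-trans (D≤D² D) D²≤q)
            where
            D≤D² : ∀ D → D ≤ D * D
            D≤D² zero = z≤n
            D≤D² (suc D) = m≤m*n (suc D) (suc D)
          odd≤ : ∀ k a → k ≤ pow q a → suc (k + k) ≤ pow q (1 + a)
          odd≤ k a h = begin
            suc (k + k) ≡⟨ eqn k ⟩
            1 + 2 * k ≤⟨ +-mono-≤ (pow>0 a 1≤q) (*-monoʳ-≤ 2 h) ⟩
            3 * pow q a ≤⟨ mul≤ 1 a (≤q 3) ≤-refl ⟩
            pow q (1 + a) ∎
            where
            eqn : ∀ k → 1 + (k + k) ≡ 1 + 2 * k
            eqn = solve-∀
          conclude : (∃ λ x₀ → x₀ ∈ A) → ⊥
          conclude (x₀ , x₀∈A) = finish (burgess {C = C} {f = f} (below-p 11 (add≤ 10 ≤-refl ≤-refl)) 1≤t f-large f²-large hyp x₀∈A {B = B} {n′ = n′} {D = D}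
              n+BC≤ (below-p 15996 (mul≤ 8006 7990 (mul≤ 1 8005 (≤q 4) ≤-refl) ≤-refl)) (below-p 7990 ≤-refl)
              (λ k k≤ → few k (≤-trans k≤ 2n′B≤)))
            where
            finish : (∃ λ X → B * (length A * C) ≤ suc (n′ + n′) * B * 3 + X * C ×
              X * X ≤ C * (C * C) * f * (B * (B + suc ((n′ + n′) + (n′ + n′)) * D))) → ⊥
            -- The number X of heavy shifts has X² ≈ p^(4/3), but the bound allows only about
            -- p^(7/6).
            finish (X , many , X²≤) = clash 31974 28033 (mul≥ 15987 15987 X≥ X≥) (≤-trans X²≤ upper)
              where
              XC≥ : pow q 15997 ≤ X * C
              XC≥ = ≮⇒≥ (λ XC< → <⇒≱ (begin-strict
                suc (n′ + n′) * B * 3 + X * C <⟨ +-monoʳ-< (suc (n′ + n′) * B * 3) XC< ⟩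
                suc (n′ + n′) * B * 3 + pow q 15997 ≤⟨ add≤ 15997 (mul≤ 15996 1 (mul≤ 8006 7990 (odd≤ n′ 8005 ≤-refl) ≤-refl) (≤q 3)) ≤-refl ⟩
                pow q 15998 ≤⟨ pow-mono 1≤q (≤ᵇ⇒≤ 15998 15999 _) ⟩
                pow q 15999 ∎) (≤-trans (mul≥ 7990 8009 ≤-refl (mul≥ 7999 10 T≥ ≤-refl)) many))
              X≥ : pow q 15987 ≤ X
              X≥ = *-cancelʳ-≤ (pow q 15987) X C {{pow≢0 10}} (≤-trans (≤-reflexive (pow-+ q 15987 10)) XC≥)
              upper : C * (C * C) * f * (B * (B + suc ((n′ + n′) + (n′ + n′)) * D)) ≤ pow q 28033
              upper = weaken 28031 28033 (mul≤ 12032 15999 (mul≤ 30 12002 (mul≤ 10 20 ≤-refl (mul≤ 10 10 ≤-refl ≤-refl)) ≤-refl)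
                (mul≤ 7990 8009 ≤-refl (add≤ 8008 (weaken 7990 8008 ≤-refl) (mul≤ 8007 1 (odd≤ (n′ + n′) 8006 (add≤ 8005 ≤-refl ≤-refl)) D≤))))

    opaque
      main : length A < pow q 7999
      main = ≰⇒> (λ T≥ → cases T≥ (≤-total t (pow q 15997)))
        where
        cases : pow q 7999 ≤ length A → t ≤ pow q 15997 ⊎ pow q 15997 ≤ t → ⊥
        cases T≥ (inj₁ t≤) = low T≥ (middle T≥ t≤)
        cases T≥ (inj₂ t≥) = high T≥ t≥

open import Defs
open import Data.Nat using (ℕ; _≥_; _<_; _^_; _*_; _∸_; NonZero)
open import Data.Nat.Primality using (Prime)
open import Data.Nat.Coprimality using (Coprime)
open import Data.Integer using (ℤ; +_; ∣_∣)
open import Data.Rational using (ℚ; _/_)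
open import Data.Product using (∃; _×_)

-- Choice of q and passage to the counting function.

module Assembly where

  open Powers
  open Bridge
  open import Data.Nat as ℕ using (suc; z≤n; s≤s; _≤_; _+_)
  import Data.Nat.DivMod as ℕ
  import Data.Nat.Divisibility as ℕ
  open import Data.Nat.Properties
  open import Data.Nat.Primality using (prime⇒nonTrivial)
  import Data.Integer as ℤ
  import Data.Integer.Properties as ℤ
  open import Data.Integer.Divisibility.Signed using (∣ᵤ⇒∣)
  open Counting using (^-distribʳ-*)

  import Data.Rational

  opaque
    -- For the integer root q, the next power already exceeds p: p < (q + 1)^(e+1) ≤ 2^(e+1) q^(e+1)
    -- ≤ q^(e+2), once q ≥ 2^(e+1).
    scale : ∀ e Q p → pow 2 (suc e) ≤ Q → pow Q (suc e) ≤ p →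
      ∃ λ q → Q ≤ q × pow q (suc e) ≤ p × p ≤ pow q (suc (suc e))
    scale e Q p 2^≤Q Q^≤p = build (integer-root e p)
      where
      build : (∃ λ q → q ^ suc e ≤ p × p < suc q ^ suc e) → ∃ λ q → Q ≤ q × pow q (suc e) ≤ p × p ≤ pow q (suc (suc e))
      build (q , lo , hi) = q , Q≤q , subst (_≤ p) (sym (pow-def q (suc e))) lo , subst (p ≤_) (sym (pow-def q (suc (suc e)))) p≤
        where
        open ≤-Reasoning
        Q≤q : Q ≤ q
        Q≤q = ≮⇒≥ (λ q<Q → <⇒≱ hi (≤-trans (^-monoˡ-≤ (suc e) q<Q) (subst (_≤ p) (pow-def Q (suc e)) Q^≤p)))
        1≤q : 1 ≤ q
        1≤q = ≤-trans (≤-trans (pow>0 (suc e) (s≤s z≤n)) 2^≤Q) Q≤q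
        p≤ : p ≤ q ^ suc (suc e)
        p≤ = begin
          p ≤⟨ <⇒≤ hi ⟩
          suc q ^ suc e ≤⟨ ^-monoˡ-≤ (suc e) (+-monoˡ-≤ q 1≤q) ⟩
          (q + q) ^ suc e ≡⟨ cong (λ z → (q + z) ^ suc e) (+-identityʳ q) ⟨
          (2 * q) ^ suc e ≡⟨ ^-distribʳ-* (suc e) 2 q ⟩
          2 ^ suc e * q ^ suc e ≤⟨ *-monoˡ-≤ (q ^ suc e) (≤-trans (≤-reflexive (sym (pow-def 2 (suc e)))) (≤-trans 2^≤Q Q≤q)) ⟩
          q ^ suc (suc e) ∎

  opaque
    -- One summand for each demand on q: the upper bound for p in `scale`, the divisor bound, and
    -- numerical constants such as 36 · 24001.
    Q₀ : ℕ
    Q₀ = pow 2 24000 + (proj₁ (few-divisors 24001) + 1000000)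

    Q₀-pow : pow 2 24000 ≤ Q₀
    Q₀-pow = m≤m+n (pow 2 24000) _

    Q₀-divisors : proj₁ (few-divisors 24001) ≤ Q₀
    Q₀-divisors = ≤-trans (m≤m+n _ 1000000) (m≤n+m _ (pow 2 24000))

    Q₀-large : 1000000 ≤ Q₀
    Q₀-large = ≤-trans (m≤n+m 1000000 (proj₁ (few-divisors 24001))) (m≤n+m _ (pow 2 24000))

  opaque
    -- The exponent (k - 3) / (3 k) is 1/3 - 1/k, so the saving is c = 1/k. What has been proved is
    -- the exponent 7999/24000 = 1/3 - 1/24000, and 24001 is the least k that leaves a strict gap.
    k₀ : ℕ
    k₀ = 24001

    k₀≥1 : k₀ ≥ 1
    k₀≥1 = s≤s z≤n

    -- The comparison of exponents of q left by T < q ^ 7999 and q ^ 24000 ≤ p.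
    exponent-gap : 7999 * (3 * k₀) < 24000 * (k₀ ∸ 3)
    exponent-gap = <ᵇ⇒< (7999 * (3 * 24001)) (24000 * (24001 ∸ 3)) _

  module _ (p : ℕ) (pr : Prime p) (e : ℕ) (λ′ : ℤ) (coprime : Coprime ∣ λ′ ∣ p) (L : ℚ) where

    open ModP p pr
    open Group p pr (suc e) using (t; t≤d; 0^)
    open Interval p pr (suc e)

    d : ℕ
    d = suc e

    N : ℚ
    N = (+ p) / d

    InT′ : ℕ → Set
    InT′ = InT p d λ′ L N

    -- Taking p - 1 makes d n < p strict, and n < p even for d = 1.
    n : ℕ
    n = (p ∸ 1) ℕ./ d

    opaque
      candidates : List ℕ
      candidates = filter (InT? p d λ′ L N) (upTo (suc ∣ Data.Rational.ceiling (L Data.Rational.+ N) ∣))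

      A : List ℤ
      A = map +_ candidates

      length-A : length A ≡ Tp p d λ′ L N
      length-A = length-map +_ candidates

      ∈-A⁻ : ∀ {z} → z ∈ A → ∃ λ x → z ≡ + x × InT′ x
      ∈-A⁻ i = let (x , j , e) = ∈-map⁻ +_ i in
        x , e , proj₂ (∈-filter⁻ (InT? p d λ′ L N) {xs = upTo (suc ∣ Data.Rational.ceiling (L Data.Rational.+ N) ∣)} j)

      A-unique : Unique A
      A-unique = map⁺ ℤ.+-injective (filter⁺ (InT? p d λ′ L N) (upTo⁺ _))

    dn<p : d * n < p
    dn<p = <-≤-trans (s≤s (≤-trans (≤-reflexive (*-comm d n)) (ℕ.m/n*n≤m (p ∸ 1) d)))
      (≤-reflexive (m+[n∸m]≡n {1} {p} (ℕ.>-nonZero⁻¹ p)))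

    gap : ∀ {x y} → y ≤ x → InT′ x → InT′ y → x ∸ y ≤ n
    gap {x} {y} y≤x ((_ , hx) , _) ((hy , _) , _) = begin
      x ∸ y ≡⟨ ℕ.m*n/n≡m (x ∸ y) d ⟨
      (x ∸ y) * d ℕ./ d ≤⟨ ℕ./-monoˡ-≤ d below ⟩
      n ∎
      where
      open ≤-Reasoning
      D[x-y]+D≤p : d * (x ∸ y) + d ≤ p
      D[x-y]+D≤p = +-cancelˡ-≤ (d * y) (d * (x ∸ y) + d) p (begin
        d * y + (d * (x ∸ y) + d) ≡⟨ +-assoc (d * y) (d * (x ∸ y)) d ⟨
        d * y + d * (x ∸ y) + d ≡⟨ cong (_+ d) (*-distribˡ-+ d y (x ∸ y)) ⟨
        d * (y + (x ∸ y)) + d ≡⟨ cong (λ z → d * z + d) (m+[n∸m]≡n y≤x) ⟩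
        d * x + d ≤⟨ spread e p x y L hy hx ⟩
        d * y + p ∎)
      below : (x ∸ y) * d ≤ p ∸ 1
      below = ≤-trans (≤-reflexive (*-comm (x ∸ y) d)) (∸-monoˡ-≤ {suc (d * (x ∸ y))} 1
        (≤-trans (≤-reflexive (+-comm 1 (d * (x ∸ y)))) (≤-trans (+-monoʳ-≤ (d * (x ∸ y)) (s≤s z≤n)) D[x-y]+D≤p)))

    abs-diff : ∀ {x y} → y ≤ x → ∣ + x ℤ.- + y ∣ ≡ x ∸ y
    abs-diff {x} {y} y≤x = cong ∣_∣ (trans (ℤ.m-n≡m⊖n x y) (ℤ.⊖-≥ y≤x))

    power≈λ : ∀ {x} → InT′ x → (+ x) ℤ.^ d ≈ λ′
    power≈λ (_ , h) = mod (∣ᵤ⇒∣ h)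

    hypothesis : CosetInInterval A n
    hypothesis = record
      { unique = A-unique
      ; n<p = ≤-<-trans (m≤n*m n d) dn<p
      ; close = close
      ; unit = unit
      ; coset = coset }
      where
      close : ∀ {x y} → x ∈ A → y ∈ A → ∣ x ℤ.- y ∣ ≤ n
      close i j with ∈-A⁻ i | ∈-A⁻ j
      ... | x , refl , hx | y , refl , hy with ≤-total y x
      ...   | inj₁ y≤x = ≤-trans (≤-reflexive (abs-diff y≤x)) (gap y≤x hx hy)
      ...   | inj₂ x≤y = ≤-trans (≤-reflexive (trans (ℤ.∣i-j∣≡∣j-i∣ (+ x) (+ y)) (abs-diff x≤y))) (gap x≤y hy hx)
      unit : ∀ {x} → x ∈ A → x ≉ ℤ.0ℤ
      unit i x≈0 with ∈-A⁻ i
      ... | x , refl , hx = <⇒≢ (ℕ.nonTrivial⇒n>1 p {{prime⇒nonTrivial pr}})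
        (sym (coprime (≈0⇒∣ (≈-trans (≈-sym (power≈λ hx)) (≈-trans (≈-^ d x≈0) (≈-reflexive (0^ d)))) , ℕ.∣-refl)))
      coset : ∀ {x y} → x ∈ A → y ∈ A → x ℤ.^ d ≈ y ℤ.^ d
      coset i j with ∈-A⁻ i | ∈-A⁻ j
      ... | x , refl , hx | y , refl , hy = ≈-trans (power≈λ hx) (≈-sym (power≈λ hy))

    opaque
      Tp-bound : pow Q₀ 24000 ≤ p → Tp p d λ′ L N ^ (3 * k₀) < p ^ (k₀ ∸ 3)
      Tp-bound large = conclude (scale 23999 Q₀ p Q₀-pow large)
        where
        conclude : (∃ λ q → Q₀ ≤ q × pow q 24000 ≤ p × p ≤ pow q 24001) → Tp p d λ′ L N ^ (3 * k₀) < p ^ (k₀ ∸ 3)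
        conclude (q , Q₀≤q , p≥ , p≤) = finish (proj₂ (few-divisors 24001) q (≤-trans Q₀-divisors Q₀≤q) 1≤q)
          where
          open ≤-Reasoning
          1000000≤q : 1000000 ≤ q
          1000000≤q = ≤-trans Q₀-large Q₀≤q
          2≤q : 2 ≤ q
          2≤q = ≤-trans (m≤m+n 2 999998) 1000000≤q
          1≤q : 1 ≤ q
          1≤q = ≤-trans (n≤1+n 1) 2≤q
          open Bounds 2≤q using (power≤; power≥)
          finish : (∃ λ D → D * D ≤ q × (∀ n .{{_ : NonZero n}} → n ≤ pow q 24001 * pow q 24001 → Divisor.τ n + Divisor.τ n ≤ D)) →
            Tp p d λ′ L N ^ (3 * k₀) < p ^ (k₀ ∸ 3)
          finish (D , D²≤q , few) = begin-strict
            Tp p d λ′ L N ^ (3 * k₀) ≡⟨ cong (_^ (3 * k₀)) length-A ⟨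
            length A ^ (3 * k₀) ≤⟨ power≤ (3 * k₀) 7999 (<⇒≤ (Final.main p pr d 1000000≤q D²≤q few p≥ p≤ hypothesis tn≤p)) ⟩
            pow q (7999 * (3 * k₀)) <⟨ pow-mono-< 2≤q exponent-gap ⟩
            pow q (24000 * (k₀ ∸ 3)) ≤⟨ power≥ (k₀ ∸ 3) 24000 p≥ ⟩
            p ^ (k₀ ∸ 3) ∎
            where
            tn≤p : t * n ≤ p
            tn≤p = ≤-trans (*-monoˡ-≤ n t≤d) (<⇒≤ dn<p)

  bound : ∀ (p : ℕ) → p ≥ pow Q₀ 24000 → Prime p →
    ∀ (d : ℕ) .{{_ : NonZero d}} (λ′ : ℤ) → Coprime ∣ λ′ ∣ p → (L : ℚ) →
    Tp p d λ′ L ((+ p) / d) ^ (3 * k₀) < p ^ (k₀ ∸ 3)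
  bound p large pr (suc e) λ′ coprime L = Tp-bound p pr e λ′ coprime L large

open Powers using (pow)
open Assembly using (k₀; k₀≥1; Q₀; bound)

theorem2 : ∃ λ k → k ≥ 1 × ∃ λ P → ∀ (p : ℕ) → p ≥ P → Prime p →
    ∀ (d : ℕ) .{{_ : NonZero d}} (λ′ : ℤ) → Coprime ∣ λ′ ∣ p → (L : ℚ) →
    Tp p d λ′ L ((+ p) / d) ^ (3 * k) < p ^ (k ∸ 3)
theorem2 = k₀ , k₀≥1 , pow Q₀ 24000 , bound
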